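{- For every integer $t \ge 1$ and every integer $d \ge 2$, the promise problem $\mathrm{Rainbow}\big(td+\lfloor d/2\rfloor,\; t(d-1)+1,\; 2\big)$ is $\mathsf{NP}$-hard.
   Context: A $k$-uniform hypergraph $H=(V,E)$ has hyperedges that are $k$-element subsets of $V$. A (proper) $c$-coloring of $H$ is a map $V\to[c]$ under which no hyperedge is monochromatic. A rainbow $q$-coloring of $H$ is a map $\chi:V\to[q]$ such that for every hyperedge $e\in E$, $\chi(e)=[q]$ (every hyperedge sees all $q$ colors); $H$ is rainbow $q$-colorable if such a coloring exists. For $2\le q\le k$, $\mathrm{Rainbow}(k,q,c)$ is the promise problem: given a $k$-uniform hypergraph $H$, distinguish the Yes case "$H$ is rainbow $q$-colorable" from the No case "$H$ is not (properly) $c$-colorable". -}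

module Defs where

open import Level using (0ℓ)
open import Data.Bool using (Bool; true; false)
open import Data.Fin using (Fin)
open import Data.Fin.Subset using (Subset; _∈_; ∣_∣)
open import Data.List using (List; []; _∷_; [_]; _++_; length; foldr; map; replicate; concatMap)
open import Data.List.Membership.Propositional using () renaming (_∈_ to _∈ₗ_)
open import Data.List.Properties using (∷-injectiveʳ)
open import Data.List.Relation.Unary.All using (All)
open import Data.List.Relation.Unary.Unique.Propositional using (Unique)
open import Data.Maybe using (Maybe; just; nothing)
open import Data.Nat using (ℕ; zero; suc; _+_; _*_; _≤_)
open import Data.Product using (Σ; ∃-syntax; _×_; _,_)
open import Data.Vec as Vec using (Vec; []; _∷_)
open import Function using (_∘_)
open import Function.Bundles using (_⇔_)
open import Relation.Binary.PropositionalEquality using (_≡_; refl; cong)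
open import Relation.Nullary using (¬_)
open import Relation.Unary using (Pred)

data Symbol (g : ℕ) : Set where
  blank : Symbol g
  bit   : Bool → Symbol g
  work  : Fin g → Symbol g

data Move : Set where
  left stay right : Move

-- A two-way infinite tape.  `before` lists the cells to the left of the head,
-- nearest first, and `after` those to its right, nearest first; every cell
-- beyond the two lists is blank.

record Tape (g : ℕ) : Set where
  constructor tape
  field
    before : List (Symbol g)
    head   : Symbol g
    after  : List (Symbol g)

uncons : ∀ {g} → List (Symbol g) → Symbol g × List (Symbol g)
uncons []       = blank , []
uncons (s ∷ ss) = s , ss

moveHead : ∀ {g} → Move → Tape g → Tape g
moveHead left  (tape ls s rs) = let (l , ls′) = uncons ls in tape ls′ l (s ∷ rs)
moveHead stay  τ              = τ
moveHead right (tape ls s rs) = let (r , rs′) = uncons rs in tape (s ∷ ls) r rs′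

writeMove : ∀ {g} → Tape g → Symbol g × Move → Tape g
writeMove τ (s , m) = moveHead m (record τ { head = s })

-- A deterministic machine with one input/output tape and `extra` further
-- tapes.  The machine halts when δ returns `nothing`.

record TM : Set where
  field
    extra   : ℕ
    symbols : ℕ
    states  : ℕ
    start   : Fin states
    δ       : Fin states → Vec (Symbol symbols) (suc extra) →
              Maybe (Fin states × Vec (Symbol symbols × Move) (suc extra))

module _ (M : TM) where
  open TM M

  Config : Set
  Config = Fin states × Vec (Tape symbols) (suc extra)

  step : Config → Maybe Config
  step (q , τs) with δ q (Vec.map Tape.head τs)
  ... | nothing         = nothing
  ... | just (q′ , acts) = just (q′ , Vec.zipWith writeMove τs acts)

  -- The halting configuration reached from c, if it is reached in at most n steps.

  run : ℕ → Config → Maybe Config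
  run n c with step c
  run n       c | nothing = just c
  run zero    c | just c′ = nothing
  run (suc n) c | just c′ = run n c′

  initial : List Bool → Config
  initial x = start , input ∷ Vec.replicate extra (tape [] blank [])
    where
    input : Tape symbols
    input = let (s , ss) = uncons (map bit x) in tape [] s ss

  -- The output is the maximal block of bits on the first tape that starts at
  -- the head and extends to the right.

  leadingBits : List (Symbol symbols) → List Bool
  leadingBits (bit b ∷ ss) = b ∷ leadingBits ss
  leadingBits _            = []

  output : Config → List Bool
  output (_ , tape _ s ss ∷ _) = leadingBits (s ∷ ss)

-- Coefficients are listed from the constant term upwards.

evalPoly : List ℕ → ℕ → ℕ
evalPoly as n = foldr (λ a r → a + n * r) 0 as

PolyTime : (List Bool → List Bool) → Set
PolyTime f =
  ∃[ M ] ∃[ p ] ∀ x → ∃[ c ]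
    run M (evalPoly p (length x)) (initial M x) ≡ just c × output M c ≡ f x

-- Self-delimiting pairing: every bit of x is preceded by `true`, and a `false`
-- marks where u starts.

pair : List Bool → List Bool → List Bool
pair x u = concatMap (λ b → true ∷ b ∷ []) x ++ false ∷ u

Language : Set₁
Language = Pred (List Bool) 0ℓ

NP : Language → Set
NP L =
  Σ (List Bool → Bool) λ V → PolyTime ([_] ∘ V) ×
  ∃[ p ] ∀ x →
    L x ⇔ (∃[ u ] length u ≤ evalPoly p (length x) × V (pair x u) ≡ true)

record PromiseProblem : Set₁ where
  field
    Instance : Set
    encode   : Instance → List Bool
    Yes      : Pred Instance 0ℓ
    No       : Pred Instance 0ℓ

_≤ₚ_ : Language → PromiseProblem → Set
L ≤ₚ Π =
  Σ (List Bool → Instance) λ f → PolyTime (encode ∘ f) ×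
  (∀ x → L x → Yes (f x)) ×
  (∀ x → ¬ L x → No (f x))
  where open PromiseProblem Π

NP-hard : PromiseProblem → Set₁
NP-hard Π = ∀ (L : Language) → NP L → L ≤ₚ Π

-- The edge set is a duplicate-free list, so there are no multiple edges.

record Hypergraph (k : ℕ) : Set where
  field
    order    : ℕ
    edges    : List (Subset order)
    uniform  : All (λ e → ∣ e ∣ ≡ k) edges
    distinct : Unique edges

module _ {k : ℕ} (H : Hypergraph k) where
  open Hypergraph H

  Monochromatic : ∀ {c} → (Fin order → Fin c) → Subset order → Set
  Monochromatic χ e = ∃[ a ] ∀ v → v ∈ e → χ v ≡ a

  IsProperColoring : ∀ {c} → (Fin order → Fin c) → Set
  IsProperColoring χ = ∀ e → e ∈ₗ edges → ¬ Monochromatic χ e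

  Colorable : ℕ → Set
  Colorable c = ∃[ χ ] IsProperColoring {c} χ

  IsRainbowColoring : ∀ {q} → (Fin order → Fin q) → Set
  IsRainbowColoring χ = ∀ e → e ∈ₗ edges → ∀ a → ∃[ v ] v ∈ e × χ v ≡ a

  RainbowColorable : ℕ → Set
  RainbowColorable q = ∃[ χ ] IsRainbowColoring {q} χ

-- The number of vertices in unary, followed by the incidence vectors of the
-- edges, each preceded by `true`; `false` closes both parts.

encodeEdges : ∀ {n} → List (Subset n) → List Bool
encodeEdges []       = [ false ]
encodeEdges (e ∷ es) = true ∷ Vec.toList e ++ encodeEdges es

encodeIncidence : ∀ n → List (Subset n) → List Bool
encodeIncidence n es = replicate n true ++ false ∷ encodeEdges es

encodeHypergraph : ∀ {k} → Hypergraph k → List Bool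
encodeHypergraph H = encodeIncidence order edges
  where open Hypergraph H

encodeIncidence-injective :
  ∀ {m n} {es : List (Subset m)} {fs : List (Subset n)} →
  encodeIncidence m es ≡ encodeIncidence n fs →
  _≡_ {A = Σ ℕ (List ∘ Subset)} (m , es) (n , fs)
encodeIncidence-injective {es = es} {fs} = λ eq →
  let (m≡n , rest) = unary _ _ eq in finish m≡n rest
  where
  unary : ∀ m n {xs ys} →
          replicate m true ++ false ∷ xs ≡ replicate n true ++ false ∷ ys →
          m ≡ n × xs ≡ ys
  unary zero    zero    refl = refl , refl
  unary (suc m) (suc n) eq   with unary m n (∷-injectiveʳ eq)
  ... | refl , xs≡ys = refl , xs≡ys

  block : ∀ {n} (e f : Subset n) {xs ys} →
          Vec.toList e ++ xs ≡ Vec.toList f ++ ys → e ≡ f × xs ≡ ys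
  block []      []      eq = refl , eq
  block (a ∷ e) (b ∷ f) eq with block e f (∷-injectiveʳ eq) | eq
  ... | refl , refl | refl = refl , refl

  blocks : ∀ {n} (es fs : List (Subset n)) →
           encodeEdges es ≡ encodeEdges fs → es ≡ fs
  blocks []       []       _  = refl
  blocks (e ∷ es) (f ∷ fs) eq with block e f (∷-injectiveʳ eq)
  ... | refl , rest = cong (e ∷_) (blocks es fs rest)

  finish : ∀ {m n} {es : List (Subset m)} {fs : List (Subset n)} →
           m ≡ n → encodeEdges es ≡ encodeEdges fs →
           _≡_ {A = Σ ℕ (List ∘ Subset)} (m , es) (n , fs)
  finish refl eq = cong (_ ,_) (blocks _ _ eq)

Rainbow : (k q c : ℕ) → PromiseProblem
Rainbow k q c = record
  { Instance = Hypergraph k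
  ; encode   = encodeHypergraph
  ; Yes      = λ H → RainbowColorable H q
  ; No       = λ H → ¬ Colorable H c
  }

{-# OPTIONS --safe #-}

-- A verifier for L is turned into a binary constraint system, its tableau.  Every
-- small tuple u of variables gets a long code: the vertices are the functions
-- from the assignments of u to the q colours, and k vertices form an edge if they
-- show all colours at every locally valid assignment.  A solution makes the
-- hypergraph rainbow q-colourable, by evaluation.
--
-- Conversely, a proper 2-colouring yields for every u a short list of assignments.
-- On a palette of d colours, d points of one colour c can be found that show the
-- whole palette except at ⌊d/2⌋ assignments, where one colour is lost each; these
-- exceptions form the list of u.  Since t palettes with the same c cover all
-- t(d - 1) + 1 colours, points taken from t tuples whose lists are incompatible
-- form an edge as soon as ⌊d/2⌋ further points supply the lost colours.  So one
-- of the latter must have the other colour however it is chosen where nothing is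
-- lost, and combining q + 1 such constraints gives a monochromatic edge.  Hence
-- boundedly many tuples have pairwise incompatible lists, and a combinatorial
-- argument (a substitute for the PCP theorem) extracts a solution.
module Submission where

open import Defs
open import Data.Bool using (Bool; true; false; not; if_then_else_; _∧_; _∨_)
import Data.Bool.Properties as Boolₚ
open import Data.Empty using (⊥; ⊥-elim)
open import Data.Fin as Fin using (Fin; zero; suc; toℕ; punchIn; punchOut; combine; remQuot)
open import Data.Fin.Subset using (Subset; ∣_∣) renaming (_∈_ to _∈ˢ_)
import Data.Fin.Properties as Finₚ
open import Data.List as List using (List; []; _∷_; [_]; _++_; length; map; concat; concatMap; filter; allFin; take; drop; cartesianProductWith)
import Data.List.Properties as Listₚ
open import Data.List.Membership.Propositional using (_∈_; _∉_; find)
import Data.List.Membership.Propositional.Properties as ∈ₚ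
open import Data.List.Relation.Binary.Subset.Propositional using (_⊆_)
import Data.List.Relation.Binary.Subset.Propositional.Properties as ⊆ₚ
open import Data.List.Relation.Unary.All as All using (All; []; _∷_)
import Data.List.Relation.Unary.All.Properties as Allₚ
open import Data.List.Relation.Unary.AllPairs as AllPairs using (AllPairs; []; _∷_)
import Data.List.Relation.Unary.AllPairs.Properties as AllPairsₚ
open import Data.List.Relation.Unary.Any as Any using (Any; here; there)
import Data.List.Relation.Unary.Any.Properties as Anyₚ
open import Data.List.Relation.Binary.Pointwise as Pointwise using (Pointwise; []; _∷_)
import Data.List.Relation.Binary.Permutation.Propositional as ↭
open ↭ using (_↭_)
import Data.List.Relation.Binary.Permutation.Propositional.Properties as ↭ₚ
open import Data.List.Relation.Unary.Unique.Propositional using (Unique)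
import Data.List.Relation.Unary.Unique.Propositional.Properties as Uniqueₚ
open import Data.Maybe using (Maybe; just; nothing)
open import Data.Nat hiding (_≟_)
open import Data.Nat.Properties hiding (_≟_)
open import Data.Nat.Tactic.RingSolver using (solve-∀)
import Data.Nat.Properties as ℕₚ
open import Data.Product using (∃; ∃-syntax; _×_; _,_; proj₁; proj₂)
import Data.Product.Properties as ×ₚ
open import Data.Sum using (_⊎_; inj₁; inj₂)
open import Data.Unit using (⊤; tt)
open import Data.Vec as Vec using (Vec; []; _∷_; lookup)
import Data.Vec.Properties as Vecₚ
open import Function using (_∘_; id; case_of_; flip)
open import Function.Bundles using (Equivalence; mk⇔)
open import Relation.Binary using (DecidableEquality)
open import Relation.Binary.PropositionalEquality hiding ([_])
open import Relation.Nullary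
open import Relation.Nullary.Decidable using (dec-true; dec-false; does-⇔) renaming (¬¬-excluded-middle to em)

-- The No case asks only for a contradiction, so the combinatorial argument can run under double
-- negation, where excluded middle is available. Quantifiers over finite types commute with double
-- negation, which is why colours, assignments and variables all come with complete lists.
--
-- The uniformity is explained by two counts. A block of `t` palettes spends `t * d` points, and at
-- a valid assignment only one of its palettes can lose colours, since the tuples of the others are
-- incompatible with it; hence `⌊d /2⌋` extra points are enough, although a tuple may have up to
-- `t * ⌊d /2⌋` exceptional assignments. In the other colour, `q + 1` points must fit into one edge,
-- and `k` exceeds `q` because `⌊d /2⌋` is positive.
--
-- The PCP theorem can be avoided because short lists are available for all sets of at most `m`
-- variables, not just for single constraints, and `m` may be chosen after the length `κ` of the
-- lists and the size `ℓ` of the forbidden families, which depend on `t` and `d` only. The price is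
-- a code on very many variables, but their number is constant, so the hypergraph remains of
-- polynomial size.

infixl 1 _>>=_
_>>=_ : ∀ {a b} {A : Set a} {B : Set b} → ¬ ¬ A → (A → ¬ ¬ B) → ¬ ¬ B
(m >>= f) k = m λ a → f a k

return : ∀ {a} {A : Set a} → A → ¬ ¬ A
return a k = k a

all-¬¬ : ∀ {a p} {A : Set a} {P : A → Set p} {xs} → All (λ x → ¬ ¬ P x) xs → ¬ ¬ All P xs
all-¬¬ []         = return []
all-¬¬ (px ∷ pxs) = do
  px′  ← px
  pxs′ ← all-¬¬ pxs
  return (px′ ∷ pxs′)

for-each : ∀ {a p} {A : Set a} {P : A → Set p} xs → (∀ x → ¬ ¬ P x) → ¬ ¬ All P xs
for-each xs f = all-¬¬ (All.universal f xs)

-- Pigeonhole principle and finite enumerations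

split-witness : ∀ {A T : Set} {P : T → A → Set} {R : A → A → Set} {τ τs} (xs : List A) →
  AllPairs R xs → All (λ x → ∃[ σ ] σ ∈ τ ∷ τs × P σ x) xs →
  ∃[ ys ] ∃[ zs ] (ys ⊆ xs × zs ⊆ xs) × length xs ≡ length ys + length zs ×
    (AllPairs R ys × AllPairs R zs) × All (P τ) ys × All (λ x → ∃[ σ ] σ ∈ τs × P σ x) zs
split-witness []       []       []       = [] , [] , (id , id) , refl , ([] , []) , [] , []
split-witness (x ∷ xs) (r ∷ rs) (w ∷ ws) with split-witness xs rs ws
... | ys , zs , (ys⊆ , zs⊆) , eq , (rys , rzs) , pys , wzs with w
... | _ , here refl , p =
  x ∷ ys , zs , (⊆ₚ.∷⁺ʳ x ys⊆ , there ∘ zs⊆) , cong suc eq , (⊆ₚ.All-resp-⊇ ys⊆ r ∷ rys , rzs) , p ∷ pys , wzs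
... | σ , there σ∈ , p =
  ys , x ∷ zs , (there ∘ ys⊆ , ⊆ₚ.∷⁺ʳ x zs⊆) , trans (cong suc eq) (sym (+-suc _ _)) ,
  (rys , ⊆ₚ.All-resp-⊇ zs⊆ r ∷ rzs) , pys , (σ , σ∈ , p) ∷ wzs

-- Either the class of the first label already has more than `n` members, or removing it loses one
-- label and at most `n` items. The class is split off in the order of `xs`, so that `AllPairs R`
-- survives and the principle can be applied repeatedly.
pigeonhole : ∀ {A T : Set} {P : T → A → Set} {R : A → A → Set} (τs : List T) (xs : List A) n →
  AllPairs R xs → All (λ x → ∃[ σ ] σ ∈ τs × P σ x) xs → length τs * n < length xs →
  ∃[ τ ] ∃[ ys ] ys ⊆ xs × AllPairs R ys × All (P τ) ys × n < length ys
pigeonhole []       (x ∷ xs) n rs ((_ , () , _) ∷ _) lt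
pigeonhole (τ ∷ τs) xs       n rs ws lt with split-witness xs rs ws
... | ys , zs , (ys⊆ , zs⊆) , eq , (rys , rzs) , pys , wzs with n <? length ys
... | yes n<  = τ , ys , ys⊆ , rys , pys , n<
... | no  n≮  =
  let (σ , vs , vs⊆ , rest) = pigeonhole τs zs n rzs wzs
        (+-cancelˡ-< n _ _ (≤-trans (subst (n + length τs * n <_) eq lt) (+-monoˡ-≤ _ (≮⇒≥ n≮))))
  in σ , vs , zs⊆ ∘ vs⊆ , rest

-- The head varies fastest. This is the order in which nested loops run through the environments
-- when the innermost loop binds the variable zero, as `⟦forⁿ⟧` needs.
allVec : ∀ {A : Set} → List A → ∀ n → List (Vec A n)
allVec xs zero    = [ [] ]
allVec xs (suc n) = cartesianProductWith (flip _∷_) (allVec xs n) xs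

allVec-complete : ∀ {A : Set} {xs : List A} → (∀ x → x ∈ xs) → ∀ {n} (v : Vec A n) → v ∈ allVec xs n
allVec-complete complete []      = here refl
allVec-complete complete (x ∷ v) = ∈ₚ.∈-cartesianProductWith⁺ (flip _∷_) (allVec-complete complete v) (complete x)

length-cartesianProductWith : ∀ {A B C : Set} (f : A → B → C) xs ys →
  length (cartesianProductWith f xs ys) ≡ length xs * length ys
length-cartesianProductWith f []       ys = refl
length-cartesianProductWith f (x ∷ xs) ys = trans (Listₚ.length-++ (map (f x) ys))
  (cong₂ _+_ (Listₚ.length-map (f x) ys) (length-cartesianProductWith f xs ys))

length-allVec : ∀ {A : Set} (xs : List A) n → length (allVec xs n) ≡ length xs ^ n
length-allVec xs zero    = refl
length-allVec xs (suc n) = trans (length-cartesianProductWith (flip _∷_) (allVec xs n) xs)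
  (trans (cong (_* length xs) (length-allVec xs n)) (*-comm (length xs ^ n) (length xs)))

vec-ext : ∀ {A : Set} {n} {v w : Vec A n} → (∀ i → lookup v i ≡ lookup w i) → v ≡ w
vec-ext {v = v} {w} eq = trans (sym (Vecₚ.tabulate∘lookup v)) (trans (Vecₚ.tabulate-cong eq) (Vecₚ.tabulate∘lookup w))

nthOr : ∀ {A : Set} → A → List A → ℕ → A
nthOr a []       _       = a
nthOr a (x ∷ xs) zero    = x
nthOr a (x ∷ xs) (suc i) = nthOr a xs i

nthOr-index : ∀ {A : Set} {a x : A} {xs} (x∈ : x ∈ xs) → nthOr a xs (toℕ (Any.index x∈)) ≡ x
nthOr-index (here refl) = refl
nthOr-index (there x∈)  = nthOr-index x∈

-- The gap theorem

module Constants (δ κ : ℕ) where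

  -- The price of fixing `c` assignments at one more variable: the variable itself and, for each of
  -- the `δ ^ c` value vectors there, an obstruction of size at most `s`.
  grow : ℕ → ℕ → ℕ
  grow c s = suc (δ ^ c * s)

  growⁿ : ℕ → ℕ → ℕ → ℕ
  growⁿ c zero    s = s
  growⁿ c (suc n) s = growⁿ c n (grow c s)

  -- The reserve for `r` more splittings in `Rigid.rigid`. A round may have to add an arbitrary
  -- variable, or two variables for each of the `c` assignments, and must leave `level c r`.
  level : ℕ → ℕ → ℕ
  level c zero    = 0
  level c (suc r) = growⁿ c (c * 2) (grow c (level c r))

  -- The recursion of `Count.count`: with `suc j` free entries, a pigeonhole is one of these entries
  -- together with one of at most `κ` listed assignments.
  bound : ℕ → ℕ
  bound zero    = 1
  bound (suc j) = suc (suc j * κ * bound j)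

  -- A set of at most `τ c` variables is adjoined, each paid for by one `grow`; above it
  -- `bound (suc c)` splittings must still be possible.
  τ : ℕ → ℕ
  τ zero    = 0
  τ (suc c) = growⁿ (suc c) (τ c) (level (suc c) (bound (suc c)))

  -- At each descent the witnesses of `suc (bound (suc c))` tuples are united, which multiplies the
  -- bound `α` on their size by this number.
  req : ℕ → ℕ → ℕ
  req zero    α = α
  req (suc c) α = req c (suc (bound (suc c)) * α)

  s≤s*δ : 1 ≤ δ → ∀ c s → s ≤ δ ^ c * s
  s≤s*δ 1≤δ c s = ≤-trans (≤-reflexive (sym (*-identityˡ s))) (*-monoˡ-≤ s (m^n>0 δ ⦃ >-nonZero 1≤δ ⦄ c))

  s≤grow : 1 ≤ δ → ∀ c s → s ≤ grow c s
  s≤grow 1≤δ c s = m≤n⇒m≤1+n (s≤s*δ 1≤δ c s)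

  growⁿ-monoʳ : ∀ c n {s s′} → s ≤ s′ → growⁿ c n s ≤ growⁿ c n s′
  growⁿ-monoʳ c zero    s≤s′ = s≤s′
  growⁿ-monoʳ c (suc n) s≤s′ = growⁿ-monoʳ c n (s≤s (*-monoʳ-≤ (δ ^ c) s≤s′))

  growⁿ-monoˡ : 1 ≤ δ → ∀ c {n n′} s → n ≤ n′ → growⁿ c n s ≤ growⁿ c n′ s
  growⁿ-monoˡ 1≤δ c {n′ = zero}   s z≤n = ≤-refl
  growⁿ-monoˡ 1≤δ c {n′ = suc n′} s z≤n = ≤-trans (s≤grow 1≤δ c s) (growⁿ-monoˡ 1≤δ c {0} {n′} (grow c s) z≤n)
  growⁿ-monoˡ 1≤δ c s (s≤s n≤n′) = growⁿ-monoˡ 1≤δ c (grow c s) n≤n′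

  α≤req : ∀ c α → α ≤ req c α
  α≤req zero    α = ≤-refl
  α≤req (suc c) α = ≤-trans (m≤m+n α _) (α≤req c _)

-- Fix an unsatisfiable binary constraint system and, for every small set U of
-- variables, a short list L U of assignments that are valid on U.  Then there
-- are arbitrarily many sets above a common T whose lists disagree on T.
-- Otherwise each T would be hit by boundedly many assignments; taking the
-- least number c of assignments for which this persists, the hitting tuples
-- are bounded in number, hence some tuple has unique extensions, and these
-- define c global assignments, one of which must be a solution.

module Gap
  {X D : Set} (_≟_ : DecidableEquality X) (allX : List X) (allX-complete : ∀ x → x ∈ allX)
  (_≟ᴰ_ : DecidableEquality D) (allD : List D) (allD-complete : ∀ d → d ∈ allD) (d₀ : D)
  (Ok : X → X → D → D → Set)
  (L : List X → List (X → D)) (κ ℓ m : ℕ)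
  (length-L : ∀ U → length (L U) ≤ κ)
  (L-valid : ∀ {U b} → length U ≤ m → b ∈ L U → ∀ {x y} → x ∈ U → y ∈ U → Ok x y (b x) (b y))
  (no-family : ∀ T Us → All (λ U → T ⊆ U × length U ≤ m) Us →
    AllPairs (λ U U′ → ∀ {b b′ : X → D} → b ∈ L U → b′ ∈ L U′ → ¬ (∀ y → y ∈ T → b y ≡ b′ y)) Us →
    length Us ≡ ℓ → ⊥)
  (unsat : ∀ (g : X → D) → (∀ x y → Ok x y (g x) (g y)) → ⊥)
  where

  open Constants (length allD) κ

  Asg : Set
  Asg = X → D

  infix 4 _≈[_]_
  _≈[_]_ : Asg → List X → Asg → Set
  g ≈[ T ] g′ = ∀ y → y ∈ T → g y ≡ g′ y

  Tup : ℕ → Set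
  Tup c = Fin c → Asg

  infix 4 _≋[_]_
  _≋[_]_ : ∀ {c} → Tup c → List X → Tup c → Set
  G ≋[ T ] G′ = ∀ i → G i ≈[ T ] G′ i

  Hit : ∀ {c} → List X → Tup c → List X → Set
  Hit T G U = ∃[ b ] b ∈ L U × ∃[ i ] b ≈[ T ] G i

  HitAbove : ∀ {c} → List X → List X → Tup c → Set
  HitAbove A T G = ∀ U → A ⊆ U → length U ≤ m → ¬ ¬ Hit T G U

  -- `HitAbove` survives any enlargement of `A`, so the witnesses of several tuples can be merged
  -- into one; only the size bound `α` suffers.
  Ehit : ∀ α T {c} → Tup c → Set
  Ehit α T G = ∃[ A ] T ⊆ A × length A ≤ α × HitAbove A T G

  HitAbove-restrict : ∀ {c A T T′} {G G′ : Tup c} → T ⊆ T′ → G ≋[ T ] G′ → HitAbove A T′ G → HitAbove A T G′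
  HitAbove-restrict T⊆ G≋ hit U A⊆U U≤ = do
    (b , b∈ , i , b≈) ← hit U (λ {x} → A⊆U {x}) U≤
    return (b , b∈ , i , λ y y∈ → trans (b≈ y (T⊆ y∈)) (G≋ i y y∈))

  Ehit-restrict : ∀ {c α T T′} {G G′ : Tup c} → T ⊆ T′ → G ≋[ T ] G′ → Ehit α T′ G → Ehit α T G′
  Ehit-restrict T⊆ G≋ (A , T⊆A , A≤ , hit) = A , T⊆A ∘ T⊆ , A≤ , HitAbove-restrict T⊆ G≋ hit

  K : ℕ
  K = ℓ * κ

  -- By `no-family`, collecting sets whose lists disagree on `T` must stop before `ℓ` of them.
  -- Maximality then says that every other list agrees on `T` with a collected assignment.
  greedy : ∀ T n Us → All (λ U → T ⊆ U × length U ≤ m) Us →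
    AllPairs (λ U U′ → ∀ {b b′} → b ∈ L U → b′ ∈ L U′ → ¬ (b ≈[ T ] b′)) Us → n + length Us ≡ ℓ →
    ¬ ¬ (∃[ Us′ ] length Us′ ≤ ℓ × ∀ U → T ⊆ U → length U ≤ m →
          ¬ ¬ (∃[ b ] b ∈ L U × ∃[ b′ ] b′ ∈ concatMap L Us′ × b ≈[ T ] b′))
  greedy T zero    Us above disj eq = ⊥-elim (no-family T Us above disj eq)
  greedy T (suc n) Us above disj eq = do
    no none ← em {A = ∃[ U ] T ⊆ U × length U ≤ m × ¬ (∃[ b ] b ∈ L U × ∃[ b′ ] b′ ∈ concatMap L Us × b ≈[ T ] b′)}
      where yes (U , T⊆U , U≤ , free) → greedy T n (U ∷ Us) ((T⊆U , U≤) ∷ above)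
              (All.tabulate (λ U′∈ b∈ b′∈ b≈b′ → free (_ , b∈ , _ , ∈ₚ.∈-concatMap⁺ L (Any.map (λ { refl → b′∈ }) U′∈) , b≈b′)) ∷ disj)
              (trans (+-suc n _) eq)
    return (Us , ≤-trans (m≤n+m _ (suc n)) (≤-reflexive eq) , λ U T⊆U U≤ ¬hit → none (U , (λ {x} → T⊆U {x}) , U≤ , ¬hit))

  length-concatMap-L : ∀ Us → length (concatMap L Us) ≤ length Us * κ
  length-concatMap-L []       = z≤n
  length-concatMap-L (U ∷ Us) = ≤-trans (≤-reflexive (Listₚ.length-++ (L U))) (+-mono-≤ (length-L U) (length-concatMap-L Us))

  base : ∀ α T → length T ≤ α → ¬ ¬ (∃ λ (G : Tup K) → Ehit α T G)
  base α T T≤ = do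
    (Us , Us≤ , hit) ← greedy T ℓ [] [] [] (+-identityʳ ℓ)
    return (_ , witness Us Us≤ hit)
    where
    witness : ∀ Us → length Us ≤ ℓ →
      (∀ U → T ⊆ U → length U ≤ m → ¬ ¬ (∃[ b ] b ∈ L U × ∃[ b′ ] b′ ∈ concatMap L Us × b ≈[ T ] b′)) →
      Ehit α T {K} (λ i → nthOr (λ _ → d₀) (concatMap L Us) (toℕ i))
    witness Us Us≤ hit = T , id , T≤ , λ U T⊆U U≤ → do
      (b , b∈ , b′ , b′∈ , b≈b′) ← hit U (λ {x} → T⊆U {x}) U≤
      return (b , b∈ , Fin.inject≤ (Any.index b′∈) gs≤ , λ y y∈ → trans (b≈b′ y y∈)
        (sym (cong (λ g → g y) (trans (cong (nthOr (λ _ → d₀) (concatMap L Us)) (Finₚ.toℕ-inject≤ (Any.index b′∈) gs≤))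
              (nthOr-index b′∈)))))
      where
      gs≤ = ≤-trans (length-concatMap-L Us) (*-monoˡ-≤ κ Us≤)

  -- Hitting on `T` says nothing about values elsewhere. The reserve of `s` further variables allows
  -- a tuple to be grown point by point while hitting is maintained.
  Pers : ∀ {c} → ℕ → ℕ → List X → Tup c → Set
  Pers α s T G = ∀ Y → length Y ≤ s → ¬ ¬ (∃[ G′ ] G ≋[ T ] G′ × Ehit α (Y ++ T) G′)

  Pers-restrict : ∀ {c α s s′ T T′} {G : Tup c} → T ⊆ T′ → s ≤ s′ → Pers α s′ T′ G → Pers α s T G
  Pers-restrict T⊆ s≤ pers Y Y≤ = do
    (G′ , G≋ , hit) ← pers Y (≤-trans Y≤ s≤)
    return (G′ , (λ i y → G≋ i y ∘ T⊆) , Ehit-restrict (⊆ₚ.++⁺ʳ Y T⊆) (λ _ _ _ → refl) hit)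

  Pers⇒Ehit : ∀ {c α s T} {G : Tup c} → Pers α s T G → ¬ ¬ Ehit α T G
  Pers⇒Ehit pers = do
    (G′ , G≋ , hit) ← pers [] z≤n
    return (Ehit-restrict id (λ i y y∈ → sym (G≋ i y y∈)) hit)

  update : ∀ {c} → Tup c → X → Vec D c → Tup c
  update G x v i y with y ≟ x
  ... | yes _ = lookup v i
  ... | no  _ = G i y

  update-≋ : ∀ {c T x} {G G′ : Tup c} → G ≋[ T ] G′ → update G x (Vec.tabulate (λ i → G′ i x)) ≋[ x ∷ T ] G′
  update-≋ {x = x} {G′ = G′} G≋ i y y∈ with y ≟ x
  ... | yes refl = Vecₚ.lookup∘tabulate (λ i → G′ i x) i
  ... | no  y≢x  with y∈
  ... | here y≡x  = ⊥-elim (y≢x y≡x)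
  ... | there y∈T = G≋ i y y∈T

  -- If every value vector at `x` failed, the obstructions together with `x` would be small enough
  -- for `pers`. The tuple obtained there takes one of the failed vectors at `x`, yet hits on its
  -- obstruction.
  extend : ∀ {c α s T} {G : Tup c} → Pers α (grow c s) T G → ∀ x → ¬ ¬ (∃[ G′ ] G ≋[ T ] G′ × Pers α s (x ∷ T) G′)
  extend {c} {α} {s} {T} {G} pers x = do
    (Y , Y≤ , all) ← collect (allVec allD c)
    (G′ , G≋ , hit) ← pers (x ∷ Y) (s≤s (≤-trans Y≤ (≤-reflexive (cong (_* s) (length-allVec allD c)))))
    let u≋ = update-≋ {G = G} {G′} G≋
    inj₁ p ← return (All.lookup all (allVec-complete allD-complete (Vec.tabulate (λ i → G′ i x))))
      where inj₂ fails → ⊥-elim (fails G′ u≋ (Ehit-restrict (Y++x∷T⊆ Y) (λ _ _ _ → refl) hit))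
    return (_ , (λ i y y∈ → trans (G≋ i y y∈) (sym (u≋ i y (there y∈)))) , p)
    where
    Y++x∷T⊆ : ∀ Y → Y ++ x ∷ T ⊆ x ∷ Y ++ T
    Y++x∷T⊆ Y z∈ with ∈ₚ.∈-++⁻ Y z∈
    ... | inj₁ z∈Y         = there (∈ₚ.∈-++⁺ˡ z∈Y)
    ... | inj₂ (here refl) = here refl
    ... | inj₂ (there z∈T) = there (∈ₚ.∈-++⁺ʳ Y z∈T)

    Fails : List X → Vec D c → Set
    Fails Y v = ∀ G′ → update G x v ≋[ x ∷ T ] G′ → ¬ Ehit α (Y ++ x ∷ T) G′

    collect : ∀ vs → ¬ ¬ (∃[ Y ] length Y ≤ length vs * s × All (λ v → Pers α s (x ∷ T) (update G x v) ⊎ Fails Y v) vs)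
    collect []       = return ([] , z≤n , [])
    collect (v ∷ vs) = do
      (Y , Y≤ , all) ← collect vs
      no ¬p ← em {A = ∃[ Y ] length Y ≤ s × Fails Y v}
        where yes (Yᵥ , Yᵥ≤ , fails) →
                return (Yᵥ ++ Y , ≤-trans (≤-reflexive (Listₚ.length-++ Yᵥ)) (+-mono-≤ Yᵥ≤ Y≤) ,
                  inj₂ (weaken (⊆ₚ.xs⊆xs++ys Yᵥ Y) {v} fails) ∷ All.map (λ { (inj₁ p) → inj₁ p ; {v′} (inj₂ f) → inj₂ (weaken
                        (⊆ₚ.xs⊆ys++xs Y Yᵥ) {v′} f) }) all)
      return (Y , ≤-trans Y≤ (m≤n+m _ s) , inj₁ (λ Y Y≤ ¬ext → ¬p (Y , Y≤ , λ G′ G≋ hit → ¬ext (G′ , G≋ , hit))) ∷ all)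
      where
      weaken : ∀ {Y Y′} → Y ⊆ Y′ → ∀ {v} → Fails Y v → Fails Y′ v
      weaken Y⊆ fails G′ u≋ hit = fails G′ u≋ (Ehit-restrict (⊆ₚ.++⁺ˡ (x ∷ T) Y⊆) (λ _ _ _ → refl) hit)

  extendⁿ : ∀ {c α s T} {G : Tup c} Y → Pers α (growⁿ c (length Y) s) T G → ¬ ¬ (∃[ G′ ] G ≋[ T ] G′ × Pers α s (Y ++ T) G′)
  extendⁿ []      pers = return (_ , (λ _ _ _ → refl) , pers)
  extendⁿ (x ∷ Y) pers = do
    (G₁ , G≋₁ , pers₁) ← extendⁿ Y pers
    (G₂ , G≋₂ , pers₂) ← extend pers₁ x
    return (G₂ , (λ i y y∈ → trans (G≋₁ i y y∈) (G≋₂ i y (∈ₚ.∈-++⁺ʳ Y y∈))) , pers₂)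

  -- Tuples that all hit and cannot be shortened are few: at a set U missed by
  -- all but one entry, every tuple hits through one of the remaining entries,
  -- and pigeonhole makes another entry constant.
  module Count (c : ℕ) (T A : List X) (incompressible : ∀ (H : Tup c) → ¬ HitAbove A T H) where

    count : ∀ j (rest : List (Fin (suc c))) (G₀ : Tup (suc c)) 𝒢 → length rest ≤ j →
      AllPairs (λ G G′ → ¬ (G ≋[ T ] G′)) 𝒢 → All (HitAbove A T) 𝒢 →
      All (λ G → ∀ i → i ∉ rest → G i ≈[ T ] G₀ i) 𝒢 → bound j < length 𝒢 → ⊥
    count j [] G₀ (G ∷ [])      _ _ _ _ lt = <-irrefl refl (≤-trans lt (bound>0 j))
      where
      bound>0 : ∀ j → 1 ≤ bound j
      bound>0 zero    = ≤-refl
      bound>0 (suc j) = s≤s z≤n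
    count j [] G₀ (G ∷ G′ ∷ 𝒢) _ ((G≉G′ ∷ _) ∷ _) _ (eq ∷ eq′ ∷ _) _ =
      G≉G′ λ i y y∈ → trans (eq i (λ ()) y y∈) (sym (eq′ i (λ ()) y y∈))
    -- Without entry `i₀`, `G₀` has `c` functions, which miss some `U` above `A`. No entry outside
    -- `rest` can hit there, as it agrees with an entry of `G₀` other than `i₀`. So every tuple hits
    -- through an entry in `rest`, and one such entry is the same on `T` for many tuples.
    count (suc j) rest@(i₀ ∷ _) G₀ 𝒢 rest≤ distinct hits fixed lt = missed λ { (U , A⊆U , U≤ , ¬hit) →
      all-¬¬ (All.map (λ { {G} (hit , fix) → witness U ¬hit G (hit U (λ {x} → A⊆U {x}) U≤) fix }) (All.zip (hits , fixed))) λ ws →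
      let ((i , b) , 𝒢′ , 𝒢′⊆ , distinct′ , all-b , lt′) =
            pigeonhole (List.cartesianProduct rest (L U)) 𝒢 (bound j) distinct ws
              (≤-trans (s≤s (≤-trans (*-monoˡ-≤ (bound j)
                (≤-trans (≤-reflexive (length-cartesianProductWith _,_ rest (L U))) (*-mono-≤ rest≤ (length-L U)))) (n≤1+n _))) lt)
      in recurse i b 𝒢′ all-b distinct′ (⊆ₚ.All-resp-⊇ 𝒢′⊆ hits) (⊆ₚ.All-resp-⊇ 𝒢′⊆ fixed) lt′ }
      where
      missed : ¬ ¬ (∃[ U ] A ⊆ U × length U ≤ m × ¬ Hit T (G₀ ∘ punchIn i₀) U)
      missed k = incompressible (G₀ ∘ punchIn i₀) λ U A⊆U U≤ ¬hit → k (U , (λ {x} → A⊆U {x}) , U≤ , ¬hit)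

      witness : ∀ U → ¬ Hit T (G₀ ∘ punchIn i₀) U → ∀ G → ¬ ¬ Hit T G U → (∀ i → i ∉ rest → G i ≈[ T ] G₀ i) →
        ¬ ¬ (∃ λ σ → σ ∈ List.cartesianProduct rest (L U) × proj₂ σ ≈[ T ] G (proj₁ σ) × proj₁ σ ∈ rest)
      witness U ¬hit G hit fix = do
        (b , b∈ , i , b≈) ← hit
        yes i∈ ← em {A = i ∈ rest}
          where no i∉ → ⊥-elim (¬hit (b , b∈ , punchOut {i = i₀} {i} (λ i₀≡i → i∉ (here (sym i₀≡i))) ,
                  λ y y∈ → trans (trans (b≈ y y∈) (fix i i∉ y y∈)) (cong (λ i → G₀ i y) (sym (Finₚ.punchIn-punchOut _)))))
        return ((i , b) , ∈ₚ.∈-cartesianProduct⁺ i∈ b∈ , b≈ , i∈)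

      recurse : ∀ i b 𝒢′ → All (λ G → b ≈[ T ] G i × i ∈ rest) 𝒢′ → AllPairs (λ G G′ → ¬ (G ≋[ T ] G′)) 𝒢′ →
        All (HitAbove A T) 𝒢′ → All (λ G → ∀ i → i ∉ rest → G i ≈[ T ] G₀ i) 𝒢′ → bound j < length 𝒢′ → ⊥
      recurse i b 𝒢′@(_ ∷ _) all-b@((_ , i∈) ∷ _) distinct′ hits′ fixed′ lt′ =
        count j rest′ G₁ 𝒢′ (≤-pred (≤-trans (Listₚ.filter-notAll (λ z → ¬? (z Finₚ.≟ i)) rest (Any.map
              (λ { refl ¬≡ → ¬≡ refl }) i∈)) rest≤)) distinct′ hits′
          (All.map (λ { {G} ((b≈ , _) , fix) → agree G b≈ fix }) (All.zip (all-b , fixed′))) lt′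
        where
        rest′ = filter (λ z → ¬? (z Finₚ.≟ i)) rest

        G₁ : Tup (suc c)
        G₁ i′ with i′ Finₚ.≟ i
        ... | yes _ = b
        ... | no  _ = G₀ i′

        agree : ∀ G → b ≈[ T ] G i → (∀ i → i ∉ rest → G i ≈[ T ] G₀ i) → ∀ i′ → i′ ∉ rest′ → G i′ ≈[ T ] G₁ i′
        agree G b≈ fix i′ i′∉ y y∈ with i′ Finₚ.≟ i
        ... | yes refl = sym (b≈ y y∈)
        ... | no  i′≢i = fix i′ (λ i′∈ → i′∉ (∈ₚ.∈-filter⁺ (λ z → ¬? (z Finₚ.≟ i)) i′∈ i′≢i)) y y∈
      recurse _ _ [] _ _ _ _ ()

  1≤δ : 1 ≤ length allD
  1≤δ = ∈ₚ.∈-length (allD-complete d₀)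

  -- T₀ witnesses that no c functions hit, while 1+c of them do above every T.
  module Rigid (c α : ℕ) (α≤m : α ≤ m) (T₀ : List X)
               (incompressible : ∀ (H : Tup c) → ¬ Ehit (suc (bound (suc c)) * α) T₀ H) where

    lev : ℕ → ℕ
    lev = level (suc c)

    collectA : ∀ T (𝒢 : List (Tup (suc c))) → All (Ehit α T) 𝒢 →
      ∃[ A ] length A ≤ length 𝒢 * α × All (HitAbove A T) 𝒢 × (1 ≤ length 𝒢 → T ⊆ A)
    collectA T []      []                             = [] , z≤n , [] , λ ()
    collectA T (G ∷ 𝒢) ((A , T⊆A , A≤ , hit) ∷ hits) =
      let (A′ , A′≤ , hits′ , _) = collectA T 𝒢 hits
      in A ++ A′ , ≤-trans (≤-reflexive (Listₚ.length-++ A)) (+-mono-≤ A≤ A′≤) ,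
         (λ U A⊆U → hit U (λ z∈ → A⊆U (∈ₚ.∈-++⁺ˡ z∈))) ∷ All.map (λ h U A⊆U → h U (λ z∈ → A⊆U (∈ₚ.∈-++⁺ʳ A z∈))) hits′ ,
         λ _ → ∈ₚ.∈-++⁺ˡ ∘ T⊆A

    grow-all : ∀ {s T} x (𝒢 : List (Tup (suc c))) → All (Pers α (grow (suc c) s) T) 𝒢 →
      ¬ ¬ (∃[ 𝒢′ ] Pointwise (λ G G′ → G ≋[ T ] G′) 𝒢 𝒢′ × All (Pers α s (x ∷ T)) 𝒢′)
    grow-all x []      []             = return ([] , [] , [])
    grow-all x (G ∷ 𝒢) (pers ∷ perss) = do
      (G′ , G≋ , pers′) ← extend pers x
      (𝒢′ , 𝒢≋ , perss′) ← grow-all x 𝒢 perss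
      return (G′ ∷ 𝒢′ , G≋ ∷ 𝒢≋ , pers′ ∷ perss′)

    distinct-resp : ∀ {T x} {G : Tup (suc c)} {𝒢 𝒢′} G′ → G ≋[ T ] G′ → Pointwise (λ G G′ → G ≋[ T ] G′) 𝒢 𝒢′ →
      All (λ H → ¬ (G ≋[ T ] H)) 𝒢 → All (λ H → ¬ (G′ ≋[ x ∷ T ] H)) 𝒢′
    distinct-resp G′ G≋ []        []           = []
    distinct-resp G′ G≋ (H≋ ∷ ps) (G≉H ∷ rest) =
      (λ G′≋H′ → G≉H λ i y y∈ → trans (trans (G≋ i y y∈) (G′≋H′ i y (there y∈))) (sym (H≋ i y y∈))) ∷ distinct-resp G′ G≋ ps rest

    allPairs-resp : ∀ {T x} {𝒢 𝒢′ : List (Tup (suc c))} → Pointwise (λ G G′ → G ≋[ T ] G′) 𝒢 𝒢′ →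
      AllPairs (λ G G′ → ¬ (G ≋[ T ] G′)) 𝒢 → AllPairs (λ G G′ → ¬ (G ≋[ x ∷ T ] G′)) 𝒢′
    allPairs-resp []        []       = []
    allPairs-resp (G≋ ∷ ps) (d ∷ ds) = distinct-resp _ G≋ ps d ∷ allPairs-resp ps ds

    module _ {P : Fin (suc c) → X → X → Set} where

      pairs : ∀ {is} → All (λ i → ∃[ x ] ∃[ y ] P i x y) is → List X
      pairs []                  = []
      pairs ((x , y , _) ∷ bad) = x ∷ y ∷ pairs bad

      length-pairs : ∀ {is} (bad : All (λ i → ∃[ x ] ∃[ y ] P i x y) is) → length (pairs bad) ≡ length is * 2
      length-pairs []        = refl
      length-pairs (_ ∷ bad) = cong (λ n → suc (suc n)) (length-pairs bad)

      in-pairs : ∀ {is} (bad : All (λ i → ∃[ x ] ∃[ y ] P i x y) is) {i} (i∈ : i ∈ is) →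
        proj₁ (All.lookup bad i∈) ∈ pairs bad × proj₁ (proj₂ (All.lookup bad i∈)) ∈ pairs bad
      in-pairs (_ ∷ bad) (here refl) = here refl , there (here refl)
      in-pairs (_ ∷ bad) (there i∈)  = let (x∈ , y∈) = in-pairs bad i∈ in there (there x∈) , there (there y∈)

    -- Uniqueness makes the value at `x` independent of the extension, so the extensions by single
    -- points glue to global assignments `g i`. If each of them violated some pair, `G` could be
    -- extended to all these pairs at once. An assignment listed for the witness `A` is valid on
    -- them, yet agrees there with some `g i`.
    finish : ∀ r T G → Pers α (lev (suc r)) T G →
      (∀ x G₁ G₂ → G ≋[ T ] G₁ → G ≋[ T ] G₂ → Pers α (lev r) (x ∷ T) G₁ → Pers α (lev r) (x ∷ T) G₂ → ∀ i → G₁ i x ≡ G₂ i x) → ⊥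
    finish r T G pers unique =
      for-each {P = λ x → ∃[ G′ ] G ≋[ T ] G′ × Pers α (lev r) (x ∷ T) G′} allX (λ x → extend (Pers-restrict id grow≤ pers) x) λ exts →
      let ext : ∀ x → ∃[ G′ ] G ≋[ T ] G′ × Pers α (lev r) (x ∷ T) G′
          ext x = All.lookup exts (allX-complete x)
          g : Tup (suc c)
          g i x = proj₁ (ext x) i x
      in for-each {P = λ i → ∃[ x ] ∃[ y ] ¬ Ok x y (g i x) (g i y)} (allFin (suc c)) (λ i k →
           all-¬¬ (All.universal (λ x → all-¬¬ (All.universal (λ y ¬ok → k (x , y , ¬ok)) allX)) allX) λ ok →
           unsat (g i) λ x y → All.lookup (All.lookup ok (allX-complete x)) (allX-complete y)) λ bad →
         let Y = pairs bad
         in extendⁿ Y (Pers-restrict id (growⁿ-monoˡ 1≤δ (suc c) _ (≤-reflexive (trans (length-pairs bad) (cong (_* 2)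
               (Listₚ.length-tabulate {n = suc c} id))))) pers) λ { (G* , G≋ , pers*) →
            Pers⇒Ehit pers* λ { (A , T⊆A , A≤ , hit) → hit A id (≤-trans A≤ α≤m) λ { (b , b∈ , i , b≈) →
            let (x , y , ¬ok) = All.lookup bad (∈ₚ.∈-allFin i)
                (x∈ , y∈) = in-pairs bad (∈ₚ.∈-allFin i)
                same : ∀ {x} → x ∈ Y → b x ≡ g i x
                same {x} x∈ = trans (b≈ _ (∈ₚ.∈-++⁺ˡ x∈)) (unique x G* (proj₁ (ext x)) G≋ (proj₁ (proj₂ (ext x)))
                  (Pers-restrict (λ { (here refl) → ∈ₚ.∈-++⁺ˡ x∈ ; (there z∈) → ∈ₚ.∈-++⁺ʳ Y z∈ }) (s≤grow 1≤δ
                        (suc c) _) pers*) (proj₂ (proj₂ (ext x))) i)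
            in ¬ok (subst₂ (Ok x y) (same x∈) (same y∈) (L-valid (≤-trans A≤ α≤m) b∈ (T⊆A (∈ₚ.∈-++⁺ˡ x∈)) (T⊆A (∈ₚ.∈-++⁺ˡ y∈)))) } } }
      where
      grow≤ : grow (suc c) (lev r) ≤ lev (suc r)
      grow≤ = growⁿ-monoˡ 1≤δ (suc c) {0} {suc c * 2} (grow (suc c) (lev r)) z≤n

    -- A tuple with two different extensions at some `x` is replaced by both, so the family of
    -- distinct tuples grows by one; after `bound (suc c)` splittings it contradicts `Count.count`.
    -- Hence extensions are unique at some stage, and `finish` applies.
    rigid : ∀ r T (G : Tup (suc c)) 𝒢 → T₀ ⊆ T → All (Pers α (lev r) T) (G ∷ 𝒢) → AllPairs (λ G G′ → ¬ (G ≋[ T ] G′)) (G ∷ 𝒢) →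
      r + length (G ∷ 𝒢) ≡ suc (bound (suc c)) → ⊥
    rigid zero T G 𝒢 T₀⊆T perss distinct eq = all-¬¬ (All.map Pers⇒Ehit perss) λ ehits →
      let (A , A≤ , hits , T⊆A) = collectA T (G ∷ 𝒢) ehits
      in Count.count c T A
           (λ H hit → incompressible H (A , T⊆A (s≤s z≤n) ∘ T₀⊆T , ≤-trans A≤ (≤-reflexive (cong
                 (_* α) eq)) , HitAbove-restrict T₀⊆T (λ _ _ _ → refl) hit))
           (suc c) (allFin (suc c)) G (G ∷ 𝒢) (≤-reflexive (Listₚ.length-tabulate {n = suc c} id)) distinct hits
           (All.universal (λ _ i i∉ → ⊥-elim (i∉ (∈ₚ.∈-allFin i))) _) (≤-reflexive (sym eq))
    rigid (suc r) T G 𝒢 T₀⊆T (pers ∷ perss) (d ∷ ds) eq =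
      em {A = ∃[ x ] ∃[ G₁ ] ∃[ G₂ ] (G ≋[ T ] G₁ × G ≋[ T ] G₂) × (Pers α (lev r) (x ∷ T) G₁ × Pers α (lev r)
            (x ∷ T) G₂) × ∃[ i ] G₁ i x ≢ G₂ i x}
      λ { (yes (x , G₁ , G₂ , (G≋₁ , G≋₂) , (pers₁ , pers₂) , i , ≢)) →
          grow-all x 𝒢 (All.map (Pers-restrict id (growⁿ-monoˡ 1≤δ (suc c) {0} {suc c * 2} (grow (suc c)
                (lev r)) z≤n)) perss) λ { (𝒢′ , 𝒢≋ , perss′) →
          rigid r (x ∷ T) G₁ (G₂ ∷ 𝒢′) (there ∘ T₀⊆T) (pers₁ ∷ pers₂ ∷ perss′)
            (((λ G₁≋G₂ → ≢ (G₁≋G₂ i x (here refl))) ∷ distinct-resp G₁ G≋₁ 𝒢≋ d) ∷ distinct-resp G₂ G≋₂ 𝒢≋ d ∷ allPairs-resp 𝒢≋ ds)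
            (trans (cong (λ n → r + suc (suc n)) (sym (Pointwise.Pointwise-length 𝒢≋))) (trans (+-suc r _) eq)) }
        ; (no none) → finish r T G pers λ x G₁ G₂ G≋₁ G≋₂ pers₁ pers₂ i → case G₁ i x ≟ᴰ G₂ i x of λ
            { (yes eq) → eq ; (no ≢) → ⊥-elim (none (x , G₁ , G₂ , (G≋₁ , G≋₂) , (pers₁ , pers₂) , i , ≢)) } }

  -- Induction on the number of functions that suffice for hitting; no functions hit nothing. Either
  -- `c` functions suffice as well, with larger witnesses and for smaller `T`, or a set `T₀` refutes
  -- this and `Rigid` takes over above it.
  descend : ∀ c α → req c α ≤ m → (∀ T → length T ≤ τ c → ¬ ¬ (∃ λ (G : Tup c) → Ehit α T G)) → ⊥
  descend zero    α α≤m hits = hits [] z≤n λ { (_ , A , _ , A≤ , hit) → hit A id (≤-trans A≤ α≤m) λ { (_ , _ , () , _) } }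
  descend (suc c) α req≤ hits = em {A = ∃[ T ] length T ≤ τ c × (∀ (H : Tup c) → ¬ Ehit α′ T H)} λ
    { (no none) → descend c α′ req≤ λ T T≤ k → none (T , T≤ , λ H hit → k (H , hit))
    ; (yes (T₀ , T₀≤ , incompressible)) →
        extendⁿ T₀ (start T₀ T₀≤) λ { (G , _ , pers) →
        Rigid.rigid c α (≤-trans (≤-trans (m≤m+n α _) (α≤req c α′)) req≤) T₀ incompressible (bound (suc c))
              (T₀ ++ []) G [] ∈ₚ.∈-++⁺ˡ (pers ∷ []) ([] ∷ [])
          (+-comm (bound (suc c)) 1) } }
    where
    α′ = suc (bound (suc c)) * α

    start : ∀ T₀ → length T₀ ≤ τ c → Pers α (growⁿ (suc c) (length T₀) (level (suc c) (bound (suc c)))) [] (λ (_ : Fin (suc c)) _ → d₀)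
    start T₀ T₀≤ Y Y≤ = do
      (G , hit) ← hits Y (≤-trans Y≤ (growⁿ-monoˡ 1≤δ (suc c) _ T₀≤))
      return (G , (λ _ _ ()) , subst (λ Z → Ehit α Z G) (sym (Listₚ.++-identityʳ Y)) hit)

  gap : req K (τ K) ≤ m → ⊥
  gap req≤ = descend K (τ K) req≤ (base (τ K))

-- Two-colourings of powers of the palette

module Assignments {X D : Set} (_≟_ : DecidableEquality X) (d₀ : D) where

  col : ∀ (w : List X) → (X → D) → Vec D (length w)
  col []      g = []
  col (x ∷ w) g = g x ∷ col w g

  ext : ∀ (w : List X) → Vec D (length w) → X → D
  ext []      []       y = d₀
  ext (x ∷ w) (s ∷ ss) y with y ≟ x
  ... | yes _ = s
  ... | no  _ = ext w ss y

  ext-col : ∀ (w : List X) (g : X → D) (y : X) → y ∈ w → ext w (col w g) y ≡ g y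
  ext-col (x ∷ w) g y y∈ with y ≟ x
  ... | yes refl = refl
  ... | no  y≢x  with y∈
  ... | here y≡x  = ⊥-elim (y≢x y≡x)
  ... | there y∈w = ext-col w g y y∈w

  col-cong : ∀ (w : List X) {g g′} → (∀ y → y ∈ w → g y ≡ g′ y) → col w g ≡ col w g′
  col-cong []      eq = refl
  col-cong (x ∷ w) eq = cong₂ _∷_ (eq x (here refl)) (col-cong w (λ y y∈ → eq y (there y∈)))

cost : Bool → Bool → ℕ
cost true  true  = 0
cost true  false = 1
cost false true  = 1
cost false false = 0

-- The final colour is known only after all removals. Alternating the requests caps the losses at
-- half of the rows, whichever colour comes out.
flips≤ : ℕ → Bool → Bool → ℕ
flips≤ zero    p c = 0
flips≤ (suc e) p c = cost p c + flips≤ e (not p) c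

flips≤half : ∀ e p c → flips≤ e p c ≤ ⌊ suc e /2⌋
flips≤half zero          p     c     = z≤n
flips≤half (suc zero)    true  true  = z≤n
flips≤half (suc zero)    true  false = ≤-refl
flips≤half (suc zero)    false true  = ≤-refl
flips≤half (suc zero)    false false = z≤n
flips≤half (suc (suc e)) true  true  = s≤s (flips≤half e true true)
flips≤half (suc (suc e)) true  false = s≤s (flips≤half e true false)
flips≤half (suc (suc e)) false true  = s≤s (flips≤half e false true)
flips≤half (suc (suc e)) false false = s≤s (flips≤half e false false)

-- Rows that use up the palette P column by column.  While some hybrid row sits
-- next to one of the other colour, remove it from the palette, asking for the
-- colours p, not p, p, ... in turn; when none does, all remaining hybrids have
-- one colour c, and at most half of the removed rows have to be moved to their
-- neighbour to get colour c as well.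

module Bundle {Cl Q : Set} (_≟_ : DecidableEquality Cl) (cols : List Cl)
  (f : (Cl → Q) → Bool) (f-cong : ∀ {x y} → (∀ s → s ∈ cols → x s ≡ y s) → f x ≡ f y) where

  record Bundled (n h : ℕ) (P : Cl → Fin n → Q) (c : Bool) : Set where
    field
      rows         : List (Cl → Q)
      flips        : List (Cl × Q)
      length-rows  : length rows ≡ n
      length-flips : length flips ≤ h
      mono         : All (λ r → f r ≡ c) rows
      cover        : ∀ s j → Any (λ r → r s ≡ P s j) rows ⊎ (s , P s j) ∈ flips

  hyb : ∀ {n} → (Cl → Fin n → Q) → (Cl → Fin n) → Cl → Q
  hyb P h s = P s (h s)

  _[_≔_] : ∀ {A : Set} → (Cl → A) → Cl → A → Cl → A
  (h [ s ≔ j ]) s′ with s′ ≟ s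
  ... | yes _ = j
  ... | no  _ = h s′

  mix : ∀ {A : Set} → List Cl → (Cl → A) → (Cl → A) → Cl → A
  mix []       h h′ = h
  mix (s ∷ ss) h h′ = mix ss h h′ [ s ≔ h′ s ]

  mix-∈ : ∀ {A : Set} ss (h h′ : Cl → A) s → s ∈ ss → mix ss h h′ s ≡ h′ s
  mix-∈ (s′ ∷ ss) h h′ s s∈ with s ≟ s′
  ... | yes refl = refl
  ... | no  s≢s′ with s∈
  ... | here s≡s′ = ⊥-elim (s≢s′ s≡s′)
  ... | there s∈′ = mix-∈ ss h h′ s s∈′

  -- `mix` changes `h` into `h′` one column at a time. After all of `cols` the two agree there,
  -- which is all that `f` sees.
  constant : ∀ {n} (P : Cl → Fin n → Q) → (∀ h s j → f (hyb P h) ≡ f (hyb P (h [ s ≔ j ]))) →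
    ∀ h h′ → f (hyb P h) ≡ f (hyb P h′)
  constant P local h h′ = trans (to-mix cols) (f-cong (λ s s∈ → cong (P s) (mix-∈ cols h h′ s s∈)))
    where
    to-mix : ∀ ss → f (hyb P h) ≡ f (hyb P (mix ss h h′))
    to-mix []       = refl
    to-mix (s ∷ ss) = trans (to-mix ss) (local (mix ss h h′) s (h′ s))

  bundle : ∀ e P p → ¬ ¬ (∃[ c ] Bundled (suc e) (flips≤ e p c) P c)
  bundle zero    P p = return (f (λ s → P s zero) , record
    { rows = [ (λ s → P s zero) ] ; flips = [] ; length-rows = refl ; length-flips = z≤n
    ; mono = refl ∷ [] ; cover = λ { s zero → inj₁ (here refl) } })
  bundle (suc e) P p = do
    yes (h , s , j , f≢) ← em {A = ∃[ h ] ∃[ s ] ∃[ j ] f (hyb P h) ≢ f (hyb P (h [ s ≔ j ]))}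
      where no none → return (f (hyb P (λ _ → zero)) , all-rows λ h s j → case f (hyb P h) Boolₚ.≟ f (hyb P (h [ s ≔ j ])) of λ
              { (yes eq) → eq ; (no ≢) → ⊥-elim (none (h , s , j , ≢)) })
    boundary (neighbours h s j f≢)
    where
    all-rows : (∀ h s j → f (hyb P h) ≡ f (hyb P (h [ s ≔ j ]))) →
      Bundled (suc (suc e)) (flips≤ (suc e) p (f (hyb P (λ _ → zero)))) P (f (hyb P (λ _ → zero)))
    all-rows local = record
      { rows = map (λ j s → P s j) (allFin (suc (suc e))) ; flips = []
      ; length-rows = trans (Listₚ.length-map (λ j s → P s j) (allFin (suc (suc e)))) (Listₚ.length-tabulate {n = suc (suc e)} id)
      ; length-flips = z≤n
      ; mono = Allₚ.map⁺ (All.universal (λ j → constant P local (λ _ → j) (λ _ → zero)) (allFin (suc (suc e))))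
      ; cover = λ s j → inj₁ (Anyₚ.map⁺ (Any.map (λ { refl → refl }) (∈ₚ.∈-allFin j))) }

    Neighbours : Set
    Neighbours = ∃[ s ] ∃[ h₁ ] ∃[ h₂ ] f (hyb P h₁) ≡ p × f (hyb P h₂) ≡ not p × (∀ s′ → s′ ≢ s → h₂ s′ ≡ h₁ s′)

    away : ∀ (h : Cl → Fin (suc (suc e))) s j s′ → s′ ≢ s → (h [ s ≔ j ]) s′ ≡ h s′
    away h s j s′ s′≢s with s′ ≟ s
    ... | yes eq = ⊥-elim (s′≢s eq)
    ... | no  _  = refl

    neighbours : ∀ h s j → f (hyb P h) ≢ f (hyb P (h [ s ≔ j ])) → Neighbours
    neighbours h s j f≢ with f (hyb P h) Boolₚ.≟ p
    ... | yes refl = s , h , h [ s ≔ j ] , refl , Boolₚ.¬-not (f≢ ∘ sym) , away h s j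
    ... | no  ≢p   = s , h [ s ≔ j ] , h ,
      trans (Boolₚ.¬-not (f≢ ∘ sym)) (trans (cong not (Boolₚ.¬-not ≢p)) (Boolₚ.not-involutive p)) ,
      Boolₚ.¬-not ≢p , (λ s′ s′≢s → sym (away h s j s′ s′≢s))

    boundary : Neighbours → ¬ ¬ (∃[ c ] Bundled (suc (suc e)) (flips≤ (suc e) p c) P c)
    boundary (s , h₁ , h₂ , f₁ , f₂ , h≡) = do
      -- The entries of `h₁` leave the palette before it is known which of the two neighbours
      -- becomes a row.
      (c , B) ← bundle e (λ s → P s ∘ punchIn (h₁ s)) (not p)
      return (c , add c B (c Boolₚ.≟ p))
      where
      add : ∀ c → Bundled (suc e) (flips≤ e (not p) c) (λ s → P s ∘ punchIn (h₁ s)) c → Dec (c ≡ p) →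
        Bundled (suc (suc e)) (flips≤ (suc e) p c) P c
      add c B (yes refl) = record
        { rows = hyb P h₁ ∷ rows ; flips = flips ; length-rows = cong suc length-rows
        ; length-flips = ≤-trans length-flips (m≤n+m _ (cost p p)) ; mono = f₁ ∷ mono
        ; cover = cover′ }
        where
        open Bundled B
        cover′ : ∀ s j → Any (λ r → r s ≡ P s j) (hyb P h₁ ∷ rows) ⊎ (s , P s j) ∈ flips
        cover′ s j with h₁ s Finₚ.≟ j
        ... | yes refl = inj₁ (here refl)
        ... | no  ≢j   with subst (λ j → Any (λ r → r s ≡ P s j) rows ⊎ (s , P s j) ∈ flips) (Finₚ.punchIn-punchOut ≢j)
              (cover s (punchOut ≢j))
        ... | inj₁ x = inj₁ (there x)
        ... | inj₂ y = inj₂ y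
      -- Away from `s` the row `h₂` shows the same as `h₁`, so only the colour of `h₁` in column `s`
      -- can get lost.
      add c B (no c≢p) = record
        { rows = hyb P h₂ ∷ rows ; flips = (s , P s (h₁ s)) ∷ flips ; length-rows = cong suc length-rows
        ; length-flips = ≤-trans (s≤s length-flips) (≤-reflexive (cong (_+ flips≤ e (not p) c) (sym (cost≢ p c c≢p))))
        ; mono = trans f₂ (sym (Boolₚ.¬-not c≢p)) ∷ mono
        ; cover = cover′ }
        where
        open Bundled B
        cost≢ : ∀ p c → c ≢ p → cost p c ≡ 1
        cost≢ true  true  c≢p = ⊥-elim (c≢p refl)
        cost≢ true  false _   = refl
        cost≢ false true  _   = refl
        cost≢ false false c≢p = ⊥-elim (c≢p refl)

        cover′ : ∀ s′ j → Any (λ r → r s′ ≡ P s′ j) (hyb P h₂ ∷ rows) ⊎ (s′ , P s′ j) ∈ (s , P s (h₁ s)) ∷ flips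
        cover′ s′ j with h₁ s′ Finₚ.≟ j
        cover′ s′ j | yes refl with s′ ≟ s
        ... | yes refl = inj₂ (here refl)
        ... | no  s′≢s = inj₁ (here (cong (P s′) (h≡ s′ s′≢s)))
        cover′ s′ j | no ≢j with subst (λ j → Any (λ r → r s′ ≡ P s′ j) rows ⊎ (s′ , P s′ j) ∈ flips)
              (Finₚ.punchIn-punchOut ≢j) (cover s′ (punchOut ≢j))
        ... | inj₁ x = inj₁ (there x)
        ... | inj₂ y = inj₂ (there y)

-- Every two-colouring of the d-element sublists, d = 1 + d′, of a list of
-- length t d′ + 1 has t sublists of one colour that cover the list: two
-- d-lists of different colours sharing d′ elements extend any cover of the rest.

module Cover {A : Set} (d′ : ℕ) (b : List A → Bool) where

  d : ℕ
  d = suc d′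

  Change : List A → Set
  Change xs = ∃[ ys ] ∃[ zs ] ys ↭ xs × zs ↭ xs × b (take d ys) ≢ b (take d zs) ×
    (∀ {a} → a ∈ take d′ ys → a ∈ take d zs)

  take-widen : ∀ n (xs : List A) {a} → a ∈ take n xs → a ∈ take (suc n) xs
  take-widen (suc n) (x ∷ xs) (here refl) = here refl
  take-widen (suc n) (x ∷ xs) (there a∈)  = there (take-widen n xs a∈)

  take-swap : ∀ n (zs : List A) x y xs {a} → a ∈ take n (zs ++ x ∷ y ∷ xs) → a ∈ take (suc n) (zs ++ y ∷ x ∷ xs)
  take-swap (suc n)       (z ∷ zs) x y xs (here refl) = here refl
  take-swap (suc n)       (z ∷ zs) x y xs (there a∈)  = there (take-swap n zs x y xs a∈)
  take-swap (suc n)       []       x y xs (here refl) = there (here refl)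
  take-swap (suc (suc n)) []       x y xs (there (here refl)) = here refl
  take-swap (suc (suc n)) []       x y xs (there (there a∈))  = there (there (take-widen n xs a∈))

  -- The permutation is followed swap by swap. At some swap of neighbours the colour of the first
  -- `d` entries changes, and such a swap exchanges at most one of these entries. The prefix `zs`
  -- carries the induction through `prep`.
  change : ∀ zs {xs ys} → xs ↭ ys → b (take d (zs ++ xs)) ≢ b (take d (zs ++ ys)) → Change (zs ++ xs)
  change zs ↭.refl ne = ⊥-elim (ne refl)
  change zs {x ∷ xs} {_ ∷ ys} (↭.prep x p) ne = subst Change (Listₚ.++-assoc zs [ x ] xs)
    (change (zs ++ [ x ]) p (subst₂ (λ l l′ → b (take d l) ≢ b (take d l′)) (sym (Listₚ.++-assoc zs [ x ] xs)) (sym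
          (Listₚ.++-assoc zs [ x ] ys)) ne))
  change zs {x ∷ y ∷ xs} {_ ∷ _ ∷ ys} (↭.swap x y p) ne with b (take d (zs ++ x ∷ y ∷ xs)) Boolₚ.≟ b (take d (zs ++ y ∷ x ∷ xs))
  ... | no  ne′ = _ , _ , ↭.↭-refl , ↭ₚ.++⁺ˡ zs (↭.swap y x ↭.refl) , ne′ , take-swap d′ zs x y xs
  ... | yes eq =
    let (ys₁ , zs₁ , p₁ , p₂ , rest) = subst Change (Listₚ.++-assoc zs (y ∷ x ∷ []) xs) (change (zs ++ y ∷ x ∷ []) p
          (subst₂ (λ l l′ → b (take d l) ≢ b (take d l′)) (sym (Listₚ.++-assoc zs (y ∷ x ∷ []) xs)) (sym (Listₚ.++-assoc zs
                (y ∷ x ∷ []) ys)) (ne ∘ trans eq)))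
        back = ↭ₚ.++⁺ˡ zs (↭.swap y x (↭.refl {xs = xs}))
    in ys₁ , zs₁ , ↭.trans p₁ back , ↭.trans p₂ back , rest
  change zs {xs} (↭.trans {ys = us} p q) ne with b (take d (zs ++ xs)) Boolₚ.≟ b (take d (zs ++ us))
  ... | no  ne′ = change zs p ne′
  ... | yes eq =
    let (ys₁ , zs₁ , p₁ , p₂ , rest) = change zs q (ne ∘ trans eq)
        back = ↭ₚ.++⁺ˡ zs (↭.↭-sym p)
    in ys₁ , zs₁ , ↭.trans p₁ back , ↭.trans p₂ back , rest

  -- One member is kept as `set` with its `remainder`, because the induction has to move some member
  -- to the front of the whole list.
  record Covered (t : ℕ) (xs : List A) : Set where
    field
      colour      : Bool
      set         : List A
      sets        : List (List A)
      length-sets : length sets ≡ t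
      mono        : All (λ S → length S ≡ d × b S ≡ colour) (set ∷ sets)
      cover       : ∀ {a} → a ∈ xs → a ∈ concat (set ∷ sets)
      remainder   : List A
      sublist     : set ++ remainder ↭ xs

  take-++ : ∀ n (xs ys : List A) → length xs ≡ n → take n (xs ++ ys) ≡ xs
  take-++ zero    []       ys eq = refl
  take-++ (suc n) (x ∷ xs) ys eq = cong (x ∷_) (take-++ n xs ys (suc-injective eq))

  add-set : ∀ {t xs} ys S (C : Covered t (drop d′ ys)) → ys ↭ xs → length S ≡ d → b S ≡ Covered.colour C →
    (∀ {a} → a ∈ take d′ ys → a ∈ S) → (r : List A) → S ++ r ↭ xs → Covered (suc t) xs
  add-set ys S C ys↭ len bS take⊆S r p = record
    { colour = colour ; set = S ; sets = set ∷ sets ; length-sets = cong suc length-sets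
    ; mono = (len , bS) ∷ mono ; remainder = r ; sublist = p
    ; cover = λ a∈ → case ∈ₚ.∈-++⁻ (take d′ ys) (subst (_ ∈_) (sym (Listₚ.take++drop≡id d′ ys)) (↭ₚ.∈-resp-↭ (↭.↭-sym ys↭) a∈)) of λ
        { (inj₁ a∈) → ∈ₚ.∈-++⁺ˡ (take⊆S a∈) ; (inj₂ a∈) → ∈ₚ.∈-++⁺ʳ S (cover a∈) } }
    where open Covered C

  covered : ∀ t xs → length xs ≡ suc t * d′ + 1 → Covered t xs
  covered zero    xs eq = record
    { colour = b xs ; set = xs ; sets = [] ; length-sets = refl
    ; mono = (trans eq (trans (cong (_+ 1) (+-identityʳ d′)) (+-comm d′ 1)) , refl) ∷ []
    ; cover = ∈ₚ.∈-++⁺ˡ ; remainder = [] ; sublist = ↭.↭-reflexive (Listₚ.++-identityʳ xs) }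
  covered (suc t) xs eq = extend-cover (covered t (drop d′ xs) (length-rest xs eq)) (b (take d xs) Boolₚ.≟ _)
    where
    length-rest : ∀ ys → length ys ≡ suc (suc t) * d′ + 1 → length (drop d′ ys) ≡ suc t * d′ + 1
    length-rest ys eq = trans (Listₚ.length-drop d′ ys) (trans (cong (_∸ d′) (trans eq (+-assoc d′ (suc t * d′) 1))) (m+n∸m≡n d′ _))

    length-first : ∀ ys → ys ↭ xs → length (take d ys) ≡ d
    length-first ys p = trans (Listₚ.length-take d ys) (m≤n⇒m⊓n≡m (≤-trans
      (≤-trans (≤-reflexive (+-comm 1 d′)) (+-monoˡ-≤ 1 (m≤m+n d′ (suc t * d′)))) (≤-reflexive (sym (trans (↭ₚ.↭-length p) eq)))))

    first++rest : ∀ ys → ys ↭ xs → take d ys ++ drop d ys ↭ xs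
    first++rest ys p = ↭.trans (↭.↭-reflexive (Listₚ.take++drop≡id d ys)) p

    extend-cover : (C : Covered t (drop d′ xs)) → Dec (b (take d xs) ≡ Covered.colour C) → Covered (suc t) xs
    extend-cover C (yes eq′) = add-set xs (take d xs) C ↭.refl (length-first xs ↭.refl) eq′ (take-widen d′ xs) (drop d xs)
          (first++rest xs ↭.refl)
    -- The list `xs` begins with a `d`-list of the wrong colour, its rearrangement with `C.set` of
    -- the right one; so the colour changes somewhere between them.
    extend-cover C (no ne) with change [] {xs} {C.set ++ C.remainder ++ take d′ xs}
        (↭.↭-sym (↭.trans (↭.trans (↭.↭-reflexive (sym (Listₚ.++-assoc C.set C.remainder (take d′ xs)))) (↭ₚ.++⁺ʳ (take d′ xs) C.sublist))
          (↭.trans (↭ₚ.++-comm (drop d′ xs) (take d′ xs)) (↭.↭-reflexive (Listₚ.take++drop≡id d′ xs)))))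
        (λ eq′ → ne (trans eq′ (trans (cong b (take-++ d C.set _ (proj₁ (All.head C.mono)))) (proj₂ (All.head C.mono)))))
      where module C = Covered C
    ... | ys , zs , ys↭ , zs↭ , ne′ , take⊆ = choose (covered t (drop d′ ys) (length-rest ys (trans (↭ₚ.↭-length ys↭) eq)))
      where
      choose : Covered t (drop d′ ys) → Covered (suc t) xs
      choose C′ with b (take d ys) Boolₚ.≟ Covered.colour C′
      ... | yes eq′ = add-set ys (take d ys) C′ ys↭ (length-first ys ys↭) eq′ (take-widen d′ ys) (drop d ys) (first++rest ys ys↭)
      ... | no  ne″ = add-set ys (take d zs) C′ ys↭ (length-first zs zs↭)
        (trans (Boolₚ.¬-not (ne′ ∘ sym)) (trans (cong not (Boolₚ.¬-not ne″)) (Boolₚ.not-involutive _))) take⊆ (drop d zs)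
              (first++rest zs zs↭)

-- Padding, concatenation and bounded lists

toVec : ∀ {A : Set} → A → ∀ n → List A → Vec A n
toVec a₀ zero    _        = []
toVec a₀ (suc n) []       = a₀ ∷ toVec a₀ n []
toVec a₀ (suc n) (x ∷ xs) = x ∷ toVec a₀ n xs

toVec-∈ : ∀ {A : Set} {a₀ x : A} n xs → length xs ≤ n → x ∈ xs → ∃[ i ] lookup (toVec a₀ n xs) i ≡ x
toVec-∈ (suc n) (x ∷ xs) le       (here refl) = zero , refl
toVec-∈ (suc n) (x ∷ xs) (s≤s le) (there x∈)  = let (i , eq) = toVec-∈ n xs le x∈ in suc i , eq

toVec-All : ∀ {A : Set} {P : A → Set} {a₀ : A} {n xs} → length xs ≡ n → All P xs → ∀ i → P (lookup (toVec a₀ n xs) i)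
toVec-All {n = suc n} eq (px ∷ pxs) zero    = px
toVec-All {n = suc n} eq (px ∷ pxs) (suc i) = toVec-All (suc-injective eq) pxs i

concatᶠ : ∀ {A : Set} {n} → (Fin n → List A) → List A
concatᶠ f = concat (List.tabulate f)

∈-concatᶠ : ∀ {A : Set} {n} (f : Fin n → List A) {a} j → a ∈ f j → a ∈ concatᶠ f
∈-concatᶠ f j a∈ = ∈ₚ.∈-concat⁺′ a∈ (∈ₚ.∈-tabulate⁺ j)

length-concatᶠ : ∀ {A : Set} {n} c (f : Fin n → List A) → (∀ j → length (f j) ≡ c) → length (concatᶠ f) ≡ n * c
length-concatᶠ {n = zero}  c f eq = refl
length-concatᶠ {n = suc n} c f eq = trans (Listₚ.length-++ (f zero)) (cong₂ _+_ (eq zero) (length-concatᶠ c (f ∘ suc) (eq ∘ suc)))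

length-concatᶠ-≤ : ∀ {A : Set} {n} c (f : Fin n → List A) → (∀ j → length (f j) ≤ c) → length (concatᶠ f) ≤ n * c
length-concatᶠ-≤ {n = zero}  c f le = z≤n
length-concatᶠ-≤ {n = suc n} c f le = ≤-trans (≤-reflexive (Listₚ.length-++ (f zero))) (+-mono-≤ (le zero)
      (length-concatᶠ-≤ c (f ∘ suc) (le ∘ suc)))

-- This is why a block of `t` palettes loses at most `h` colours at a valid assignment and not
-- `t * h`: only one of its gadgets can be active.
length-concatᶠ-unique : ∀ {A : Set} {n} c (f : Fin n → List A) → (∀ j → length (f j) ≤ c) →
  (∀ j j′ {a a′} → a ∈ f j → a′ ∈ f j′ → j ≡ j′) → length (concatᶠ f) ≤ c
length-concatᶠ-unique {n = zero}  c f le unique = z≤n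
length-concatᶠ-unique {n = suc n} c f le unique with f zero in eq
... | []     = length-concatᶠ-unique c (f ∘ suc) (le ∘ suc) (λ j j′ a∈ a′∈ → Finₚ.suc-injective (unique (suc j) (suc j′) a∈ a′∈))
... | a ∷ as = ≤-trans (≤-reflexive (trans (Listₚ.length-++ (a ∷ as)) (trans (cong (suc (length as) +_) (no-rest
      (f ∘ suc) others)) (+-identityʳ _))))
                       (subst (λ l → length l ≤ c) eq (le zero))
  where
  others : ∀ j {b} → b ∈ f (suc j) → ⊥
  others j b∈ with unique zero (suc j) (subst (a ∈_) (sym eq) (here refl)) b∈
  ... | ()
  no-rest : ∀ {n} (f : Fin n → List _) → (∀ j {b} → b ∈ f j → ⊥) → length (concatᶠ f) ≡ 0
  no-rest {zero}  f none = refl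
  no-rest {suc n} f none with f zero in eq
  ... | []    = no-rest (f ∘ suc) (none ∘ suc)
  ... | b ∷ _ = ⊥-elim (none zero (subst (b ∈_) (sym eq) (here refl)))

AllPairs-lookup : ∀ {A : Set} {R : A → A → Set} {xs} → (∀ {x y} → R x y → R y x) → AllPairs R xs →
  ∀ i j → i ≢ j → R (List.lookup xs i) (List.lookup xs j)
AllPairs-lookup R-sym (r ∷ rs) zero    zero    i≢j = ⊥-elim (i≢j refl)
AllPairs-lookup R-sym (r ∷ rs) zero    (suc j) i≢j = All.lookup r (∈ₚ.∈-lookup j)
AllPairs-lookup R-sym (r ∷ rs) (suc i) zero    i≢j = R-sym (All.lookup r (∈ₚ.∈-lookup i))
AllPairs-lookup R-sym (r ∷ rs) (suc i) (suc j) i≢j = AllPairs-lookup R-sym rs i j (i≢j ∘ cong suc)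

allList≤ : ∀ {A : Set} → List A → ℕ → List (List A)
allList≤ xs zero    = [ [] ]
allList≤ xs (suc n) = [] ∷ cartesianProductWith _∷_ xs (allList≤ xs n)

allList≤-complete : ∀ {A : Set} {xs : List A} → (∀ x → x ∈ xs) → ∀ n l → length l ≤ n → l ∈ allList≤ xs n
allList≤-complete complete zero    []      _        = here refl
allList≤-complete complete (suc n) []      _        = here refl
allList≤-complete complete (suc n) (x ∷ l) (s≤s l≤) = there (∈ₚ.∈-cartesianProductWith⁺ _∷_ (complete x)
      (allList≤-complete complete n l l≤))

-- Monochromatic edges from incompatible tuples

module Numbers (t′ d″ : ℕ) where

  t d′ d h q k : ℕ
  t  = suc t′
  d′ = suc d″
  d  = suc d′
  h  = ⌊ d /2⌋
  q  = t * d′ + 1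
  k  = t * d + h

  -- The final edge consists of one point for each of the `q` colours and `t′ + h` copies of a
  -- further point.
  k≡q+ : k ≡ q + (t′ + h)
  k≡q+ = begin
    t * d + h              ≡⟨ cong (_+ h) (*-suc t d′) ⟩
    t + t * d′ + h         ≡⟨ cong (_+ h) (+-comm t (t * d′)) ⟩
    t * d′ + t + h         ≡⟨ cong (_+ h) (+-assoc (t * d′) 1 t′) ⟨
    q + t′ + h             ≡⟨ +-assoc q t′ h ⟩
    q + (t′ + h)           ∎
    where open ≡-Reasoning

-- Besides extensionality, `no-mono` is all that is used of the colouring. Pairs may repeat in `ps`,
-- since the hypergraph has enough copies of each.
module Families (t′ d″ : ℕ)
  {X D : Set} (_≟_ : DecidableEquality X) (allX : List X) (allX-complete : ∀ x → x ∈ allX)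
  (_≟ᴰ_ : DecidableEquality D) (allD : List D) (allD-complete : ∀ d → d ∈ allD) (d₀ : D)
  (Valid : List X → (X → D) → Set) (Valid-⊆ : ∀ {v w g} → v ⊆ w → Valid w g → Valid v g)
  (color : List X → ((X → D) → Fin (Numbers.q t′ d″)) → Bool) (color-cong : ∀ v {x x′} → (∀ g → x g ≡ x′ g) → color v x ≡ color v x′)
  (M m : ℕ) (M≥ : suc (Numbers.q t′ d″) * (suc t′ * m) ≤ M)
  (no-mono : ∀ (ps : List (List X × ((X → D) → Fin (Numbers.q t′ d″)))) → length ps ≡ Numbers.k t′ d″ →
    All (λ (v , x) → length v ≤ M × (∀ g g′ → (∀ y → y ∈ v → g y ≡ g′ y) → x g ≡ x g′)) ps →
    (∀ g → Valid (concatMap proj₁ ps) g → ∀ a → Any (λ (_ , x) → x g ≡ a) ps) →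
    ∀ c → All (λ (v , x) → color v x ≡ c) ps → ⊥)
  where

  open Numbers t′ d″
  open Assignments _≟_ d₀

  Point : Set
  Point = (X → D) → Fin q

  Local : List X → Point → Set
  Local v x = ∀ g g′ → (∀ y → y ∈ v → g y ≡ g′ y) → x g ≡ x g′

  a₀ : Fin q
  a₀ = Fin.fromℕ< (m≤n+m 1 (t * d′))

  module Bd (u : List X) = Bundle (Vecₚ.≡-dec _≟ᴰ_) (allVec allD (length u)) (λ r → color u (r ∘ col u))
    (λ eq → color-cong u (λ g → eq (col u g) (allVec-complete allD-complete (col u g))))

  Type : Set
  Type = Bool × Vec (Vec (Fin q) d) t

  Bundles : List X → Type → Set
  Bundles u (c , Ss) = ∀ j → Bd.Bundled u d h (λ _ → lookup (lookup Ss j)) c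

  record Gadget (u : List X) : Set where
    field
      type    : Type
      bundles : Bundles u type
      covers  : ∀ a → ∃[ j ] ∃[ i ] lookup (lookup (proj₂ type) j) i ≡ a

  -- `Bundle` gives every ordered palette a colour, using the same palette in all columns. `Cover`
  -- two-colours the `d`-lists accordingly and selects `t` of them; its length condition is the
  -- value of `q`.
  gadget : ∀ u → ¬ ¬ Gadget u
  gadget u = do
    all ← for-each (allVec (allFin q) d) (λ S → Bd.bundle u d′ (λ _ → lookup S) true)
    return (build λ S → All.lookup all (allVec-complete ∈ₚ.∈-allFin S))
    where
    build : (∀ S → ∃[ c ] Bd.Bundled u d (flips≤ d′ true c) (λ _ → lookup S) c) → Gadget u
    build res = record
      { type    = colour , Ss
      ; bundles = λ j → toBundle (toVec-All {P = λ S → proj₁ (res S) ≡ colour} len (Allₚ.map⁺ (All.map proj₂ mono)) j)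
      ; covers  = λ a → let (S , a∈S , S∈) = ∈ₚ.∈-concat⁻′ (set ∷ sets) (cover (∈ₚ.∈-allFin a))
                            (j , eqⱼ) = toVec-∈ {a₀ = Vec.replicate d a₀} t _ (≤-reflexive len) (∈ₚ.∈-map⁺ (toVec a₀ d) S∈)
                            (i , eqᵢ) = toVec-∈ {a₀ = a₀} d S (≤-reflexive (proj₁ (All.lookup mono S∈))) a∈S
                        in j , i , trans (cong (λ S → lookup S i) eqⱼ) eqᵢ }
      where
      open Cover.Covered (Cover.covered d′ (λ S → proj₁ (res (toVec a₀ d S))) t′ (allFin q) (Listₚ.length-tabulate {n = q} id))
      Ss = toVec (Vec.replicate d a₀) t (map (toVec a₀ d) (set ∷ sets))

      len : length (map (toVec a₀ d) (set ∷ sets)) ≡ t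
      len = cong suc (trans (Listₚ.length-map (toVec a₀ d) sets) length-sets)

      toBundle : ∀ {S} → proj₁ (res S) ≡ colour → Bd.Bundled u d h (λ _ → lookup S) colour
      toBundle {S} eq = subst (Bd.Bundled u d h (λ _ → lookup S)) eq record
        { rows = B.rows ; flips = B.flips ; length-rows = B.length-rows ; mono = B.mono ; cover = B.cover
        ; length-flips = ≤-trans B.length-flips (flips≤half d′ true _) }
        where module B = Bd.Bundled u (proj₂ (res S))

  flip-columns : ∀ {u} → Gadget u → List (Vec D (length u))
  flip-columns G = concatᶠ (λ j → map proj₁ (Bd.Bundled.flips (Gadget.bundles G j)))

  length-flip-columns : ∀ {u} (G : Gadget u) → length (flip-columns G) ≤ t * h
  length-flip-columns G = length-concatᶠ-≤ h (λ j → map proj₁ (Bd.Bundled.flips (Gadget.bundles G j)))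
    (λ j → ≤-trans (≤-reflexive (Listₚ.length-map proj₁ (Bd.Bundled.flips (Gadget.bundles G j)))) (Bd.Bundled.length-flips
          (Gadget.bundles G j)))

  gadgets : ¬ ¬ (∀ u → length u ≤ m → Gadget u)
  gadgets = do
    all ← for-each (allList≤ allX m) gadget
    return (λ u u≤ → All.lookup all (allList≤-complete allX-complete m u u≤))

  module Contradiction (gad : ∀ u → length u ≤ m → Gadget u) where

    columns : ∀ u → List (Vec D (length u))
    columns u with length u ≤? m
    ... | yes u≤ = flip-columns (gad u u≤)
    ... | no  _  = []

    length-columns : ∀ u → length (columns u) ≤ t * h
    length-columns u with length u ≤? m
    ... | yes u≤ = length-flip-columns (gad u u≤)
    ... | no  _  = z≤n

    columns-≡ : ∀ u u≤ → columns u ≡ flip-columns (gad u u≤)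
    columns-≡ u u≤ with length u ≤? m
    ... | yes u≤′ = cong (λ p → flip-columns (gad u p)) (≤-irrelevant u≤′ u≤)
    ... | no  u≰  = ⊥-elim (u≰ u≤)

    Incompatible : List X → List X → Set
    Incompatible u u′ = ∀ g → Valid (u ++ u′) g → col u g ∈ columns u → col u′ g ∈ columns u′ → ⊥

    Incompatible-sym : ∀ {u u′} → Incompatible u u′ → Incompatible u′ u
    Incompatible-sym {u} {u′} inc g valid act act′ = inc g (Valid-⊆ (λ y∈ → case ∈ₚ.∈-++⁻ u y∈ of λ
      { (inj₁ y∈) → ∈ₚ.∈-++⁺ʳ u′ y∈ ; (inj₂ y∈) → ∈ₚ.∈-++⁺ˡ y∈ }) valid) act′ act

    -- q + 1 blocks of t gadgets of the same type, with pairwise incompatible sets.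
    module Blocks (c : Bool) (Ss : Vec (Vec (Fin q) d) t) (covers : ∀ a → ∃[ j ] ∃[ i ] lookup (lookup Ss j) i ≡ a)
                  (u : Fin (suc q) → Fin t → List X) (u≤ : ∀ i j → length (u i j) ≤ m)
                  (bs : ∀ i j → Bd.Bundled (u i j) d h (λ _ → lookup (lookup Ss j)) c)
                  (flips⊆ : ∀ i j {s} → s ∈ Bd.Bundled.flips (bs i j) → proj₁ s ∈ columns (u i j))
                  (apart : ∀ i j i′ j′ → (i , j) ≢ (i′ , j′) → Incompatible (u i j) (u i′ j′)) where

      module B i j = Bd.Bundled (u i j) (bs i j)

      Active : Fin (suc q) → Fin t → (X → D) → Set
      Active i j g = Any (λ (s , _) → s ≡ col (u i j) g) (B.flips i j)

      active? : ∀ i g → Dec (∃[ j ] Active i j g)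
      active? i g = Finₚ.any? (λ j → Any.any? (λ (s , _) → Vecₚ.≡-dec _≟ᴰ_ s (col (u i j) g)) (B.flips i j))

      Active-cong : ∀ i {g g′} j → (∀ y → y ∈ u i j → g y ≡ g′ y) → Active i j g → Active i j g′
      Active-cong i j eq = subst (λ s′ → Any (λ (s , _) → s ≡ s′) (B.flips i j)) (col-cong (u i j) eq)

      clash : ∀ w g → Valid w g → ∀ i j i′ j′ → u i j ⊆ w → u i′ j′ ⊆ w → Active i j g → Active i′ j′ g → (i , j) ≡ (i′ , j′)
      clash w g valid i j i′ j′ ⊆w ⊆w′ act act′ with ×ₚ.≡-dec Finₚ._≟_ Finₚ._≟_ (i , j) (i′ , j′)
      ... | yes eq = eq
      ... | no  ne = ⊥-elim (apart i j i′ j′ ne g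
        (Valid-⊆ (λ y∈ → case ∈ₚ.∈-++⁻ (u i j) y∈ of λ { (inj₁ y∈) → ⊆w y∈ ; (inj₂ y∈) → ⊆w′ y∈ }) valid)
              (in-columns i j act) (in-columns i′ j′ act′))
        where
        in-columns : ∀ i j → Active i j g → col (u i j) g ∈ columns (u i j)
        in-columns i j act = let (s , s∈ , eq) = find act in subst (_∈ columns (u i j)) eq (flips⊆ i j s∈)

      missing : ∀ i j → (X → D) → List (Fin q)
      missing i j g = map proj₂ (filter (λ (s , _) → Vecₚ.≡-dec _≟ᴰ_ s (col (u i j) g)) (B.flips i j))

      missing-active : ∀ i j g {a} → a ∈ missing i j g → Active i j g
      missing-active i j g a∈ = let (_ , s∈ , _) = ∈ₚ.∈-map⁻ proj₂ a∈
                                    (s∈′ , eq) = ∈ₚ.∈-filter⁻ (λ (s , _) → Vecₚ.≡-dec _≟ᴰ_ s (col (u i j) g)) s∈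
                                in Any.map (λ { refl → eq }) s∈′

      length-missing : ∀ i j g → length (missing i j g) ≤ h
      length-missing i j g = ≤-trans (≤-reflexive (Listₚ.length-map proj₂ (filter (λ (s , _) → Vecₚ.≡-dec _≟ᴰ_ s (col
            (u i j) g)) (B.flips i j))))
        (≤-trans (Listₚ.length-filter (λ (s , _) → Vecₚ.≡-dec _≟ᴰ_ s (col (u i j) g)) (B.flips i j)) (B.length-flips i j))

      missingᵇ : Fin (suc q) → (X → D) → List (Fin q)
      missingᵇ i g = concatᶠ (λ j → missing i j g)

      row-points : ∀ i j → List (List X × Point)
      row-points i j = map (λ r → u i j , r ∘ col (u i j)) (B.rows i j)

      block-points : ∀ i → List (List X × Point)
      block-points i = concatᶠ (row-points i)

      missing-cong : ∀ i {g g′} → (∀ j y → y ∈ u i j → g y ≡ g′ y) → missingᵇ i g ≡ missingᵇ i g′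
      missing-cong i eq = cong concat (Listₚ.tabulate-cong (λ j →
        cong (λ s′ → map proj₂ (filter (λ (s , _) → Vecₚ.≡-dec _≟ᴰ_ s s′) (B.flips i j))) (col-cong (u i j) (eq j))))

      -- The values on the active assignments alone force the colour `not c`: the points on `v` that
      -- extend them form a monochromatic subcube.
      Prescribed : Fin (suc q) → List X → Point → Set
      Prescribed i v ω = Local v ω × (∀ z → Local v z → (∀ g → (∃[ j ] Active i j g) → z g ≡ ω g) → color v z ≡ not c)

      -- Otherwise h points of colour c supply the colours that the block's rows miss.
      subcube : ∀ i v → (∀ j → u i j ⊆ v) → length v ≤ M → ¬ ¬ (∃[ ω ] Prescribed i v ω)
      subcube i v u⊆v v≤M none = for-each (allFin h) counterexample λ zs → refute (λ l → All.lookup zs (∈ₚ.∈-allFin l))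
        where
        ω : Fin h → Point
        -- The `l`-th point is to supply the `l`-th missing colour; `a₀` stands in where fewer
        -- colours are missing.
        ω l g = nthOr a₀ (missingᵇ i g) (toℕ l)

        ω-local : ∀ l → Local v (ω l)
        ω-local l g g′ eq = cong (λ as → nthOr a₀ as (toℕ l)) (missing-cong i (λ j y y∈ → eq y (u⊆v j y∈)))

        Counterexample : Fin h → Set
        Counterexample l = ∃[ z ] Local v z × (∀ g → (∃[ j ] Active i j g) → z g ≡ ω l g) × color v z ≡ c

        counterexample : ∀ l → ¬ ¬ Counterexample l
        counterexample l ¬ex = none (ω l , ω-local l , λ z loc agree → case color v z Boolₚ.≟ c of λ
          { (yes eq) → ⊥-elim (¬ex (z , loc , agree , eq)) ; (no ne) → Boolₚ.¬-not ne })

        refute : (∀ l → Counterexample l) → ⊥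
        refute zs = no-mono ps length-ps bounded rainbow c mono
          where
          extras = map (λ l → v , proj₁ (zs l)) (allFin h)
          ps = block-points i ++ extras

          length-ps : length ps ≡ k
          length-ps = trans (Listₚ.length-++ (block-points i)) (cong₂ _+_
            (length-concatᶠ d (row-points i) (λ j → trans (Listₚ.length-map _ (B.rows i j)) (B.length-rows i j)))
            (trans (Listₚ.length-map _ (allFin h)) (Listₚ.length-tabulate {n = h} id)))

          bounded : All (λ (v , x) → length v ≤ M × Local v x) ps
          bounded = Allₚ.++⁺
            (Allₚ.concat⁺ (Allₚ.tabulate⁺ (λ j → Allₚ.map⁺ (All.universal (λ r → ≤-trans (u≤ i j) (≤-trans (m≤m+n m _)
                  (≤-trans (m≤m+n (t * m) _) M≥)) ,
              λ g g′ eq → cong r (col-cong (u i j) eq)) (B.rows i j)))))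
            (Allₚ.map⁺ (All.universal (λ l → v≤M , proj₁ (proj₂ (zs l))) (allFin h)))

          mono : All (λ (v , x) → color v x ≡ c) ps
          mono = Allₚ.++⁺ (Allₚ.concat⁺ (Allₚ.tabulate⁺ (λ j → Allₚ.map⁺ (B.mono i j))))
            (Allₚ.map⁺ (All.universal (λ l → proj₂ (proj₂ (proj₂ (zs l)))) (allFin h)))

          rainbow : ∀ g → Valid (concatMap proj₁ ps) g → ∀ a → Any (λ (_ , x) → x g ≡ a) ps
          rainbow g valid a = let (j , i′ , eq) = covers a in
            case B.cover i j (col (u i j) g) i′ of λ
            { (inj₁ found) → Anyₚ.++⁺ˡ (Anyₚ.concat⁺ (Anyₚ.tabulate⁺ {f = row-points i} j
                  (Anyₚ.map⁺ {f = λ r → u i j , r ∘ col (u i j)} (Any.map (λ eq′ → trans eq′ eq) found))))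
            ; (inj₂ lost)  → Anyₚ.++⁺ʳ (block-points i) (Anyₚ.map⁺ (supplied (∈-concatᶠ (λ j → missing i j g) j
                (∈ₚ.∈-map⁺ proj₂ (∈ₚ.∈-filter⁺ (λ (s , _) → Vecₚ.≡-dec _≟ᴰ_ s (col (u i j) g)) (subst (λ a →
                      (_ , a) ∈ B.flips i j) eq lost) refl))) j
                (Any.map (λ { refl → refl }) lost))) }
            where
            v⊆ : v ⊆ concatMap proj₁ ps
            v⊆ y∈ = ∈ₚ.∈-concat⁺′ y∈ (∈ₚ.∈-map⁺ proj₁ (∈ₚ.∈-++⁺ʳ (block-points i) (here refl)))

            valid-v : Valid v g
            valid-v = Valid-⊆ v⊆ valid

            length≤h : length (missingᵇ i g) ≤ h
            length≤h = length-concatᶠ-unique h (λ j → missing i j g) (λ j → length-missing i j g)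
              (λ j j′ a∈ a′∈ → cong proj₂ (clash v g valid-v i j i j′ (u⊆v j) (u⊆v j′) (missing-active i j g a∈)
                    (missing-active i j′ g a′∈)))

            supplied : ∀ {a} → a ∈ missingᵇ i g → ∀ j → Active i j g → Any (λ l → proj₁ (zs l) g ≡ a) (allFin h)
            supplied a∈ j act = Any.map (λ { {l} refl → trans (proj₁ (proj₂ (proj₂ (zs l))) g (j , act))
                (trans (cong (nthOr a₀ (missingᵇ i g)) (Finₚ.toℕ-inject≤ (Any.index a∈) length≤h)) (nthOr-index a∈)) })
              (∈ₚ.∈-allFin (Fin.inject≤ (Any.index a∈) length≤h))

      block : Fin (suc q) → List X
      block i = concatᶠ (u i)

      all-blocks : List X
      all-blocks = concatᶠ block

      -- The point of block zero must see whether any of the other blocks is active; every other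
      -- point looks at its own block only.
      scope : Fin (suc q) → List X
      scope zero    = all-blocks
      scope (suc a) = block (suc a)

      u⊆block : ∀ i j → u i j ⊆ block i
      u⊆block i j = ∈-concatᶠ (u i) j

      u⊆all : ∀ i j → u i j ⊆ all-blocks
      u⊆all i j y∈ = ∈-concatᶠ block i (u⊆block i j y∈)

      u⊆scope : ∀ i j → u i j ⊆ scope i
      u⊆scope zero    j = u⊆all zero j
      u⊆scope (suc a) j = u⊆block (suc a) j

      length-block : ∀ i → length (block i) ≤ t * m
      length-block i = length-concatᶠ-≤ m (u i) (u≤ i)

      length-scope : ∀ i → length (scope i) ≤ M
      length-scope zero    = ≤-trans (length-concatᶠ-≤ (t * m) block length-block) M≥
      length-scope (suc a) = ≤-trans (length-block (suc a)) (≤-trans (m≤m+n (t * m) _) M≥)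

      contradiction-blocks : ⊥
      contradiction-blocks = for-each (allFin (suc q)) (λ i → subcube i (scope i) (u⊆scope i) (length-scope i))
        λ ωs → refute (λ i → All.lookup ωs (∈ₚ.∈-allFin i))
        where
        refute : (∀ i → ∃[ ω ] Prescribed i (scope i) ω) → ⊥
        refute ωs = no-mono ps length-ps bounded rainbow (not c) mono
          where
          -- The points in block 1 + a take the colour a, unless prescribed;
          -- the point on all blocks sees which one is prescribed, and steps in.
          default : Fin (suc q) → Point
          default (suc a) g = a
          default zero    g with Finₚ.any? (λ a → active? (suc a) g)
          ... | yes (a , _) = a
          ... | no  _       = a₀

          raw : Fin (suc q) → Point
          raw i g with active? i g
          ... | yes _ = proj₁ (ωs i) g
          ... | no  _ = default i g

          -- Passing through the values on the scope makes `z i` local by construction, although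
          -- `raw i` is defined from whole assignments.
          restrict : Fin (suc q) → (X → D) → X → D
          restrict i g = ext (scope i) (col (scope i) g)

          z : Fin (suc q) → Point
          z i g = raw i (restrict i g)

          restrict-≡ : ∀ i g y → y ∈ scope i → restrict i g y ≡ g y
          restrict-≡ i g = ext-col (scope i) g

          z-local : ∀ i → Local (scope i) (z i)
          z-local i g g′ eq = cong (raw i ∘ ext (scope i)) (col-cong (scope i) eq)

          raw-prescribed : ∀ i g → (∃[ j ] Active i j g) → raw i g ≡ proj₁ (ωs i) g
          raw-prescribed i g act with active? i g
          ... | yes _    = refl
          ... | no  ¬act = ⊥-elim (¬act act)

          raw-default : ∀ i g → ¬ (∃[ j ] Active i j g) → raw i g ≡ default i g
          raw-default i g ¬act with active? i g
          ... | yes act = ⊥-elim (¬act act)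
          ... | no  _   = refl

          z-colour : ∀ i → color (scope i) (z i) ≡ not c
          z-colour i = proj₂ (proj₂ (ωs i)) (z i) (z-local i) λ g (j , act) →
            trans (raw-prescribed i (restrict i g) (j , Active-cong i j (λ y y∈ → sym (restrict-≡ i g y (u⊆scope i j y∈))) act))
              (proj₁ (proj₂ (ωs i)) (restrict i g) g (restrict-≡ i g))

          point : Fin (suc q) → List X × Point
          point i = scope i , z i

          ps : List (List X × Point)
          ps = map (λ a → point (suc a)) (allFin q) ++ List.replicate (t′ + h) (point zero)

          for-all-ps : ∀ {P : List X × Point → Set} → (∀ i → P (point i)) → All P ps
          for-all-ps p = Allₚ.++⁺ (Allₚ.map⁺ (All.universal (λ a → p (suc a)) (allFin q))) (Allₚ.replicate⁺ (t′ + h) (p zero))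

          length-ps : length ps ≡ k
          length-ps = trans (Listₚ.length-++ (map (λ a → point (suc a)) (allFin q))) (trans (cong₂ _+_
            (trans (Listₚ.length-map _ (allFin q)) (Listₚ.length-tabulate {n = q} id)) (Listₚ.length-replicate (t′ + h))) (sym k≡q+))

          bounded : All (λ (v , x) → length v ≤ M × Local v x) ps
          bounded = for-all-ps {λ (v , x) → length v ≤ M × Local v x} (λ i → length-scope i , z-local i)

          mono : All (λ (v , x) → color v x ≡ not c) ps
          mono = for-all-ps {λ (v , x) → color v x ≡ not c} z-colour

          in-first : ∀ {P : List X × Point → Set} a → P (point (suc a)) → Any P ps
          in-first a p = Anyₚ.++⁺ˡ (Anyₚ.map⁺ (Any.map (λ { refl → p }) (∈ₚ.∈-allFin a)))

          zero∈ : point zero ∈ List.replicate (t′ + h) (point zero)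
          -- There is at least one copy because `d` is at least two, which makes `h` a successor.
          zero∈ = subst (λ n → point zero ∈ List.replicate n (point zero)) (sym (+-suc t′ _)) (here refl)

          rainbow : ∀ g → Valid (concatMap proj₁ ps) g → ∀ a → Any (λ (_ , x) → x g ≡ a) ps
          rainbow g valid a with active? (suc a) (restrict (suc a) g) in dec
          ... | no  ¬act = in-first a (raw-default (suc a) (restrict (suc a) g) ¬act)
          ... | yes (j , act) = Anyₚ.++⁺ʳ (map (λ a → point (suc a)) (allFin q)) (Any.map (λ { refl → steps-in }) zero∈)
            where
            all⊆ : all-blocks ⊆ concatMap proj₁ ps
            all⊆ y∈ = ∈ₚ.∈-concat⁺′ y∈ (∈ₚ.∈-map⁺ proj₁ (∈ₚ.∈-++⁺ʳ (map (λ a → point (suc a)) (allFin q)) zero∈))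

            only : ∀ i j′ → Active i j′ (restrict zero g) → (suc a , j) ≡ (i , j′)
            only i j′ act′ = clash all-blocks g (Valid-⊆ all⊆ valid) (suc a) j i j′ (u⊆all _ _) (u⊆all _ _)
              (Active-cong (suc a) j (λ y y∈ → restrict-≡ (suc a) g y (u⊆scope (suc a) j y∈)) act)
              (Active-cong i j′ (λ y y∈ → restrict-≡ zero g y (u⊆all i j′ y∈)) act′)

            default≡a : default zero (restrict zero g) ≡ a
            default≡a with Finₚ.any? (λ a → active? (suc a) (restrict zero g))
            ... | yes (a′ , j′ , act′) = Finₚ.suc-injective (cong proj₁ (sym (only (suc a′) j′ act′)))
            ... | no  none = ⊥-elim (none (a , j , Active-cong (suc a) j
              (λ y y∈ → trans (restrict-≡ (suc a) g y (u⊆scope (suc a) j y∈)) (sym (restrict-≡ zero g y (u⊆all (suc a) j y∈)))) act))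

            steps-in : z zero g ≡ a
            -- Block `suc a` is active, so incompatibility keeps block zero idle and its point takes
            -- the default.
            steps-in = trans (raw-default zero (restrict zero g) (λ (j′ , act′) → case cong proj₁ (only zero j′ act′) of λ ())) default≡a

    types : List Type
    types = List.cartesianProduct (true ∷ false ∷ []) (allVec (allVec (allFin q) d) t)

    types-complete : ∀ τ → τ ∈ types
    types-complete (c , Ss) = ∈ₚ.∈-cartesianProduct⁺ (bool c) (allVec-complete (allVec-complete ∈ₚ.∈-allFin) Ss)
      where
      bool : ∀ c → c ∈ true ∷ false ∷ []
      bool true  = here refl
      bool false = there (here refl)

    no-family : ∀ Us → All (λ u → length u ≤ m) Us → AllPairs Incompatible Us → length types * (suc q * t) < length Us → ⊥
    no-family Us Us≤ incs lt =
      let ((c , Ss) , ys , _ , incs′ , tys , lt′) = pigeonhole {P = λ τ u → ∃[ u≤ ] Gadget.type (gad u u≤) ≡ τ} types Us (suc q * t) incs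
            (All.map (λ {u} u≤ → Gadget.type (gad u u≤) , types-complete _ , u≤ , refl) Us≤) lt
      in same-type c Ss ys incs′ tys lt′
      where
      same-type : ∀ c Ss ys → AllPairs Incompatible ys → All (λ u → ∃[ u≤ ] Gadget.type (gad u u≤) ≡
            (c , Ss)) ys → suc q * t < length ys → ⊥
      same-type c Ss ys incs tys lt = Blocks.contradiction-blocks c Ss covers u (λ i j → proj₁ (ty i j)) bs flips⊆
        (λ i j i′ j′ ne → AllPairs-lookup {R = Incompatible} (λ {x} {y} → Incompatible-sym {x} {y}) incs (idx i j)
              (idx i′ j′) (λ eq → ne (idx-injective i j i′ j′ eq)))
        where
        idx : Fin (suc q) → Fin t → Fin (length ys)
        idx i j = Fin.inject≤ (Fin.combine i j) (<⇒≤ lt)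

        idx-injective : ∀ i j i′ j′ → idx i j ≡ idx i′ j′ → (i , j) ≡ (i′ , j′)
        idx-injective i j i′ j′ eq = let (eq₁ , eq₂) = Finₚ.combine-injective i j i′ j′ (Finₚ.inject≤-injective (<⇒≤ lt) (<⇒≤ lt) _ _ eq) in cong₂ _,_ eq₁ eq₂

        u : Fin (suc q) → Fin t → List X
        u i j = List.lookup ys (idx i j)

        ty : ∀ i j → ∃[ u≤ ] Gadget.type (gad (u i j) u≤) ≡ (c , Ss)
        ty i j = All.lookup tys (∈ₚ.∈-lookup (idx i j))

        bundles-at : ∀ {u τ} (G : Gadget u) → Gadget.type G ≡ τ → Bundles u τ
        bundles-at G refl = Gadget.bundles G

        flips-at : ∀ {u τ} (G : Gadget u) (eq : Gadget.type G ≡ τ) j {s} → s ∈ Bd.Bundled.flips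
              (bundles-at G eq j) → proj₁ s ∈ flip-columns G
        flips-at {u} G refl j s∈ = ∈-concatᶠ (λ j → map proj₁ (Bd.Bundled.flips (Gadget.bundles G j))) j (∈ₚ.∈-map⁺ proj₁ s∈)

        bs : ∀ i j → Bd.Bundled (u i j) d h (λ _ → lookup (lookup Ss j)) c
        bs i j = bundles-at (gad (u i j) (proj₁ (ty i j))) (proj₂ (ty i j)) j

        flips⊆ : ∀ i j {s} → s ∈ Bd.Bundled.flips (bs i j) → proj₁ s ∈ columns (u i j)
        flips⊆ i j s∈ = subst (_ ∈_) (sym (columns-≡ (u i j) (proj₁ (ty i j)))) (flips-at (gad (u i j) (proj₁ (ty i j)))
              (proj₂ (ty i j)) j s∈)

        covers : ∀ a → ∃[ j ] ∃[ i ] lookup (lookup Ss j) i ≡ a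
        covers a = let (u≤ , eq) = ty zero zero in subst (λ τ → ∃[ j ] ∃[ i ] lookup (lookup (proj₂ τ) j) i ≡ a) eq (Gadget.covers (gad (u zero zero) u≤) a)

-- Hypergraphs of constraint systems

∧-true : ∀ {a b} → a ∧ b ≡ true → a ≡ true × b ≡ true
∧-true {true} {true} _ = refl , refl

does-true : ∀ {P : Set} {P? : Dec P} → does P? ≡ true → P
does-true {P? = yes p} _ = p

does-false : ∀ {P : Set} {P? : Dec P} → does P? ≡ false → ¬ P
does-false {P? = no ¬p} _ = ¬p

≡-⇔ : ∀ {a b} → (a ≡ true → b ≡ true) → (b ≡ true → a ≡ true) → a ≡ b
≡-⇔ {true}  {b}     f g = sym (f refl)
≡-⇔ {false} {false} f g = refl
≡-⇔ {false} {true}  f g = g refl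

-- The label of a position in the word  pair x u  padded with blanks: every bit
-- of x is preceded by a marker, the witness u goes to the free cells.
data Label : Set where
  marker separator free padding : Label
  input : Bool → Label

-- These are the tests that a machine can make by moving heads on counters. All that depends only on
-- colours, values and the transition table is precomputed into `constᵉ`.
data BExp (n : ℕ) : Set where
  constᵉ      : Bool → BExp n
  eqᵉ succᵉ   : Fin n → Fin n → BExp n
  zeroᵉ lastᵉ : Fin n → BExp n
  labelᵉ      : (Label → Bool) → Fin n → BExp n
  _∧ᵉ_        : BExp n → BExp n → BExp n
  ¬ᵉ_         : BExp n → BExp n

infixr 6 _∧ᵉ_
infix  7 ¬ᵉ_
infixr 5 _⇒ᵉ_

_⇒ᵉ_ : ∀ {n} → BExp n → BExp n → BExp n
e ⇒ᵉ f = ¬ᵉ (e ∧ᵉ ¬ᵉ f)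

⋀ ⋁ : ∀ {n} → List (BExp n) → BExp n
⋀ []       = constᵉ true
⋀ (e ∷ es) = e ∧ᵉ ⋀ es
⋁ []       = constᵉ false
⋁ (e ∷ es) = ¬ᵉ (¬ᵉ e ∧ᵉ ¬ᵉ ⋁ es)

rename : ∀ {m n} → (Fin m → Fin n) → BExp m → BExp n
rename f (constᵉ b)   = constᵉ b
rename f (eqᵉ x y)    = eqᵉ (f x) (f y)
rename f (succᵉ x y)  = succᵉ (f x) (f y)
rename f (zeroᵉ x)    = zeroᵉ (f x)
rename f (lastᵉ x)    = lastᵉ (f x)
rename f (labelᵉ p x) = labelᵉ p (f x)
rename f (e ∧ᵉ e′)    = rename f e ∧ᵉ rename f e′
rename f (¬ᵉ e)       = ¬ᵉ rename f e

-- Loops bind the variable zero, which ranges over the positions.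
data Emitter (n : ℕ) : Set where
  skip : Emitter n
  emit : Bool → Emitter n
  _⨾_  : Emitter n → Emitter n → Emitter n
  for  : Emitter (suc n) → Emitter n
  ifᵉ  : BExp n → Emitter n → Emitter n → Emitter n

infixr 4 _⨾_

forⁿ : ∀ r {n} → Emitter (r + n) → Emitter n
forⁿ zero    e = e
forⁿ (suc r) e = forⁿ r (for e)

each : ∀ {n} {A : Set} → List A → (A → Emitter n) → Emitter n
each []       f = skip
each (x ∷ xs) f = f x ⨾ each xs f

concatMap-product : ∀ {A B C D : Set} {f : A → B → C} (g : C → List D) xs ys →
  concatMap g (cartesianProductWith f xs ys) ≡ concatMap (λ x → concatMap (λ y → g (f x y)) ys) xs
concatMap-product g []       ys = refl
concatMap-product {f = f} g (x ∷ xs) ys = trans (Listₚ.concatMap-++ g (map (f x) ys) _)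
  (cong₂ _++_ (Listₚ.concatMap-map g (f x) ys) (concatMap-product g xs ys))

module Semantics {N : ℕ} (lbl : Fin N → Label) where

  eval : ∀ {n} → BExp n → Vec (Fin N) n → Bool
  eval (constᵉ b)   ρ = b
  eval (eqᵉ x y)    ρ = does (lookup ρ x Finₚ.≟ lookup ρ y)
  eval (succᵉ x y)  ρ = does (toℕ (lookup ρ y) ℕₚ.≟ suc (toℕ (lookup ρ x)))
  eval (zeroᵉ x)    ρ = does (toℕ (lookup ρ x) ℕₚ.≟ 0)
  eval (lastᵉ x)    ρ = does (suc (toℕ (lookup ρ x)) ℕₚ.≟ N)
  eval (labelᵉ p x) ρ = p (lbl (lookup ρ x))
  eval (e ∧ᵉ e′)    ρ = eval e ρ ∧ eval e′ ρ
  eval (¬ᵉ e)       ρ = not (eval e ρ)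

  ⟦_⟧ : ∀ {n} → Emitter n → Vec (Fin N) n → List Bool
  ⟦ skip ⟧      ρ = []
  ⟦ emit b ⟧    ρ = [ b ]
  ⟦ e ⨾ e′ ⟧    ρ = ⟦ e ⟧ ρ ++ ⟦ e′ ⟧ ρ
  ⟦ for e ⟧     ρ = concatMap (λ i → ⟦ e ⟧ (i ∷ ρ)) (allFin N)
  ⟦ ifᵉ b e e′ ⟧ ρ = if eval b ρ then ⟦ e ⟧ ρ else ⟦ e′ ⟧ ρ

  ⇒ᵉ-elim : ∀ {n} (e f : BExp n) {ρ} → eval (e ⇒ᵉ f) ρ ≡ true → eval e ρ ≡ true → eval f ρ ≡ true
  ⇒ᵉ-elim e f {ρ} eq e-true with eval e ρ | eval f ρ
  ... | true | true = refl

  ⇒ᵉ-intro : ∀ {n} (e f : BExp n) {ρ} → (eval e ρ ≡ true → eval f ρ ≡ true) → eval (e ⇒ᵉ f) ρ ≡ true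
  ⇒ᵉ-intro e f {ρ} imp with eval e ρ
  ... | false = refl
  ... | true  rewrite imp refl = refl

  ⋀-elim : ∀ {n} {A : Set} (f : A → BExp n) xs {ρ} → eval (⋀ (map f xs)) ρ ≡ true → ∀ {x} → x ∈ xs → eval (f x) ρ ≡ true
  ⋀-elim f (x ∷ xs) eq (here refl) = proj₁ (∧-true eq)
  ⋀-elim f (x ∷ xs) eq (there x∈)  = ⋀-elim f xs (proj₂ (∧-true eq)) x∈

  ⋀-intro : ∀ {n} {A : Set} (f : A → BExp n) xs {ρ} → (∀ x → x ∈ xs → eval (f x) ρ ≡ true) → eval (⋀ (map f xs)) ρ ≡ true
  ⋀-intro f []       h = refl
  ⋀-intro f (x ∷ xs) h = cong₂ _∧_ (h x (here refl)) (⋀-intro f xs (λ x x∈ → h x (there x∈)))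

  ⋁-elim : ∀ {n} {A : Set} (f : A → BExp n) xs {ρ} → eval (⋁ (map f xs)) ρ ≡ true → ∃[ x ] x ∈ xs × eval (f x) ρ ≡ true
  ⋁-elim f (x ∷ xs) {ρ} eq with eval (f x) ρ in eq′
  ... | true  = x , here refl , eq′
  ... | false = let (y , y∈ , eq″) = ⋁-elim f xs (trans (sym (Boolₚ.not-involutive _)) eq) in y , there y∈ , eq″

  ⋁-intro : ∀ {n} {A : Set} (f : A → BExp n) xs {ρ} {x} → x ∈ xs → eval (f x) ρ ≡ true → eval (⋁ (map f xs)) ρ ≡ true
  ⋁-intro f (x ∷ xs) (here refl) eq rewrite eq = refl
  ⋁-intro f (x ∷ xs) {ρ} (there x∈) eq with eval (f x) ρ
  ... | true  = refl
  ... | false = trans (Boolₚ.not-involutive _) (⋁-intro f xs x∈ eq)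

  eval-rename : ∀ {m n} (f : Fin m → Fin n) (e : BExp m) {ρ : Vec (Fin N) n} {σ} → (∀ x → lookup ρ (f x) ≡ lookup σ x) →
    eval (rename f e) ρ ≡ eval e σ
  eval-rename f (constᵉ b)   eq = refl
  eval-rename f (eqᵉ x y)    eq = cong₂ (λ i j → does (i Finₚ.≟ j)) (eq x) (eq y)
  eval-rename f (succᵉ x y)  eq = cong₂ (λ i j → does (toℕ j ℕₚ.≟ suc (toℕ i))) (eq x) (eq y)
  eval-rename f (zeroᵉ x)    eq = cong (λ i → does (toℕ i ℕₚ.≟ 0)) (eq x)
  eval-rename f (lastᵉ x)    eq = cong (λ i → does (suc (toℕ i) ℕₚ.≟ N)) (eq x)
  eval-rename f (labelᵉ p x) eq = cong (p ∘ lbl) (eq x)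
  eval-rename f (e ∧ᵉ e′)    eq = cong₂ _∧_ (eval-rename f e eq) (eval-rename f e′ eq)
  eval-rename f (¬ᵉ e)       eq = cong not (eval-rename f e eq)

  ⟦each⟧ : ∀ {n} {A : Set} (xs : List A) (f : A → Emitter n) ρ → ⟦ each xs f ⟧ ρ ≡ concatMap (λ x → ⟦ f x ⟧ ρ) xs
  ⟦each⟧ []       f ρ = refl
  ⟦each⟧ (x ∷ xs) f ρ = cong (⟦ f x ⟧ ρ ++_) (⟦each⟧ xs f ρ)

  ⟦forⁿ⟧ : ∀ r {n} (e : Emitter (r + n)) ρ → ⟦ forⁿ r e ⟧ ρ ≡ concatMap (λ v → ⟦ e ⟧ (v Vec.++ ρ)) (allVec (allFin N) r)
  ⟦forⁿ⟧ zero    e ρ = sym (Listₚ.++-identityʳ _)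
  ⟦forⁿ⟧ (suc r) e ρ = trans (⟦forⁿ⟧ r (for e) ρ) (sym (concatMap-product (λ v → ⟦ e ⟧ (v Vec.++ ρ)) (allVec (allFin N) r) (allFin N)))

module _ {A : Set} (_≟_ : DecidableEquality A) where

  open import Data.List.Membership.DecPropositional _≟_ using (_∈?_)

  card-∷ : ∀ e es (vs : List A) → e ∉ es →
    ∣ Vec.map (λ v → does (v ∈? (e ∷ es))) (Vec.fromList vs) ∣ ≡
    ∣ Vec.map (λ v → does (v ≟ e)) (Vec.fromList vs) ∣ + ∣ Vec.map (λ v → does (v ∈? es)) (Vec.fromList vs) ∣
  card-∷ e es []       e∉ = refl
  card-∷ e es (v ∷ vs) e∉ with v ≟ e | v ∈? es
  ... | yes refl | yes v∈ = ⊥-elim (e∉ v∈)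
  ... | yes refl | no  _  = cong suc (card-∷ e es vs e∉)
  ... | no  _    | yes _  = trans (cong suc (card-∷ e es vs e∉)) (sym (+-suc _ _))
  ... | no  _    | no  _  = card-∷ e es vs e∉

  card-∉ : ∀ e (vs : List A) → e ∉ vs → ∣ Vec.map (λ v → does (v ≟ e)) (Vec.fromList vs) ∣ ≡ 0
  card-∉ e []       e∉ = refl
  card-∉ e (v ∷ vs) e∉ with v ≟ e
  ... | yes refl = ⊥-elim (e∉ (here refl))
  ... | no  _    = card-∉ e vs (e∉ ∘ there)

  card-≟ : ∀ e (vs : List A) → Unique vs → e ∈ vs → ∣ Vec.map (λ v → does (v ≟ e)) (Vec.fromList vs) ∣ ≡ 1
  card-≟ e (v ∷ vs) (v∉ ∷ unique) e∈ with v ≟ e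
  ... | yes refl = cong suc (card-∉ e vs (λ e∈ → All.lookup v∉ e∈ refl))
  ... | no  v≢e  with e∈
  ... | here e≡v  = ⊥-elim (v≢e (sym e≡v))
  ... | there e∈′ = card-≟ e vs unique e∈′

  card-members : ∀ es (vs : List A) → Unique vs → Unique es → es ⊆ vs →
    ∣ Vec.map (λ v → does (v ∈? es)) (Vec.fromList vs) ∣ ≡ length es
  card-members []       vs u []       es⊆ = none vs
    where
    none : ∀ vs → ∣ Vec.map (λ v → does (v ∈? [])) (Vec.fromList vs) ∣ ≡ 0
    none []       = refl
    none (v ∷ vs) = none vs
  card-members (e ∷ es) vs u (e∉ ∷ ue) es⊆ = trans (card-∷ e es vs (λ e∈ → All.lookup e∉ e∈ refl))
    (cong₂ _+_ (card-≟ e vs u (es⊆ (here refl))) (card-members es vs u ue (es⊆ ∘ there)))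

module _ {A : Set} (key : A → ℕ) where

  Increasing : List A → Set
  Increasing = AllPairs (λ x y → key x < key y)

  increasing-unique : ∀ {xs ys} → Increasing xs → Increasing ys → xs ⊆ ys → ys ⊆ xs → xs ≡ ys
  increasing-unique {[]}     {[]}     _        _        _   _   = refl
  increasing-unique {[]}     {y ∷ ys} _        _        _   ⊆[] with ⊆[] (here refl)
  ... | ()
  increasing-unique {x ∷ xs} {[]}     _        _        ⊆[] _   with ⊆[] (here refl)
  ... | ()
  increasing-unique {x ∷ xs} {y ∷ ys} (lx ∷ ix) (ly ∷ iy) sub sup with heads
    where
    heads : x ≡ y
    heads with sub (here refl) | sup (here refl)
    ... | here eq  | _        = eq
    ... | there _  | here eq  = sym eq
    ... | there x∈ | there y∈ = ⊥-elim (<-asym (All.lookup ly x∈) (All.lookup lx y∈))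
  ... | refl = cong (x ∷_) (increasing-unique ix iy (tail lx sub) (tail ly sup))
    where
    tail : ∀ {as bs} → All (λ z → key x < key z) as → x ∷ as ⊆ x ∷ bs → as ⊆ bs
    tail l sub z∈ with sub (there z∈)
    ... | here refl = ⊥-elim (<-irrefl refl (All.lookup l z∈))
    ... | there z∈′ = z∈′

map-unique : ∀ {A B : Set} (f : A → B) {xs} → (∀ {x y} → x ∈ xs → y ∈ xs → f x ≡ f y → x ≡ y) → Unique xs → Unique (map f xs)
map-unique f inj []           = []
map-unique f inj (x∉ ∷ unique) =
  Allₚ.map⁺ (All.tabulate (λ y∈ eq → All.lookup x∉ y∈ (inj (here refl) (there y∈) eq))) ∷
  map-unique f (λ x∈ y∈ → inj (there x∈) (there y∈)) unique

allVec-unique : ∀ {A : Set} {xs : List A} → Unique xs → ∀ n → Unique (allVec xs n)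
allVec-unique u zero    = [] ∷ []
allVec-unique u (suc n) = Uniqueₚ.cartesianProductWith⁺ (flip _∷_) (λ eq → Vecₚ.∷-injectiveʳ eq , Vecₚ.∷-injectiveˡ eq)
      (allVec-unique u n) u

-- Scanning the copies in increasing order and giving each to any waiting item
-- that accepts it serves all items, if each accepts at least as many copies as
-- there are items.
module Arrange {I C : Set} (_<ᶜ_ : C → C → Set) (accepts : I → C → Bool) where

  available : I → List C → ℕ
  available i cs = length (filter (λ c → accepts i c Boolₚ.≟ true) cs)

  arrange : ∀ cs → AllPairs _<ᶜ_ cs → ∀ is → All (λ i → length is ≤ available i cs) is →
    ∃[ out ] AllPairs (λ x y → proj₁ x <ᶜ proj₁ y) out × All (λ (c , i) → accepts i c ≡ true × c ∈ cs) out × map proj₂ out ↭ is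
  arrange cs       _  []       _ = [] , [] , [] , ↭.refl
  arrange []       _  (i ∷ is) (() ∷ _)
  arrange (c ∷ cs) (c< ∷ s) is@(_ ∷ _) enough with Any.any? (λ i → accepts i c Boolₚ.≟ true) is
  ... | no none =
    let (out , inc , acc , perm) = arrange cs s is (All.zipWith (λ { {i} (≤av , ¬acc) → ≤-trans ≤av (≤-reflexive
          (rejected i ¬acc)) }) (enough , Allₚ.¬Any⇒All¬ is none))
    in out , inc , All.map (λ (a , c∈) → a , there c∈) acc , perm
    where
    rejected : ∀ i → ¬ (accepts i c ≡ true) → available i (c ∷ cs) ≡ available i cs
    rejected i ¬acc = cong length (Listₚ.filter-reject (λ c → accepts i c Boolₚ.≟ true) {x = c} {xs = cs} ¬acc)
  ... | yes some with find some
  ... | i , i∈ , acc with ∈ₚ.∈-∃++ i∈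
  ... | as , bs , eq =
    let (out , inc , accs , perm′) = arrange cs s (as ++ bs) (⊆ₚ.All-resp-⊇ rest⊆ (All.map (λ {j} le → ≤-pred (≤-trans
          (≤-trans (≤-reflexive (sym length-is)) le) (at-most j))) enough))
    in (c , i) ∷ out , All.map (λ (_ , c∈) → All.lookup c< c∈) accs ∷ inc ,
       (acc , here refl) ∷ All.map (λ (a , c∈) → a , there c∈) accs , ↭.trans (↭.prep i perm′) (↭.↭-sym perm)
    where
    perm : is ↭ i ∷ as ++ bs
    perm = ↭.trans (↭.↭-reflexive eq) (↭ₚ.shift i as bs)
    length-is : length is ≡ suc (length (as ++ bs))
    length-is = ↭ₚ.↭-length perm
    rest⊆ : as ++ bs ⊆ is
    rest⊆ z∈ = ↭ₚ.∈-resp-↭ (↭.↭-sym perm) (there z∈)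
    at-most : ∀ j → available j (c ∷ cs) ≤ suc (available j cs)
    at-most j with does (accepts j c Boolₚ.≟ true)
    ... | true  = ≤-refl
    ... | false = n≤1+n _

-- A vertex has a part in `W`, a copy number and a table, which ranges over a constant set, and `M`
-- variables given by `M * 2` positions. So the order is polynomial in the number of positions.
module Incidence (k q : ℕ)
  {D : Set} (_≟ᴰ_ : DecidableEquality D) (allD : List D) (allD-complete : ∀ d → d ∈ allD) (d₀ : D)
  (M : ℕ) (rel : D → D → BExp 4) where

  P : ℕ
  P = k + k

  Cols : List (Vec D M)
  Cols = allVec allD M

  Cols-complete : ∀ s → s ∈ Cols
  Cols-complete = allVec-complete allD-complete

  Table : Set
  Table = Vec (Fin q) (length Cols)

  apply : Table → Vec D M → Fin q
  apply z s = lookup z (Any.index (Cols-complete s))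

  table : (Vec D M → Fin q) → Table
  table f = Vec.tabulate (f ∘ List.lookup Cols)

  apply-table : ∀ f s → apply (table f) s ≡ f s
  apply-table f s = trans (Vecₚ.lookup∘tabulate _ (Any.index (Cols-complete s))) (cong f (sym (Anyₚ.lookup-index (Cols-complete s))))

  W : Set
  W = Fin P × Table

  _≟ᵂ_ : DecidableEquality W
  _≟ᵂ_ = ×ₚ.≡-dec Finₚ._≟_ (Vecₚ.≡-dec Finₚ._≟_)

  allW : List W
  allW = List.cartesianProduct (allFin P) (allVec (allFin q) (length Cols))

  allW-complete : ∀ w → w ∈ allW
  allW-complete (p , z) = ∈ₚ.∈-cartesianProduct⁺ (∈ₚ.∈-allFin p) (allVec-complete ∈ₚ.∈-allFin z)

  allW-unique : Unique allW
  allW-unique = Uniqueₚ.cartesianProduct⁺ (Uniqueₚ.allFin⁺ P) (allVec-unique (Uniqueₚ.allFin⁺ q) _)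

  Shape : Set
  Shape = Vec W k

  -- Increasing copy numbers make the members of an edge distinct and order them canonically, so
  -- that no edge is generated twice.
  IncreasingShape : Shape → Set
  IncreasingShape sh = AllPairs (λ v w → toℕ (proj₁ v) < toℕ (proj₁ w)) (List.tabulate (lookup sh))

  increasing? : ∀ sh → Dec (IncreasingShape sh)
  increasing? sh = AllPairs.allPairs? (λ v w → toℕ (proj₁ v) <? toℕ (proj₁ w)) (List.tabulate (lookup sh))

  shapes : List Shape
  shapes = filter increasing? (allVec allW k)

  var : Fin k × Fin M → Fin 2 → Fin (k * (M * 2))
  var (j , a) c = combine j (combine a c)

  four : Fin k × Fin M → Fin k × Fin M → Fin 4 → Fin (k * (M * 2))
  four x y zero                   = var x zero
  four x y (suc zero)             = var x (suc zero)
  four x y (suc (suc zero))       = var y zero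
  four x y (suc (suc (suc zero))) = var y (suc zero)

  places : List (Fin k × Fin M)
  places = List.cartesianProduct (allFin k) (allFin M)

  place-pairs : List ((Fin k × Fin M) × (Fin k × Fin M))
  place-pairs = List.cartesianProduct places places

  place-pairs-complete : ∀ x y → (x , y) ∈ place-pairs
  place-pairs-complete (j , a) (j′ , a′) = ∈ₚ.∈-cartesianProduct⁺
    (∈ₚ.∈-cartesianProduct⁺ (∈ₚ.∈-allFin j) (∈ₚ.∈-allFin a)) (∈ₚ.∈-cartesianProduct⁺ (∈ₚ.∈-allFin j′) (∈ₚ.∈-allFin a′))

  at : Vec (Vec D M) k → Fin k × Fin M → D
  at s (j , a) = lookup (lookup s j) a

  pairᵉ : Vec (Vec D M) k → (Fin k × Fin M) × (Fin k × Fin M) → BExp (k * (M * 2))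
  pairᵉ s (x , y) = rename (four x y) (rel (at s x) (at s y))

  validᵉ : Vec (Vec D M) k → BExp (k * (M * 2))
  validᵉ s = ⋀ (map (pairᵉ s) place-pairs)

  Sees : Shape → Vec (Vec D M) k → Set
  Sees sh s = ∀ a → ∃[ j ] apply (proj₂ (lookup sh j)) (lookup s j) ≡ a

  sees? : ∀ sh s → Dec (Sees sh s)
  sees? sh s = Finₚ.all? (λ a → Finₚ.any? (λ j → apply (proj₂ (lookup sh j)) (lookup s j) Finₚ.≟ a))

  -- Whether all colours are seen is decided by `sh` and `s`, hence when the program is written;
  -- only validity has to be tested on positions.
  clauseᵉ : Shape → Vec (Vec D M) k → BExp (k * (M * 2))
  clauseᵉ sh s = validᵉ s ⇒ᵉ constᵉ (does (sees? sh s))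

  clausesᵉ : Shape → BExp (k * (M * 2))
  clausesᵉ sh = ⋀ (map (clauseᵉ sh) (allVec Cols k))

  rainbowᵉ : Shape → BExp (k * (M * 2) + 0)
  rainbowᵉ sh = rename (Fin._↑ˡ 0) (clausesᵉ sh)

  equalᵉ : Fin k → Fin (M * 2) → BExp (M * 2 + (k * (M * 2) + 0))
  equalᵉ j i = eqᵉ (i Fin.↑ˡ _) (M * 2 Fin.↑ʳ (combine j i Fin.↑ˡ 0))

  memberᵉ : Shape → W → Fin k → BExp (M * 2 + (k * (M * 2) + 0))
  memberᵉ sh w j = constᵉ (does (w ≟ᵂ lookup sh j)) ∧ᵉ ⋀ (map (equalᵉ j) (allFin (M * 2)))

  bitᵉ : Shape → W → BExp (M * 2 + (k * (M * 2) + 0))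
  bitᵉ sh w = ⋁ (map (memberᵉ sh w) (allFin k))

  row : Shape → Emitter (k * (M * 2) + 0)
  row sh = each allW (λ w → forⁿ (M * 2) (ifᵉ (bitᵉ sh w) (emit true) (emit false)))

  edge-emitter : Shape → Emitter (k * (M * 2) + 0)
  edge-emitter sh = ifᵉ (rainbowᵉ sh) (emit true ⨾ row sh) skip

  program : Emitter 0
  program = each allW (λ _ → forⁿ (M * 2) (emit true)) ⨾ emit false ⨾
            each shapes (λ sh → forⁿ (k * (M * 2)) (edge-emitter sh)) ⨾ emit false

  module On {N : ℕ} (lbl : Fin N → Label) where

    open Semantics lbl

    X : Set
    X = Fin N × Fin N

    _≟ˣ_ : DecidableEquality X
    _≟ˣ_ = ×ₚ.≡-dec Finₚ._≟_ Finₚ._≟_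

    R : X → X → D → D → Bool
    R (x₁ , x₂) (y₁ , y₂) a b = eval (rel a b) (x₁ ∷ x₂ ∷ y₁ ∷ y₂ ∷ [])

    Solution : (X → D) → Set
    Solution g = ∀ x y → R x y (g x) (g y) ≡ true

    U : Set
    U = Vec (Fin N) (M * 2)

    Env : Set
    Env = Vec (Fin N) (k * (M * 2))

    Vertex : Set
    Vertex = W × U

    _≟ⱽ_ : DecidableEquality Vertex
    _≟ⱽ_ = ×ₚ.≡-dec _≟ᵂ_ (Vecₚ.≡-dec Finₚ._≟_)

    open import Data.List.Membership.DecPropositional _≟ⱽ_ using (_∈?_) public

    vertices : List Vertex
    vertices = List.cartesianProduct allW (allVec (allFin N) (M * 2))

    vertices-complete : ∀ v → v ∈ vertices
    vertices-complete (w , u) = ∈ₚ.∈-cartesianProduct⁺ (allW-complete w) (allVec-complete ∈ₚ.∈-allFin u)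

    vertices-unique : Unique vertices
    vertices-unique = Uniqueₚ.cartesianProduct⁺ allW-unique (allVec-unique (Uniqueₚ.allFin⁺ N) _)

    n : ℕ
    n = length vertices

    chunk : Fin k → Env → U
    chunk j ρ = Vec.tabulate (λ i → lookup ρ (combine j i))

    member : Shape → Env → Fin k → Vertex
    member sh ρ j = lookup sh j , chunk j ρ

    members : Shape × Env → List Vertex
    members (sh , ρ) = List.tabulate (member sh ρ)

    subset : Shape × Env → Subset n
    subset e = Vec.map (λ v → does (v ∈? members e)) (Vec.fromList vertices)

    codes : List (Shape × Env)
    codes = List.cartesianProduct shapes (allVec (allFin N) (k * (M * 2)))

    Rainbowᶜ : Shape × Env → Set
    Rainbowᶜ (sh , ρ) = eval (rainbowᵉ sh) (ρ Vec.++ []) ≡ true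

    rainbow? : ∀ e → Dec (Rainbowᶜ e)
    rainbow? (sh , ρ) = eval (rainbowᵉ sh) (ρ Vec.++ []) Boolₚ.≟ true

    edgeCodes : List (Shape × Env)
    edgeCodes = filter rainbow? codes

    edge-increasing : ∀ {e} → e ∈ edgeCodes → IncreasingShape (proj₁ e)
    edge-increasing e∈ = proj₂ (∈ₚ.∈-filter⁻ increasing? {xs = allVec allW k} (proj₁ (∈ₚ.∈-cartesianProduct⁻ shapes (allVec
          (allFin N) (k * (M * 2))) (proj₁ (∈ₚ.∈-filter⁻ rainbow? {xs = codes} e∈)))))

    members-increasing : ∀ e → IncreasingShape (proj₁ e) → Increasing (toℕ ∘ proj₁ ∘ proj₁) (members e)
    members-increasing (sh , ρ) inc = AllPairsₚ.map⁻ (subst (AllPairs (λ v w → toℕ (proj₁ v) < toℕ (proj₁ w))) (sym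
          (Listₚ.map-tabulate (member sh ρ) proj₁)) inc)

    members-unique : ∀ e → IncreasingShape (proj₁ e) → Unique (members e)
    members-unique e inc = AllPairs.map (λ { lt refl → <-irrefl refl lt }) (members-increasing e inc)

    lookup-subset : ∀ e v → lookup (subset e) v ≡ does (List.lookup vertices v ∈? members e)
    lookup-subset e v = trans (Vecₚ.lookup-map v _ (Vec.fromList vertices)) (cong (λ w → does (w ∈? members e))
          (lookup-fromList vertices v))
      where
      lookup-fromList : ∀ {A : Set} (xs : List A) i → lookup (Vec.fromList xs) i ≡ List.lookup xs i
      lookup-fromList (x ∷ xs) zero    = refl
      lookup-fromList (x ∷ xs) (suc i) = lookup-fromList xs i

    index : Vertex → Fin n
    index v = Any.index (vertices-complete v)

    lookup-index : ∀ v → List.lookup vertices (index v) ≡ v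
    lookup-index v = sym (Anyₚ.lookup-index (vertices-complete v))

    -- Both member lists are sorted by copy number and have the same elements, so they agree entry
    -- by entry; the entries give back the shape and the environment.
    subset-injective : ∀ {e e′} → e ∈ edgeCodes → e′ ∈ edgeCodes → subset e ≡ subset e′ → e ≡ e′
    subset-injective {e@(sh , ρ)} {e′@(sh′ , ρ′)} e∈ e′∈ eq = cong₂ _,_
      (vec-ext (λ j → cong proj₁ (same j)))
      (vec-ext (λ i → subst (λ i → lookup ρ i ≡ lookup ρ′ i) (Finₚ.combine-remQuot {k} (M * 2) i)
        (trans (sym (Vecₚ.lookup∘tabulate _ (proj₂ (remQuot {k} (M * 2) i))))
          (trans (cong (λ v → lookup (proj₂ v) (proj₂ (remQuot {k} (M * 2) i))) (same (proj₁ (remQuot {k} (M * 2) i))))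
            (Vecₚ.lookup∘tabulate _ (proj₂ (remQuot {k} (M * 2) i)))))))
      where
      tabulate-injective : ∀ {A : Set} {n} {f g : Fin n → A} → List.tabulate f ≡ List.tabulate g → ∀ i → f i ≡ g i
      tabulate-injective eq zero    = Listₚ.∷-injectiveˡ eq
      tabulate-injective eq (suc i) = tabulate-injective (Listₚ.∷-injectiveʳ eq) i

      transfer : ∀ e e′ → subset e ≡ subset e′ → members e ⊆ members e′
      transfer e e′ eq {v} v∈ = does-true {P? = v ∈? members e′} (trans (sym (trans (lookup-subset e′ (index v)) (cong
            (λ w → does (w ∈? members e′)) (lookup-index v))))
        (trans (cong (λ s → lookup s (index v)) (sym eq)) (trans (lookup-subset e (index v))
          (trans (cong (λ w → does (w ∈? members e)) (lookup-index v)) (dec-true (v ∈? members e) v∈)))))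

      same : ∀ j → member sh ρ j ≡ member sh′ ρ′ j
      same = tabulate-injective (increasing-unique (toℕ ∘ proj₁ ∘ proj₁) (members-increasing e (edge-increasing e∈))
            (members-increasing e′ (edge-increasing e′∈))
        (transfer e e′ eq) (transfer e′ e (sym eq)))

    codes-unique : Unique codes
    codes-unique = Uniqueₚ.cartesianProduct⁺ (Uniqueₚ.filter⁺ increasing? (allVec-unique allW-unique k)) (allVec-unique
          (Uniqueₚ.allFin⁺ N) _)

    hypergraph : Hypergraph k
    hypergraph = record
      { order    = n
      ; edges    = map subset edgeCodes
      ; uniform  = Allₚ.map⁺ (All.tabulate (λ {e} e∈ → trans
          (card-members _≟ⱽ_ (members e) vertices vertices-unique (members-unique e (edge-increasing e∈)) (λ {v} _ → vertices-complete v))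
          (Listₚ.length-tabulate (member (proj₁ e) (proj₂ e)))))
      ; distinct = map-unique subset subset-injective (Uniqueₚ.filter⁺ rainbow? codes-unique)
      }

    eval-bit : ∀ sh w u ρ → eval (bitᵉ sh w) (u Vec.++ (ρ Vec.++ [])) ≡ does ((w , u) ∈? members (sh , ρ))
    eval-bit sh w u ρ = ≡-⇔ to from
      where
      inner : ∀ i → lookup (u Vec.++ (ρ Vec.++ [])) (i Fin.↑ˡ _) ≡ lookup u i
      inner i = Vecₚ.lookup-++ˡ u (ρ Vec.++ []) i
      outer : ∀ j i → lookup (u Vec.++ (ρ Vec.++ [])) (M * 2 Fin.↑ʳ (combine j i Fin.↑ˡ 0)) ≡ lookup ρ (combine j i)
      outer j i = trans (Vecₚ.lookup-++ʳ u (ρ Vec.++ []) (combine j i Fin.↑ˡ 0)) (Vecₚ.lookup-++ˡ ρ [] (combine j i))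

      to : eval (bitᵉ sh w) (u Vec.++ (ρ Vec.++ [])) ≡ true → does ((w , u) ∈? members (sh , ρ)) ≡ true
      to eq = let (j , _ , eq′) = ⋁-elim (memberᵉ sh w) (allFin k) eq ; (w≡ , u≡) = ∧-true eq′ in
        dec-true ((w , u) ∈? members (sh , ρ)) (subst (_∈ members (sh , ρ)) (sym (cong₂ _,_ (does-true {P? = w ≟ᵂ lookup sh j} w≡)
          (trans (sym (Vecₚ.tabulate∘lookup u)) (Vecₚ.tabulate-cong (λ i → trans (sym (inner i))
            (trans (does-true {P? = _ Finₚ.≟ _} (⋀-elim (equalᵉ j) (allFin (M * 2)) u≡ (∈ₚ.∈-allFin i))) (outer j i)))))))
          (∈ₚ.∈-tabulate⁺ {f = member sh ρ} j))

      from : does ((w , u) ∈? members (sh , ρ)) ≡ true → eval (bitᵉ sh w) (u Vec.++ (ρ Vec.++ [])) ≡ true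
      from eq = let (j , eq′) = ∈ₚ.∈-tabulate⁻ {f = member sh ρ} (does-true {P? = (w , u) ∈? members (sh , ρ)} eq) in
        ⋁-intro (memberᵉ sh w) (allFin k) (∈ₚ.∈-allFin j) (cong₂ _∧_ (dec-true (w ≟ᵂ lookup sh j) (cong proj₁ eq′))
          (⋀-intro (equalᵉ j) (allFin (M * 2)) (λ i _ → dec-true (_ Finₚ.≟ _) (trans (inner i) (trans (cong (λ v → lookup (proj₂ v) i) eq′)
            (trans (Vecₚ.lookup∘tabulate (λ i → lookup ρ (combine j i)) i) (sym (outer j i))))))))

    ⟦row⟧ : ∀ sh ρ → ⟦ row sh ⟧ (ρ Vec.++ []) ≡ Vec.toList (subset (sh , ρ))
    ⟦row⟧ sh ρ = begin
      ⟦ row sh ⟧ (ρ Vec.++ [])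
        ≡⟨ ⟦each⟧ allW _ (ρ Vec.++ []) ⟩
      concatMap (λ w → ⟦ forⁿ (M * 2) (ifᵉ (bitᵉ sh w) (emit true) (emit false)) ⟧ (ρ Vec.++ [])) allW
        ≡⟨ Listₚ.concatMap-cong (λ w → trans (⟦forⁿ⟧ (M * 2) _ (ρ Vec.++ [])) (Listₚ.concatMap-cong (λ u → entry w u) (allVec
              (allFin N) (M * 2)))) allW ⟩
      concatMap (λ w → concatMap (λ u → [ does ((w , u) ∈? members (sh , ρ)) ]) (allVec (allFin N) (M * 2))) allW
        ≡⟨ concatMap-product (λ v → [ does (v ∈? members (sh , ρ)) ]) allW (allVec (allFin N) (M * 2)) ⟨
      concatMap (λ v → [ does (v ∈? members (sh , ρ)) ]) vertices
        ≡⟨ singles vertices ⟩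
      Vec.toList (subset (sh , ρ)) ∎
      where
      open ≡-Reasoning
      if-emit : ∀ b → (if b then [ true ] else [ false ]) ≡ [ b ]
      if-emit true  = refl
      if-emit false = refl
      entry : ∀ w u → ⟦ ifᵉ (bitᵉ sh w) (emit true) (emit false) ⟧ (u Vec.++ (ρ Vec.++ [])) ≡ [ does ((w , u) ∈? members (sh , ρ)) ]
      entry w u = trans (if-emit (eval (bitᵉ sh w) (u Vec.++ (ρ Vec.++ [])))) (cong [_] (eval-bit sh w u ρ))
      singles : ∀ {A : Set} {f : A → Bool} xs → concatMap (λ x → [ f x ]) xs ≡ Vec.toList (Vec.map f (Vec.fromList xs))
      singles []       = refl
      singles (x ∷ xs) = cong (_ ∷_) (singles xs)

    ⟦program⟧ : ⟦ program ⟧ [] ≡ encodeHypergraph hypergraph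
    ⟦program⟧ = cong₂ _++_ order-part (cong (false ∷_) (trans (cong (_++ [ false ]) edge-part) (encode-filter codes)))
      where
      open ≡-Reasoning
      order-part : ⟦ each allW (λ _ → forⁿ (M * 2) (emit true)) ⟧ [] ≡ List.replicate n true
      order-part = begin
        ⟦ each allW (λ _ → forⁿ (M * 2) (emit true)) ⟧ []                           ≡⟨ ⟦each⟧ allW _ [] ⟩
        concatMap (λ _ → ⟦ forⁿ (M * 2) (emit true) ⟧ []) allW                      ≡⟨ Listₚ.concatMap-cong (λ _ → ⟦forⁿ⟧
              (M * 2) (emit true) []) allW ⟩
        concatMap (λ _ → concatMap (λ _ → [ true ]) (allVec (allFin N) (M * 2))) allW ≡⟨ concatMap-product (λ _ → [ true ]) allW _ ⟨
        concatMap (λ _ → [ true ]) vertices                                          ≡⟨ trues vertices ⟩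
        List.replicate n true                                                        ∎
        where
        trues : ∀ {A : Set} (xs : List A) → concatMap (λ _ → [ true ]) xs ≡ List.replicate (length xs) true
        trues []       = refl
        trues (x ∷ xs) = cong (true ∷_) (trues xs)

      code-output : Shape × Env → List Bool
      code-output (sh , ρ) = ⟦ edge-emitter sh ⟧ (ρ Vec.++ [])

      edge-part : ⟦ each shapes (λ sh → forⁿ (k * (M * 2)) (edge-emitter sh)) ⟧ [] ≡ concatMap code-output codes
      edge-part = trans (⟦each⟧ shapes _ []) (trans (Listₚ.concatMap-cong (λ sh → ⟦forⁿ⟧ (k * (M * 2)) (edge-emitter sh) []) shapes)
        (sym (concatMap-product code-output shapes _)))

      encode-filter : ∀ es → concatMap code-output es ++ [ false ] ≡ encodeEdges (map subset (filter rainbow? es))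
      encode-filter []              = refl
      encode-filter ((sh , ρ) ∷ es) with eval (rainbowᵉ sh) (ρ Vec.++ [])
      ... | false = encode-filter es
      ... | true  = cong (true ∷_) (trans (cong (_++ [ false ]) (cong (_++ concatMap code-output es) (⟦row⟧ sh ρ)))
        (trans (Listₚ.++-assoc (Vec.toList (subset (sh , ρ))) _ _) (cong (Vec.toList (subset (sh , ρ)) ++_) (encode-filter es))))

    place : U → Fin M → X
    place u a = lookup u (combine a zero) , lookup u (combine a (suc zero))

    ValidAt : Env → Vec (Vec D M) k → Set
    ValidAt ρ s = ∀ x y → R (place (chunk (proj₁ x) ρ) (proj₂ x)) (place (chunk (proj₁ y) ρ) (proj₂ y)) (at s x) (at s y) ≡ true

    eval-pair : ∀ ρ s x y → eval (pairᵉ s (x , y)) ρ ≡ R (place (chunk (proj₁ x) ρ) (proj₂ x)) (place (chunk (proj₁ y) ρ)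
          (proj₂ y)) (at s x) (at s y)
    eval-pair ρ s (j , a) (j′ , a′) = eval-rename (four (j , a) (j′ , a′)) (rel (at s (j , a)) (at s (j′ , a′))) λ
      { zero                   → sym (Vecₚ.lookup∘tabulate _ (combine a zero))
      ; (suc zero)             → sym (Vecₚ.lookup∘tabulate _ (combine a (suc zero)))
      ; (suc (suc zero))       → sym (Vecₚ.lookup∘tabulate _ (combine a′ zero))
      ; (suc (suc (suc zero))) → sym (Vecₚ.lookup∘tabulate _ (combine a′ (suc zero))) }

    eval-rainbow : ∀ sh ρ → eval (rainbowᵉ sh) (ρ Vec.++ []) ≡ eval (clausesᵉ sh) ρ
    eval-rainbow sh ρ = eval-rename (Fin._↑ˡ 0) (clausesᵉ sh) {ρ Vec.++ []} {ρ} (Vecₚ.lookup-++ˡ ρ [])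

    rainbow-elim : ∀ sh ρ → Rainbowᶜ (sh , ρ) → ∀ s → ValidAt ρ s → Sees sh s
    rainbow-elim sh ρ eq s valid = does-true {P? = sees? sh s} (⇒ᵉ-elim (validᵉ s) (constᵉ (does (sees? sh s)))
      (⋀-elim (clauseᵉ sh) (allVec Cols k) (trans (sym (eval-rainbow sh ρ)) eq) (allVec-complete Cols-complete s))
      (⋀-intro (pairᵉ s) place-pairs (λ (x , y) _ → trans (eval-pair ρ s x y) (valid x y))))

    rainbow-intro : ∀ sh ρ → (∀ s → ValidAt ρ s → Sees sh s) → Rainbowᶜ (sh , ρ)
    rainbow-intro sh ρ sees = trans (eval-rainbow sh ρ)
      (⋀-intro (clauseᵉ sh) (allVec Cols k) (λ s _ → ⇒ᵉ-intro (validᵉ s) (constᵉ (does (sees? sh s))) (λ valid →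
        dec-true (sees? sh s) (sees s (λ x y → trans (sym (eval-pair ρ s x y)) (⋀-elim (pairᵉ s) place-pairs valid
              (place-pairs-complete x y)))))))

    solution⇒rainbow : ∀ g → Solution g → RainbowColorable hypergraph q
    solution⇒rainbow g sol = colour , λ e e∈ a → let (c , c∈ , e≡) = ∈ₚ.∈-map⁻ subset e∈ in found e c c∈ e≡ a
      where
      read : U → Vec D M
      read u = Vec.tabulate (λ a → g (place u a))

      colourⱽ : Vertex → Fin q
      colourⱽ ((_ , z) , u) = apply z (read u)

      colour : Fin n → Fin q
      colour v = colourⱽ (List.lookup vertices v)

      found : ∀ e c → c ∈ edgeCodes → e ≡ subset c → ∀ a → ∃[ v ] v ∈ˢ e × colour v ≡ a
      found e (sh , ρ) c∈ refl a =
        let s = Vec.tabulate (λ j → read (chunk j ρ))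
            at-s : ∀ x → at s x ≡ g (place (chunk (proj₁ x) ρ) (proj₂ x))
            at-s = λ x → trans (cong (λ v → lookup v (proj₂ x)) (Vecₚ.lookup∘tabulate (λ j → read (chunk j ρ)) (proj₁ x)))
                  (Vecₚ.lookup∘tabulate _ (proj₂ x))
            (j , eq) = rainbow-elim sh ρ (proj₂ (∈ₚ.∈-filter⁻ rainbow? {xs = codes} c∈)) s (λ x y → trans (cong₂ (R _ _)
                  (at-s x) (at-s y)) (sol _ _)) a
            v = member sh ρ j
        in index v ,
           Vecₚ.lookup⇒[]= (index v) (subset (sh , ρ)) (trans (lookup-subset (sh , ρ) (index v)) (trans (cong (λ w → does
                 (w ∈? members (sh , ρ))) (lookup-index v))
             (dec-true (v ∈? members (sh , ρ)) (∈ₚ.∈-tabulate⁺ {f = member sh ρ} j)))) ,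
           trans (cong colourⱽ (lookup-index v)) (trans (cong (apply (proj₂ (lookup sh j))) (sym (Vecₚ.lookup∘tabulate
                 (λ j → read (chunk j ρ)) j))) eq)

-- A proper 2-colouring, read on pairs of a small set of variables and a point
-- depending on these only: each pair is represented by 2k copies, and gets the
-- colour of at least k of them.
module ProperColouring (k q : ℕ)
  {D : Set} (_≟ᴰ_ : DecidableEquality D) (allD : List D) (allD-complete : ∀ d → d ∈ allD) (d₀ : D)
  (M : ℕ) (rel : D → D → BExp 4) {N : ℕ} (lbl : Fin N → Label) (x₀ : Fin N × Fin N)
  (functional : ∀ x a b → Incidence.On.R k q _≟ᴰ_ allD allD-complete d₀ M rel lbl x x a b ≡ true → a ≡ b)
  (χ : Fin (Incidence.On.n k q _≟ᴰ_ allD allD-complete d₀ M rel lbl) → Fin 2)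
  (proper : IsProperColoring (Incidence.On.hypergraph k q _≟ᴰ_ allD allD-complete d₀ M rel lbl) χ) where

  open Incidence k q _≟ᴰ_ allD allD-complete d₀ M rel
  open On lbl

  Point : Set
  Point = (X → D) → Fin q

  -- If a variable repeats in `w`, one of its places is taken; for a valid `s` the choice is
  -- immaterial by `functional`.
  extendᵛ : ∀ {n} → Vec X n → Vec D n → X → D
  extendᵛ w s y with Finₚ.any? (λ a → lookup w a ≟ˣ y)
  ... | yes (a , _) = lookup s a
  ... | no  _       = d₀

  padded : List X → Vec X M
  padded = toVec x₀ M

  coordinate : X → Fin 2 → Fin N
  coordinate x zero    = proj₁ x
  coordinate x (suc _) = proj₂ x

  flat : Vec X M → U
  flat w = Vec.tabulate (λ i → coordinate (lookup w (proj₁ (remQuot {M} 2 i))) (proj₂ (remQuot {M} 2 i)))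

  lookup-flat : ∀ w a c → lookup (flat w) (combine a c) ≡ coordinate (lookup w a) c
  lookup-flat w a c = trans (Vecₚ.lookup∘tabulate _ (combine a c))
    (cong (λ r → coordinate (lookup w (proj₁ r)) (proj₂ r)) (Finₚ.remQuot-combine {M} {2} a c))

  place-flat : ∀ w a → place (flat w) a ≡ lookup w a
  place-flat w a = cong₂ _,_ (lookup-flat w a zero) (lookup-flat w a (suc zero))

  tableOf : List X → Point → Table
  tableOf v x = table (λ s → x (extendᵛ (padded v) s))

  vertex : Fin P → List X × Point → Vertex
  vertex p (v , x) = (p , tableOf v x) , flat (padded v)

  shade : Fin 2 → Bool
  shade zero    = true
  shade (suc _) = false

  unshade : Bool → Fin 2
  unshade true  = zero
  unshade false = suc zero

  unshade-shade : ∀ a → unshade (shade a) ≡ a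
  unshade-shade zero       = refl
  unshade-shade (suc zero) = refl

  colourⱽ : Vertex → Bool
  colourⱽ v = shade (χ (index v))

  accepts : Bool → List X × Point → Fin P → Bool
  accepts c vx p = does (colourⱽ (vertex p vx) Boolₚ.≟ c)

  votes : Bool → List X × Point → ℕ
  votes c vx = length (filter (λ p → accepts c vx p Boolₚ.≟ true) (allFin P))

  color : List X → Point → Bool
  color v x = does (k ≤? votes true (v , x))

  votes-total : ∀ vx → votes true vx + votes false vx ≡ P
  votes-total vx = trans (total (allFin P)) (Listₚ.length-tabulate {n = P} id)
    where
    total : ∀ ps → length (filter (λ p → accepts true vx p Boolₚ.≟ true) ps) + length (filter
          (λ p → accepts false vx p Boolₚ.≟ true) ps) ≡ length ps
    total []       = refl
    total (p ∷ ps) with colourⱽ (vertex p vx)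
    ... | true  = cong suc (total ps)
    ... | false = trans (+-suc _ _) (cong suc (total ps))

  majority : ∀ {v x} c → color v x ≡ c → k ≤ votes c (v , x)
  majority {v} {x} true  eq = does-true {P? = k ≤? votes true (v , x)} eq
  majority {v} {x} false eq = +-cancelˡ-≤ k _ _ (≤-trans (≤-reflexive (sym (votes-total (v , x))))
    (+-monoˡ-≤ (votes false (v , x)) (<⇒≤ (≰⇒> (does-false {P? = k ≤? votes true (v , x)} eq)))))

  color-cong : ∀ v {x x′} → (∀ g → x g ≡ x′ g) → color v x ≡ color v x′
  color-cong v {x} {x′} eq = cong (λ z → does (k ≤? length (filter (λ p → does (shade (χ (index ((p , z) , flat
        (padded v)))) Boolₚ.≟ true) Boolₚ.≟ true) (allFin P))))
    (Vecₚ.tabulate-cong (λ i → eq (extendᵛ (padded v) (List.lookup Cols i))))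

  Valid : List X → (X → D) → Set
  Valid w g = ∀ x y → x ∈ w → y ∈ w → R x y (g x) (g y) ≡ true

  Local : List X → Point → Set
  Local v x = ∀ g g′ → (∀ y → y ∈ v → g y ≡ g′ y) → x g ≡ x g′

  -- Each pair has `k` copies of colour `c`, so copies with increasing numbers can be chosen for all
  -- of them. They form an edge: the values in a valid `s` are consistent by `functional`, hence
  -- come from one assignment `g`, at which all colours are shown.
  no-mono : ∀ (ps : List (List X × Point)) → length ps ≡ k →
    All (λ (v , x) → length v ≤ M × Local v x) ps →
    (∀ g → Valid (concatMap proj₁ ps) g → ∀ a → Any (λ (_ , x) → x g ≡ a) ps) →
    ∀ c → All (λ (v , x) → color v x ≡ c) ps → ⊥
  no-mono ps length-ps bounded rainbow c mono = refute (Arrange.arrange (λ p p′ → toℕ p < toℕ p′) (accepts c) (allFin P)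
      (AllPairsₚ.tabulate⁺-< (λ lt → lt)) ps (All.map (λ {(v , x)} eq → ≤-trans (≤-reflexive length-ps) (majority {v} {x} c eq)) mono))
    where
    refute : ∃[ out ] AllPairs (λ x y → toℕ (proj₁ x) < toℕ (proj₁ y)) out × All (λ
          (p , vx) → accepts c vx p ≡ true × p ∈ allFin P) out × map proj₂ out ↭ ps → ⊥
    refute (out , inc , acc , perm) = proper (subset (sh , ρ)) (∈ₚ.∈-map⁺ subset code∈) (unshade c , monochromatic)
      where
      length-out : length out ≡ k
      length-out = trans (sym (Listₚ.length-map proj₂ out)) (trans (↭ₚ.↭-length perm) length-ps)

      slot : Fin k → Fin P × (List X × Point)
      slot j = List.lookup out (Fin.cast (sym length-out) j)

      vs : Fin k → List X
      vs j = proj₁ (proj₂ (slot j))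

      xs : Fin k → Point
      xs j = proj₂ (proj₂ (slot j))

      xs∈ : ∀ j → (vs j , xs j) ∈ ps
      xs∈ j = ↭ₚ.∈-resp-↭ perm (∈ₚ.∈-map⁺ proj₂ (∈ₚ.∈-lookup (Fin.cast (sym length-out) j)))

      layer : Fin k → W
      layer j = proj₁ (slot j) , tableOf (vs j) (xs j)

      sh : Shape
      sh = Vec.tabulate layer

      cell : Fin (k * (M * 2)) → Fin N
      cell i = lookup (flat (padded (vs (proj₁ (remQuot {k} (M * 2) i))))) (proj₂ (remQuot {k} (M * 2) i))

      ρ : Env
      ρ = Vec.tabulate cell

      chunk-ρ : ∀ j → chunk j ρ ≡ flat (padded (vs j))
      chunk-ρ j = trans (Vecₚ.tabulate-cong (λ i → trans (Vecₚ.lookup∘tabulate cell (combine j i))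
        (cong (λ r → lookup (flat (padded (vs (proj₁ r)))) (proj₂ r)) (Finₚ.remQuot-combine {k} {M * 2} j i))))
              (Vecₚ.tabulate∘lookup (flat (padded (vs j))))

      member-≡ : ∀ j → member sh ρ j ≡ vertex (proj₁ (slot j)) (vs j , xs j)
      member-≡ j = cong₂ _,_ (Vecₚ.lookup∘tabulate layer j) (chunk-ρ j)

      member-colour : ∀ j → colourⱽ (member sh ρ j) ≡ c
      member-colour j = trans (cong colourⱽ (member-≡ j))
        (does-true {P? = colourⱽ (vertex (proj₁ (slot j)) (vs j , xs j)) Boolₚ.≟ c} (proj₁ (All.lookup acc (∈ₚ.∈-lookup
              (Fin.cast (sym length-out) j)))))

      monochromatic : ∀ v → v ∈ˢ subset (sh , ρ) → χ v ≡ unshade c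
      monochromatic v v∈ = let (j , eq) = ∈ₚ.∈-tabulate⁻ {f = member sh ρ} (does-true {P? = List.lookup vertices v ∈? members (sh , ρ)}
                                 (trans (sym (lookup-subset (sh , ρ) v)) (Vecₚ.[]=⇒lookup v∈)))
                               v≡ : index (member sh ρ j) ≡ v
                               v≡ = lookup-injective vertices-unique (trans (lookup-index (member sh ρ j)) (sym eq))
                           in trans (sym (unshade-shade (χ v))) (cong unshade (trans (cong (shade ∘ χ) (sym v≡)) (member-colour j)))
        where
        lookup-injective : ∀ {A : Set} {xs : List A} → Unique xs → ∀ {i j} → List.lookup xs i ≡ List.lookup xs j → i ≡ j
        lookup-injective (x∉ ∷ u) {zero}  {zero}  eq = refl
        lookup-injective (x∉ ∷ u) {zero}  {suc j} eq = ⊥-elim (All.lookup x∉ (∈ₚ.∈-lookup j) eq)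
        lookup-injective (x∉ ∷ u) {suc i} {zero}  eq = ⊥-elim (All.lookup x∉ (∈ₚ.∈-lookup i) (sym eq))
        lookup-injective (x∉ ∷ u) {suc i} {suc j} eq = cong suc (lookup-injective u eq)

      increasing : IncreasingShape sh
      increasing = subst (AllPairs (λ v w → toℕ (proj₁ v) < toℕ (proj₁ w))) (sym (Listₚ.tabulate-cong (Vecₚ.lookup∘tabulate layer)))
        (AllPairsₚ.tabulate⁺-< (λ {i} {j} i<j → AllPairs-lookup-< inc (Fin.cast (sym length-out) i) (Fin.cast (sym length-out) j)
          (subst₂ _<_ (sym (Finₚ.toℕ-cast (sym length-out) i)) (sym (Finₚ.toℕ-cast (sym length-out) j)) i<j)))
        where
        AllPairs-lookup-< : ∀ {A : Set} {R : A → A → Set} {xs} → AllPairs R xs → ∀ i j → toℕ i < toℕ j → R (List.lookup xs i)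
              (List.lookup xs j)
        AllPairs-lookup-< (r ∷ rs) zero    (suc j) _         = All.lookup r (∈ₚ.∈-lookup j)
        AllPairs-lookup-< (r ∷ rs) (suc i) (suc j) (s≤s i<j) = AllPairs-lookup-< rs i j i<j

      sees : ∀ s → ValidAt ρ s → Sees sh s
      sees s valid a =
        let (j , eq) = find-slot (rainbow g g-valid a)
        in j , trans (cong (λ w → apply (proj₂ w) (lookup s j)) (Vecₚ.lookup∘tabulate layer j))
          (trans (apply-table (λ s → xs j (extendᵛ (padded (vs j)) s)) (lookup s j)) (trans (local j) eq))
        where
        site : Fin k × Fin M → X
        site (j , a) = lookup (padded (vs j)) a

        valid′ : ∀ x y → R (site x) (site y) (at s x) (at s y) ≡ true
        valid′ x y = subst₂ (λ x′ y′ → R x′ y′ (at s x) (at s y) ≡ true) (site-≡ x) (site-≡ y) (valid x y)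
          where
          site-≡ : ∀ x → place (chunk (proj₁ x) ρ) (proj₂ x) ≡ site x
          site-≡ (j , a) = trans (cong (λ u → place u a) (chunk-ρ j)) (place-flat (padded (vs j)) a)

        consistent : ∀ x y → site x ≡ site y → at s x ≡ at s y
        consistent x y eq = functional (site x) (at s x) (at s y) (subst (λ z → R (site x) z (at s x) (at s y) ≡ true)
              (sym eq) (valid′ x y))

        g : X → D
        g y with Finₚ.any? (λ j → Finₚ.any? (λ a → site (j , a) ≟ˣ y))
        ... | yes (j , a , _) = at s (j , a)
        ... | no  _           = d₀

        g-site : ∀ x → g (site x) ≡ at s x
        g-site x with Finₚ.any? (λ j → Finₚ.any? (λ a → site (j , a) ≟ˣ site x))
        ... | yes (j , a , eq) = consistent (j , a) x eq
        ... | no  none         = ⊥-elim (none (proj₁ x , proj₂ x , refl))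

        slot-of : ∀ {vx} → vx ∈ ps → ∃[ j ] proj₂ (slot j) ≡ vx
        slot-of vx∈ = let (o , o∈ , eq) = ∈ₚ.∈-map⁻ proj₂ (↭ₚ.∈-resp-↭ (↭.↭-sym perm) vx∈)
          in Fin.cast length-out (Any.index o∈) , trans (cong (proj₂ ∘ List.lookup out) (trans (Finₚ.cast-trans length-out
                (sym length-out) (Any.index o∈)) (Finₚ.cast-is-id _ (Any.index o∈))))
             (trans (cong proj₂ (sym (Anyₚ.lookup-index o∈))) (sym eq))

        site-of : ∀ {y} → y ∈ concatMap proj₁ ps → ∃[ x ] site x ≡ y
        site-of {y} y∈ =
          let (v , y∈v , v∈) = ∈ₚ.∈-concat⁻′ (map proj₁ ps) y∈
              (vx , vx∈ , v≡) = ∈ₚ.∈-map⁻ proj₁ v∈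
              (j , eq) = slot-of vx∈
              v≡j = trans v≡ (cong proj₁ (sym eq))
              (a , eq′) = toVec-∈ M (vs j) (proj₁ (All.lookup bounded (xs∈ j))) (subst (y ∈_) v≡j y∈v)
          in (j , a) , eq′

        g-valid : Valid (concatMap proj₁ ps) g
        g-valid y z y∈ z∈ with site-of y∈ | site-of z∈
        ... | x , refl | x′ , refl = trans (cong₂ (R (site x) (site x′)) (g-site x) (g-site x′)) (valid′ x x′)

        find-slot : ∀ {a} → Any (λ (_ , x) → x g ≡ a) ps → ∃[ j ] xs j g ≡ a
        find-slot found = let (vx , vx∈ , eq) = find found ; (j , eq′) = slot-of vx∈ in j , trans (cong (λ vx → proj₂ vx g) eq′) eq

        local : ∀ j → xs j (extendᵛ (padded (vs j)) (lookup s j)) ≡ xs j g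
        local j = proj₂ (All.lookup bounded (xs∈ j)) _ _ λ y y∈ →
          let (a , eq) = toVec-∈ M (vs j) (proj₁ (All.lookup bounded (xs∈ j))) y∈ in
          subst (λ y → extendᵛ (padded (vs j)) (lookup s j) y ≡ g y) eq (trans (extend-site j a) (sym (g-site (j , a))))
          where
          extend-site : ∀ j a → extendᵛ (padded (vs j)) (lookup s j) (site (j , a)) ≡ at s (j , a)
          extend-site j a with Finₚ.any? (λ a′ → lookup (padded (vs j)) a′ ≟ˣ site (j , a))
          ... | yes (a′ , eq) = consistent (j , a′) (j , a) eq
          ... | no  none      = ⊥-elim (none (a , refl))

      code∈ : (sh , ρ) ∈ edgeCodes
      code∈ = ∈ₚ.∈-filter⁺ rainbow? (∈ₚ.∈-cartesianProduct⁺ (∈ₚ.∈-filter⁺ increasing? (allVec-complete allW-complete sh) increasing)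
        (allVec-complete ∈ₚ.∈-allFin ρ)) (rainbow-intro sh ρ sees)


-- Unsolvable systems give hypergraphs that are not 2-colourable

module Hardness (t′ d″ : ℕ)
  {D : Set} (_≟ᴰ_ : DecidableEquality D) (allD : List D) (allD-complete : ∀ d → d ∈ allD) (d₀ : D)
  (rel : D → D → BExp 4) where

  open Numbers t′ d″

  type-count κ ℓ : ℕ
  type-count = length (List.cartesianProduct (true ∷ false ∷ []) (allVec (allVec (allFin q) d) t))
  κ = t * h
  ℓ = suc (type-count * (suc q * t))

  -- The value of `m` is far too large to be evaluated; the only fact about it that enters is
  -- `req≤m`.
  abstract
    m : ℕ
    m = Constants.req (length allD) κ (ℓ * κ) (Constants.τ (length allD) κ (ℓ * κ))

    req≤m : Constants.req (length allD) κ (ℓ * κ) (Constants.τ (length allD) κ (ℓ * κ)) ≤ m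
    req≤m = ≤-refl

  -- Room for the scope of the point that sees all `suc q` blocks, each of `t` sets with at most `m`
  -- variables.
  M : ℕ
  M = suc q * (t * m)

  open Incidence k q _≟ᴰ_ allD allD-complete d₀ M rel public

  module _ {N : ℕ} (lbl : Fin N → Label) (x₀ : Fin N × Fin N)
    (functional : ∀ x a b → On.R lbl x x a b ≡ true → a ≡ b)
    (χ : Fin (On.n lbl) → Fin 2) (proper : IsProperColoring (On.hypergraph lbl) χ)
    (unsolvable : ∀ g → ¬ On.Solution lbl g) where

    open On lbl
    open ProperColouring k q _≟ᴰ_ allD allD-complete d₀ M rel lbl x₀ functional χ proper
    open Assignments _≟ˣ_ d₀

    allX : List X
    allX = List.cartesianProduct (allFin N) (allFin N)

    allX-complete : ∀ x → x ∈ allX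
    allX-complete (i , j) = ∈ₚ.∈-cartesianProduct⁺ (∈ₚ.∈-allFin i) (∈ₚ.∈-allFin j)

    Valid-⊆ : ∀ {v w g} → v ⊆ w → Valid w g → Valid v g
    Valid-⊆ v⊆w valid x y x∈ y∈ = valid x y (v⊆w x∈) (v⊆w y∈)

    AllValid : List X → (X → D) → Set
    AllValid u b = All (λ x → All (λ y → R x y (b x) (b y) ≡ true) u) u

    valid? : ∀ u b → Dec (AllValid u b)
    valid? u b = All.all? (λ x → All.all? (λ y → R x y (b x) (b y) Boolₚ.≟ true) u) u

    with-All : ∀ {A : Set} {P : A → Set} {Q : A → A → Set} {xs} → All P xs → AllPairs Q xs → AllPairs (λ x y → P x × P y × Q x y) xs
    with-All []         []         = []
    with-All (px ∷ pxs) (qx ∷ qxs) = All.zipWith (λ (py , q) → px , py , q) (pxs , qx) ∷ with-All pxs qxs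

    open Families t′ d″ _≟ˣ_ allX allX-complete _≟ᴰ_ allD allD-complete d₀ Valid (λ {v} {w} {g} → Valid-⊆ {v} {w} {g})
      color color-cong M m ≤-refl no-mono using (Gadget; gadgets; module Contradiction)

    module _ (gad : ∀ u → length u ≤ m → Gadget u) where

      open Contradiction gad

      L : List X → List (X → D)
      L u = filter (valid? u) (map (ext u) (columns u))

      length-L : ∀ u → length (L u) ≤ κ
      length-L u = ≤-trans (Listₚ.length-filter (valid? u) (map (ext u) (columns u)))
        (≤-trans (≤-reflexive (Listₚ.length-map (ext u) (columns u))) (length-columns u))

      L-valid : ∀ {u b} → length u ≤ m → b ∈ L u → ∀ {x y} → x ∈ u → y ∈ u → R x y (b x) (b y) ≡ true
      L-valid {u} _ b∈ x∈ y∈ = All.lookup (All.lookup (proj₂ (∈ₚ.∈-filter⁻ (valid? u) {xs = map (ext u) (columns u)} b∈)) x∈) y∈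

      active∈L : ∀ u g → Valid u g → col u g ∈ columns u → ext u (col u g) ∈ L u
      active∈L u g valid act = ∈ₚ.∈-filter⁺ (valid? u) (∈ₚ.∈-map⁺ (ext u) act)
        (All.tabulate (λ {x} x∈ → All.tabulate (λ {y} y∈ → trans (cong₂ (R x y) (ext-col u g x x∈) (ext-col u g y y∈)) (valid x y x∈ y∈))))

      -- If one assignment valid on `u ++ u′` were active for both sets, its restrictions would lie
      -- in both lists and agree on `T`. So lists that disagree on `T` belong to incompatible sets.
      no-large-family : ∀ T Us → All (λ u → T ⊆ u × length u ≤ m) Us →
        AllPairs (λ u u′ → ∀ {b b′} → b ∈ L u → b′ ∈ L u′ → ¬ (∀ y → y ∈ T → b y ≡ b′ y)) Us → length Us ≡ ℓ → ⊥
      no-large-family T Us above disj len = no-family Us (All.map proj₂ above)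
        (AllPairs.map (λ {u} {u′} ((T⊆u , _) , (T⊆u′ , _) , disagree) g valid act act′ →
          disagree (active∈L u g (Valid-⊆ {u} {u ++ u′} {g} ∈ₚ.∈-++⁺ˡ valid) act) (active∈L u′ g (Valid-⊆ {u′} {u ++ u′} {g}
                (∈ₚ.∈-++⁺ʳ u) valid) act′)
            λ y y∈ → trans (ext-col u g y (T⊆u y∈)) (sym (ext-col u′ g y (T⊆u′ y∈)))) (with-All above disj))
        (≤-reflexive (sym len))

      contradiction-gap : ⊥
      contradiction-gap = Gap.gap _≟ˣ_ allX allX-complete _≟ᴰ_ allD allD-complete d₀ (λ x y a b → R x y a b ≡ true)
        L κ ℓ m length-L (λ {u} → L-valid {u}) no-large-family unsolvable req≤m

    unsolvable⇒¬proper : ⊥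
    unsolvable⇒¬proper = gadgets contradiction-gap

-- The tableau of a machine

isZero : ℕ → Bool
isZero zero    = true
isZero (suc _) = false

apply-stay : ∀ {g n} (τs : Vec (Tape g) n) → Vec.zipWith writeMove τs (Vec.map (_, stay) (Vec.map Tape.head τs)) ≡ τs
apply-stay []       = refl
apply-stay (τ ∷ τs) = cong (τ ∷_) (apply-stay τs)

-- The tableau of a deterministic machine as a binary constraint system on pairs
-- (time, position).  A row describes a configuration relative to the heads: the
-- value at position j holds, for every tape, the j-th symbol to the left of the
-- head, the j-th to its right, counting from the head itself, and also the state
-- and the scanned symbols, which are shared by the whole row.
module Tableau (Mc : TM) where

  open TM Mc

  Sym : Set
  Sym = Symbol symbols

  _≟ˢ_ : DecidableEquality Sym
  blank  ≟ˢ blank  = yes refl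
  blank  ≟ˢ bit _  = no λ ()
  blank  ≟ˢ work _ = no λ ()
  bit _  ≟ˢ blank  = no λ ()
  bit a  ≟ˢ bit b  with a Boolₚ.≟ b
  ... | yes refl = yes refl
  ... | no  ne   = no λ { refl → ne refl }
  bit _  ≟ˢ work _ = no λ ()
  work _ ≟ˢ blank  = no λ ()
  work _ ≟ˢ bit _  = no λ ()
  work i ≟ˢ work j with i Finₚ.≟ j
  ... | yes refl = yes refl
  ... | no  ne   = no λ { refl → ne refl }

  allSym : List Sym
  allSym = blank ∷ bit true ∷ bit false ∷ map work (allFin symbols)

  allSym-complete : ∀ s → s ∈ allSym
  allSym-complete blank       = here refl
  allSym-complete (bit true)  = there (here refl)
  allSym-complete (bit false) = there (there (here refl))
  allSym-complete (work i)    = there (there (there (∈ₚ.∈-map⁺ work (∈ₚ.∈-allFin i))))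

  V : Set
  V = Vec Sym (suc extra)

  _≟ⱽ_ : DecidableEquality V
  _≟ⱽ_ = Vecₚ.≡-dec _≟ˢ_

  D : Set
  D = Bool × Fin states × V × V × V

  isz : D → Bool
  isz = proj₁
  st : D → Fin states
  st = proj₁ ∘ proj₂
  hd lf rt : D → V
  hd = proj₁ ∘ proj₂ ∘ proj₂
  lf = proj₁ ∘ proj₂ ∘ proj₂ ∘ proj₂
  rt = proj₂ ∘ proj₂ ∘ proj₂ ∘ proj₂

  _≟ᴰ_ : DecidableEquality D
  _≟ᴰ_ = ×ₚ.≡-dec Boolₚ._≟_ (×ₚ.≡-dec Finₚ._≟_ (×ₚ.≡-dec _≟ⱽ_ (×ₚ.≡-dec _≟ⱽ_ _≟ⱽ_)))

  allD : List D
  allD = List.cartesianProduct (true ∷ false ∷ []) (List.cartesianProduct (allFin states)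
    (List.cartesianProduct (allVec allSym _) (List.cartesianProduct (allVec allSym _) (allVec allSym _))))

  allD-complete : ∀ a → a ∈ allD
  allD-complete (z , s , h , l , r) = ∈ₚ.∈-cartesianProduct⁺ (bool z) (∈ₚ.∈-cartesianProduct⁺ (∈ₚ.∈-allFin s)
    (∈ₚ.∈-cartesianProduct⁺ (vec h) (∈ₚ.∈-cartesianProduct⁺ (vec l) (vec r))))
    where
    vec : (v : V) → v ∈ allVec allSym _
    vec = allVec-complete allSym-complete
    bool : ∀ z → z ∈ true ∷ false ∷ []
    bool true  = here refl
    bool false = there (here refl)

  d₀ : D
  d₀ = true , start , Vec.replicate _ blank , Vec.replicate _ blank , Vec.replicate _ blank

  -- A halted machine keeps rewriting its configuration.
  δ⁺ : Fin states → V → Fin states × Vec (Sym × Move) (suc extra)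
  δ⁺ q h with δ q h
  ... | just r  = r
  ... | nothing = q , Vec.map (_, stay) h

  -- At offset zero the right half holds the scanned cell, which the step overwrites.
  written : Bool → Sym → Sym → Sym
  written true  w r = w
  written false w r = r

  _==_ : Sym → Sym → Bool
  s == s′ = does (s ≟ˢ s′)

  -- Here the head is fixed and the tape moves. A left move pushes the right half outwards (`up`),
  -- pulls the left half inwards (`down`) and brings the nearest left symbol under the head
  -- (`edge`). A right move exchanges the halves, and the written symbol becomes the nearest one on
  -- the left.
  same-tape up-tape down-tape edge-tape : Bool → Sym × Move → (la ra lb rb : Sym) → Bool
  same-tape z (w , stay)  la ra lb rb = (lb == la) ∧ (rb == written z w ra)
  same-tape z (w , _)     la ra lb rb = true
  up-tape   z (w , left)  la ra lb rb = rb == written z w ra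
  up-tape   z (w , right) la ra lb rb = lb == la
  up-tape   z (w , stay)  la ra lb rb = true
  down-tape z (w , left)  la ra lb rb = lb == la
  down-tape z (w , right) la ra lb rb = rb == ra
  down-tape z (w , stay)  la ra lb rb = true
  edge-tape z (w , left)  la ra lb rb = rb == la
  edge-tape z (w , right) la ra lb rb = lb == w
  edge-tape z (w , stay)  la ra lb rb = true

  tapewise : (Bool → Sym × Move → (la ra lb rb : Sym) → Bool) → D → D → Bool
  tapewise f a b = does (Finₚ.all? (λ i →
    f (isz a) (lookup (proj₂ (δ⁺ (st a) (hd a))) i) (lookup (lf a) i) (lookup (rt a) i) (lookup (lf b) i) (lookup (rt b) i) Boolₚ.≟ true))

  fits : Label → Sym → Bool
  fits marker    s       = s == bit true
  fits (input b) s       = s == bit b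
  fits separator s       = s == bit false
  fits padding   s       = s == blank
  fits free      blank   = true
  fits free      (bit _) = true
  fits free      _       = false

  is-label : Label → Label → Bool
  is-label marker        marker        = true
  is-label (input true)  (input true)  = true
  is-label (input false) (input false) = true
  is-label separator     separator     = true
  is-label padding       padding       = true
  is-label free          free          = true
  is-label _             _             = false

  is-label-refl : ∀ ℓ → is-label ℓ ℓ ≡ true
  is-label-refl marker        = refl
  is-label-refl (input true)  = refl
  is-label-refl (input false) = refl
  is-label-refl separator     = refl
  is-label-refl padding       = refl
  is-label-refl free          = refl

  is-label-≡ : ∀ ℓ ℓ′ → is-label ℓ ℓ′ ≡ true → ℓ ≡ ℓ′
  is-label-≡ marker        marker        _ = refl
  is-label-≡ (input true)  (input true)  _ = refl
  is-label-≡ (input false) (input false) _ = refl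
  is-label-≡ separator     separator     _ = refl
  is-label-≡ padding       padding       _ = refl
  is-label-≡ free          free          _ = refl

  data Rule : Set where
    identity shared origin inside start-row propagate control same up down edge accept : Rule
    labelled : Label → Rule

  rules : List Rule
  rules = identity ∷ shared ∷ origin ∷ inside ∷ start-row ∷ propagate ∷ control ∷ same ∷ up ∷ down ∷ edge ∷ accept ∷
    labelled marker ∷ labelled (input true) ∷ labelled (input false) ∷ labelled separator ∷ labelled padding ∷ labelled free ∷ []

  rules-complete : ∀ r → r ∈ rules
  rules-complete identity  = here refl
  rules-complete shared    = there (here refl)
  rules-complete origin    = there (there (here refl))
  rules-complete inside    = there (there (there (here refl)))
  rules-complete start-row = there (there (there (there (here refl))))
  rules-complete propagate = there (there (there (there (there (here refl)))))
  rules-complete control   = there (there (there (there (there (there (here refl))))))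
  rules-complete same      = there (there (there (there (there (there (there (here refl)))))))
  rules-complete up        = there (there (there (there (there (there (there (there (here refl))))))))
  rules-complete down      = there (there (there (there (there (there (there (there (there (here refl)))))))))
  rules-complete edge      = there (there (there (there (there (there (there (there (there (there (here refl))))))))))
  rules-complete accept    = there (there (there (there (there (there (there (there (there (there (there (here refl)))))))))))
  rules-complete (labelled ℓ) = there (there (there (there (there (there (there (there (there (there (there (there (labels ℓ))))))))))))
    where
    labels : ∀ ℓ → labelled ℓ ∈ _
    labels marker        = here refl
    labels (input true)  = there (here refl)
    labels (input false) = there (there (here refl))
    labels separator     = there (there (there (here refl)))
    labels padding       = there (there (there (there (here refl))))
    labels free          = there (there (there (there (there (here refl)))))

  private
    pattern i  = zero
    pattern j  = suc zero
    pattern i′ = suc (suc zero)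
    pattern j′ = suc (suc (suc zero))

  guard : Rule → BExp 4
  guard identity     = eqᵉ i i′ ∧ᵉ eqᵉ j j′
  guard shared       = eqᵉ i i′
  guard origin       = zeroᵉ j
  guard inside       = ¬ᵉ zeroᵉ j
  guard start-row    = zeroᵉ i
  guard (labelled ℓ) = zeroᵉ i ∧ᵉ labelᵉ (is-label ℓ) j
  guard propagate    = zeroᵉ i ∧ᵉ eqᵉ i i′ ∧ᵉ succᵉ j j′
  guard control      = succᵉ i i′
  guard same         = succᵉ i i′ ∧ᵉ eqᵉ j j′
  guard up           = succᵉ i i′ ∧ᵉ succᵉ j j′
  guard down         = succᵉ i i′ ∧ᵉ succᵉ j′ j
  guard edge         = succᵉ i i′ ∧ᵉ eqᵉ j j′ ∧ᵉ zeroᵉ j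
  guard accept       = lastᵉ i

  halted : D → Bool
  halted a with δ (st a) (hd a)
  ... | nothing = true
  ... | just _  = false

  body : Rule → D → D → Bool
  -- Two values for one variable violate this rule, which makes the system `functional`.
  body identity     a b = does (a ≟ᴰ b)
  body shared       a b = does (st a Finₚ.≟ st b) ∧ does (hd a ≟ⱽ hd b)
  body origin       a b = isz a ∧ does (rt a ≟ⱽ hd a)
  body inside       a b = not (isz a)
  body start-row    a b = does (st a Finₚ.≟ start) ∧ does (lf a ≟ⱽ Vec.replicate _ blank) ∧ does (Vecₚ.≡-dec _≟ˢ_ (Vec.tail
        (rt a)) (Vec.replicate _ blank))
  body (labelled ℓ) a b = fits ℓ (Vec.head (rt a))
  body propagate    a b = not (Vec.head (rt a) == blank) ∨ (Vec.head (rt b) == blank)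
  body control      a b = does (st b Finₚ.≟ proj₁ (δ⁺ (st a) (hd a)))
  body same         a b = tapewise same-tape a b
  body up           a b = tapewise up-tape a b
  body down         a b = tapewise down-tape a b
  body edge         a b = tapewise edge-tape a b
  body accept       a b = halted a ∧ (Vec.head (hd a) == bit true)

  ruleᵉ : D → D → Rule → BExp 4
  ruleᵉ a b r = guard r ⇒ᵉ constᵉ (body r a b)

  rel : D → D → BExp 4
  rel a b = ⋀ (map (ruleᵉ a b) rules)

  nth : List Sym → ℕ → Sym
  nth = nthOr blank

  leftOf rightOf : Tape symbols → ℕ → Sym
  leftOf  τ n       = nth (Tape.before τ) n
  rightOf τ zero    = Tape.head τ
  rightOf τ (suc n) = nth (Tape.after τ) n

  module _ (τ : Tape symbols) (w : Sym) where

    left-left : ∀ n → leftOf (writeMove τ (w , left)) n ≡ leftOf τ (suc n)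
    left-left n with Tape.before τ
    ... | []    = refl
    ... | _ ∷ _ = refl

    left-right-zero : rightOf (writeMove τ (w , left)) zero ≡ leftOf τ zero
    left-right-zero with Tape.before τ
    ... | []    = refl
    ... | _ ∷ _ = refl

    left-right-suc : ∀ n → rightOf (writeMove τ (w , left)) (suc n) ≡ written (isZero n) w (rightOf τ n)
    left-right-suc zero    = refl
    left-right-suc (suc n) = refl

    stay-right : ∀ n → rightOf (writeMove τ (w , stay)) n ≡ written (isZero n) w (rightOf τ n)
    stay-right zero    = refl
    stay-right (suc n) = refl

    right-right : ∀ n → rightOf (writeMove τ (w , right)) n ≡ rightOf τ (suc n)
    right-right zero with Tape.after τ
    ... | []    = refl
    ... | _ ∷ _ = refl
    right-right (suc n) with Tape.after τ
    ... | []    = refl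
    ... | _ ∷ _ = refl

  next : Config Mc → Config Mc
  next (s , τs) = let (s′ , acts) = δ⁺ s (Vec.map Tape.head τs) in s′ , Vec.zipWith writeMove τs acts

  conf : Config Mc → ℕ → Config Mc
  conf c zero    = c
  conf c (suc n) = next (conf c n)

  cell : Config Mc → ℕ → D
  cell (s , τs) n = isZero n , s , Vec.map Tape.head τs , Vec.map (λ τ → leftOf τ n) τs , Vec.map (λ τ → rightOf τ n) τs

  next-halted : ∀ c → step Mc c ≡ nothing → next c ≡ c
  next-halted (s , τs) eq with δ s (Vec.map Tape.head τs)
  ... | nothing = cong (s ,_) (apply-stay τs)

  next-step : ∀ c {c′} → step Mc c ≡ just c′ → next c ≡ c′
  next-step (s , τs) eq with δ s (Vec.map Tape.head τs)
  next-step (s , τs) refl | just _ = refl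

  conf-next : ∀ c n → conf (next c) n ≡ next (conf c n)
  conf-next c zero    = refl
  conf-next c (suc n) = cong next (conf-next c n)

  conf-halted : ∀ c → step Mc c ≡ nothing → ∀ n → conf c n ≡ c
  conf-halted c halt zero    = refl
  conf-halted c halt (suc n) = trans (cong next (conf-halted c halt n)) (next-halted c halt)

  -- A halted configuration is a fixed point of `next`. So every row from the halting time on is
  -- final, and acceptance can be read in the last row.
  run-conf : ∀ n m c {c′} → run Mc n c ≡ just c′ → n ≤ m → conf c m ≡ c′ × step Mc c′ ≡ nothing
  run-conf n m c eq n≤m with step Mc c in eq′
  run-conf n       m       c refl n≤m       | nothing = conf-halted c eq′ m , eq′
  run-conf (suc n) (suc m) c eq   (s≤s n≤m) | just c₁ =
    let (eq₁ , halt) = run-conf n m c₁ eq n≤m in trans (sym (conf-next c m)) (trans (cong (λ c → conf c m) (next-step c eq′)) eq₁) , halt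

-- The `f` free cells bound the length of the witness; the `r` padding cells make the grid exceed
-- the running time.
labels : List Bool → ℕ → ℕ → List Label
labels x f r = concatMap (λ b → marker ∷ input b ∷ []) x ++ separator ∷ List.replicate f free ++ List.replicate r padding

module Words (Mc : TM) where

  open TM Mc
  open Tableau Mc

  word : List Bool → List Bool → List Sym
  word x u = map bit (pair x u)

  Fits : (ls : List Label) → (Fin (length ls) → Sym) → Set
  Fits ls s = ∀ i → fits (List.lookup ls i) (s i) ≡ true

  Propagates : ∀ {n} → (Fin n → Sym) → Set
  Propagates s = ∀ i i′ → toℕ i′ ≡ suc (toℕ i) → s i ≡ blank → s i′ ≡ blank

  propagates-suc : ∀ {n} {s : Fin (suc n) → Sym} → Propagates s → Propagates (s ∘ suc)
  propagates-suc prop i i′ eq = prop (suc i) (suc i′) (cong suc eq)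

  all-blank : ∀ {n} (s : Fin (suc n) → Sym) → Propagates s → s zero ≡ blank → ∀ i → s i ≡ blank
  all-blank s prop eq zero            = eq
  all-blank {suc n} s prop eq (suc i) = all-blank (s ∘ suc) (propagates-suc {s = s} prop) (prop zero (suc zero) refl eq) i

  ==-true : ∀ {s s′} → s == s′ ≡ true → s ≡ s′
  ==-true {s} {s′} = does-true {P? = s ≟ˢ s′}

  ==-refl : ∀ s → s == s ≡ true
  ==-refl s = dec-true (s ≟ˢ s) refl

  decode-padding : ∀ r s → Fits (List.replicate r padding) s → ∀ i → s i ≡ blank
  decode-padding (suc r) s fit zero    = ==-true (fit zero)
  decode-padding (suc r) s fit (suc i) = decode-padding r (s ∘ suc) (fit ∘ suc) i

  decode-free : ∀ f r s → Fits (List.replicate f free ++ List.replicate r padding) s → Propagates s →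
    ∃[ u ] length u ≤ f × ∀ i → s i ≡ nth (map bit u) (toℕ i)
  decode-free zero    r s fit prop = [] , z≤n , decode-padding r s fit
  decode-free (suc f) r s fit prop with s zero in eq | fit zero
  ... | blank  | _ = [] , z≤n , all-blank s prop eq
  ... | bit b  | _ with decode-free f r (s ∘ suc) (fit ∘ suc) (propagates-suc {s = s} prop)
  ... | u , u≤ , eqs = b ∷ u , s≤s u≤ , λ { zero → eq ; (suc i) → eqs i }

  decode : ∀ x f r s → Fits (labels x f r) s → Propagates s → ∃[ u ] length u ≤ f × ∀ i → s i ≡ nth (word x u) (toℕ i)
  decode []      f r s fit prop =
    let (u , u≤ , eqs) = decode-free f r (s ∘ suc) (fit ∘ suc) (propagates-suc {s = s} prop)
    in u , u≤ , λ { zero → ==-true (fit zero) ; (suc i) → eqs i }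
  decode (b ∷ x) f r s fit prop =
    let (u , u≤ , eqs) = decode x f r (λ i → s (suc (suc i))) (λ i → fit (suc (suc i))) (propagates-suc {s = s ∘ suc}
          (propagates-suc {s = s} prop))
    in u , u≤ , λ { zero → ==-true (fit zero) ; (suc zero) → ==-true (fit (suc zero)) ; (suc (suc i)) → eqs i }

  encode-padding : ∀ r i → fits (List.lookup (List.replicate r padding) i) blank ≡ true
  encode-padding (suc r) zero    = refl
  encode-padding (suc r) (suc i) = encode-padding r i

  encode-free : ∀ u f r → length u ≤ f → ∀ i →
    fits (List.lookup (List.replicate f free ++ List.replicate r padding) i) (nth (map bit u) (toℕ i)) ≡ true
  encode-free []      zero    r _        i       = encode-padding r i
  encode-free []      (suc f) r _        zero    = refl
  encode-free []      (suc f) r _        (suc i) = encode-free [] f r z≤n i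
  encode-free (b ∷ u) (suc f) r _        zero    = refl
  encode-free (b ∷ u) (suc f) r (s≤s u≤) (suc i) = encode-free u f r u≤ i

  encode : ∀ x u f r → length u ≤ f → ∀ i → fits (List.lookup (labels x f r) i) (nth (word x u) (toℕ i)) ≡ true
  encode []      u f r u≤ zero          = refl
  encode []      u f r u≤ (suc i)       = encode-free u f r u≤ i
  encode (b ∷ x) u f r u≤ zero          = refl
  encode (b ∷ x) u f r u≤ (suc zero)    = ==-refl (bit b)
  encode (b ∷ x) u f r u≤ (suc (suc i)) = encode x u f r u≤ i

  bits-propagate : ∀ (l : List Bool) n → nth (map bit l) n ≡ blank → nth (map bit l) (suc n) ≡ blank
  bits-propagate []      n       eq = refl
  bits-propagate (b ∷ l) (suc n) eq = bits-propagate l n eq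

module CookLevin (Mc : TM) (accepts : List Bool → Bool) (pM : List ℕ)
  (computes : ∀ y → ∃[ c ] run Mc (evalPoly pM (length y)) (initial Mc y) ≡ just c × output Mc c ≡ [ accepts y ])
  (x : List Bool) (f r : ℕ)
  (enough-time : ∀ u → length u ≤ f → evalPoly pM (length (pair x u)) < length (labels x f r)) where

  open TM Mc
  open Tableau Mc
  open Words Mc

  N : ℕ
  N = length (labels x f r)

  lbl : Fin N → Label
  lbl = List.lookup (labels x f r)

  open Semantics lbl

  R : Fin N × Fin N → Fin N × Fin N → D → D → Bool
  R (x₁ , x₂) (y₁ , y₂) a b = eval (rel a b) (x₁ ∷ x₂ ∷ y₁ ∷ y₂ ∷ [])

  Holds : Rule → Fin N × Fin N → Fin N × Fin N → Set
  Holds ru (x₁ , x₂) (y₁ , y₂) = eval (guard ru) (x₁ ∷ x₂ ∷ y₁ ∷ y₂ ∷ []) ≡ true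

  R-elim : ∀ x y {a b} → R x y a b ≡ true → ∀ ru → Holds ru x y → body ru a b ≡ true
  R-elim x y {a} {b} eq ru holds = ⇒ᵉ-elim (guard ru) (constᵉ (body ru a b)) (⋀-elim (ruleᵉ a b) rules eq (rules-complete ru)) holds

  R-intro : ∀ x y {a b} → (∀ ru → Holds ru x y → body ru a b ≡ true) → R x y a b ≡ true
  R-intro x y {a} {b} imp = ⋀-intro (ruleᵉ a b) rules (λ ru _ → ⇒ᵉ-intro (guard ru) (constᵉ (body ru a b)) (imp ru))

  functional : ∀ x a b → R x x a b ≡ true → a ≡ b
  functional x a b eq = does-true {P? = a ≟ᴰ b} (R-elim x x eq identity (cong₂ _∧_ (dec-true (proj₁ x Finₚ.≟ proj₁ x) refl)
        (dec-true (proj₂ x Finₚ.≟ proj₂ x) refl)))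

  tapewise-elim : ∀ φ a b → tapewise φ a b ≡ true → ∀ i →
    φ (isz a) (lookup (proj₂ (δ⁺ (st a) (hd a))) i) (lookup (lf a) i) (lookup (rt a) i) (lookup (lf b) i) (lookup (rt b) i) ≡ true
  tapewise-elim φ a b eq = does-true {P? = Finₚ.all? (λ i → _ Boolₚ.≟ true)} eq

  nth-uncons : ∀ l n → rightOf (tape [] (proj₁ (uncons l)) (proj₂ (uncons l))) n ≡ nth l n
  nth-uncons []      zero    = refl
  nth-uncons []      (suc n) = refl
  nth-uncons (s ∷ l) zero    = refl
  nth-uncons (s ∷ l) (suc n) = refl

  initial-cell : ∀ u n → cell (initial Mc (pair x u)) n ≡
    (isZero n , start , nth (word x u) 0 ∷ Vec.replicate extra blank , Vec.replicate _ blank , nth (word x u) n ∷ Vec.replicate extra blank)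
  initial-cell u n = cong (λ v → isZero n , start , v) (cong₂ _,_ (cong₂ _∷_ (nth-uncons (word x u) 0)
        (Vecₚ.map-replicate Tape.head _ extra))
    (cong₂ _,_ (cong (_ ∷_) (Vecₚ.map-replicate (λ τ → leftOf τ n) _ extra)) (cong₂ _∷_ (nth-uncons (word x u) n) (blanks n))))
    where
    blanks : ∀ n → Vec.map (λ τ → rightOf τ n) (Vec.replicate extra (tape [] blank [])) ≡ Vec.replicate extra blank
    blanks zero    = Vecₚ.map-replicate (λ τ → rightOf τ zero) _ extra
    blanks (suc n) = Vecₚ.map-replicate (λ τ → rightOf τ (suc n)) _ extra

  lookup-next : ∀ c (φ : Tape symbols → Sym) t → lookup (Vec.map φ (proj₂ (next c))) t ≡
    φ (writeMove (lookup (proj₂ c) t) (lookup (proj₂ (δ⁺ (proj₁ c) (Vec.map Tape.head (proj₂ c)))) t))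
  lookup-next (s , τs) φ t = trans (Vecₚ.lookup-map t φ (Vec.zipWith writeMove τs acts)) (cong φ (Vecₚ.lookup-zipWith writeMove t τs acts))
    where acts = proj₂ (δ⁺ s (Vec.map Tape.head τs))

  module Sound (g : Fin N × Fin N → D) (solution : ∀ x y → R x y (g x) (g y) ≡ true) where

    G : ∀ {i j} → i < N → j < N → D
    G p q = g (Fin.fromℕ< p , Fin.fromℕ< q)

    fact : ∀ ru {i j i′ j′} (p : i < N) (q : j < N) (p′ : i′ < N) (q′ : j′ < N) →
      Holds ru (Fin.fromℕ< p , Fin.fromℕ< q) (Fin.fromℕ< p′ , Fin.fromℕ< q′) → body ru (G p q) (G p′ q′) ≡ true
    fact ru p q p′ q′ = R-elim (Fin.fromℕ< p , Fin.fromℕ< q) (Fin.fromℕ< p′ , Fin.fromℕ< q′) (solution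
          (Fin.fromℕ< p , Fin.fromℕ< q) (Fin.fromℕ< p′ , Fin.fromℕ< q′)) ru

    equalAt : ∀ {i i′} (p : i < N) (p′ : i′ < N) → i ≡ i′ → does (Fin.fromℕ< p Finₚ.≟ Fin.fromℕ< p′) ≡ true
    equalAt p p′ eq = dec-true (_ Finₚ.≟ _) (Finₚ.fromℕ<-cong _ _ eq p p′)

    succAt : ∀ {i} (p : i < N) (p′ : suc i < N) → does (toℕ (Fin.fromℕ< p′) ℕₚ.≟ suc (toℕ (Fin.fromℕ< p))) ≡ true
    succAt p p′ = dec-true (_ ℕₚ.≟ _) (trans (Finₚ.toℕ-fromℕ< p′) (cong suc (sym (Finₚ.toℕ-fromℕ< p))))

    zeroAt : (p : 0 < N) → does (toℕ (Fin.fromℕ< p) ℕₚ.≟ 0) ≡ true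
    zeroAt p = dec-true (_ ℕₚ.≟ _) (Finₚ.toℕ-fromℕ< p)

    isz-G : ∀ {i j} (p : i < N) (q : j < N) → isz (G p q) ≡ isZero j
    isz-G {j = zero}  p q = proj₁ (∧-true (fact origin p q p q (zeroAt q)))
    isz-G {j = suc j} p q = trans (sym (Boolₚ.not-involutive _)) (cong not (fact inside p q p q
      (cong not (dec-false (_ ℕₚ.≟ _) (λ eq → case trans (sym (Finₚ.toℕ-fromℕ< q)) eq of λ ())))))

    hd-G : ∀ {i j} (p : i < N) (q : j < N) (z : 0 < N) → hd (G p q) ≡ rt (G p z)
    hd-G p q z = trans (does-true {P? = _ ≟ⱽ _} (proj₂ (∧-true (fact shared p q p z (equalAt p p refl)))))
      (sym (does-true {P? = _ ≟ⱽ _} (proj₂ (∧-true (fact origin p z p z (zeroAt z))))))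

    -- For each move, exactly one rule determines each half at `j`. At position zero, which has no
    -- predecessor, `edge` takes the place of `up`.
    tape-step : ∀ τ act j lb rb →
      same-tape (isZero j) act (leftOf τ j) (rightOf τ j) lb rb ≡ true →
      down-tape false act (leftOf τ (suc j)) (rightOf τ (suc j)) lb rb ≡ true →
      (∀ j₀ → j ≡ suc j₀ → up-tape (isZero j₀) act (leftOf τ j₀) (rightOf τ j₀) lb rb ≡ true) →
      (j ≡ 0 → edge-tape true act (leftOf τ 0) (rightOf τ 0) lb rb ≡ true) →
      lb ≡ leftOf (writeMove τ act) j × rb ≡ rightOf (writeMove τ act) j
    tape-step τ (w , left) zero lb rb s d u e =
      trans (==-true d) (sym (left-left τ w 0)) , trans (==-true (e refl)) (sym (left-right-zero τ w))
    tape-step τ (w , left) (suc j) lb rb s d u e =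
      trans (==-true d) (sym (left-left τ w (suc j))) , trans (==-true (u j refl)) (sym (left-right-suc τ w j))
    tape-step τ (w , stay) j lb rb s d u e =
      let (l , r) = ∧-true s in ==-true l , trans (==-true r) (sym (stay-right τ w j))
    tape-step τ (w , right) zero lb rb s d u e = ==-true (e refl) , trans (==-true d) (sym (right-right τ w 0))
    tape-step τ (w , right) (suc j) lb rb s d u e = ==-true (u j refl) , trans (==-true d) (sym (right-right τ w (suc j)))

    module Row (u : List Bool) (row-word : ∀ {j} (z : 0 < N) (q : j < N) → Vec.head (rt (G z q)) ≡ nth (word x u) j) where

      C : ℕ → Config Mc
      C = conf (initial Mc (pair x u))

      -- Position `j` depends on position `suc j` one step earlier, and the grid ends at `N`. So
      -- correctness is guaranteed only in the triangle `i + j < N`; it contains position zero of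
      -- the last row, where acceptance is read.
      cone : ∀ i {j} (p : i < N) (q : j < N) → i + j < N → G p q ≡ cell (C i) j
      cone zero {j} p q _ = trans (cong₂ _,_ (isz-G p q) (cong₂ _,_ (does-true {P? = _ Finₚ.≟ _} (proj₁ start-fact))
          (cong₂ _,_ (trans (hd-G p q p) (rt-0 p)) (cong₂ _,_ (does-true {P? = _ ≟ⱽ _} (proj₁ (∧-true (proj₂ start-fact)))) (rt-0 q)))))
          (sym (initial-cell u j))
        where
        start-fact = ∧-true {does (st (G p q) Finₚ.≟ start)} (fact start-row p q p q (zeroAt p))
        rt-0 : ∀ {j} (q : j < N) → rt (G p q) ≡ nth (word x u) j ∷ Vec.replicate extra blank
        rt-0 q = head-tail (rt (G p q)) (row-word p q) (does-true {P? = Vecₚ.≡-dec _≟ˢ_ (Vec.tail (rt (G p q))) (Vec.replicate _ blank)}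
          (proj₂ (∧-true {does (lf (G p q) ≟ⱽ Vec.replicate _ blank)} (proj₂ (∧-true {does (st (G p q) Finₚ.≟ start)}
                (fact start-row p q p q (zeroAt p)))))))
          where
          head-tail : ∀ {n s} {w : Vec Sym n} (v : Vec Sym (suc n)) → Vec.head v ≡ s → Vec.tail v ≡ w → v ≡ s ∷ w
          head-tail (_ ∷ _) refl refl = refl
      cone (suc i) {j} p q i+j< = cong₂ _,_ (isz-G p q) (cong₂ _,_ st-≡ (cong₂ _,_ (trans (hd-G p q z) (proj₂ (sides z
            (≤-trans (s≤s (≤-reflexive (+-identityʳ (suc i)))) p)))) (cong₂ _,_ (proj₁ (sides q i+j<)) (proj₂ (sides q i+j<)))))
        where
        p₀ : i < N
        p₀ = <-trans (n<1+n i) p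
        z : 0 < N
        z = ≤-trans (s≤s z≤n) p
        τs = proj₂ (C i)
        acts = proj₂ (δ⁺ (proj₁ (C i)) (Vec.map Tape.head τs))

        st-≡ : st (G p q) ≡ proj₁ (C (suc i))
        st-≡ = trans (does-true {P? = _ Finₚ.≟ _} (fact control p₀ q p q (succAt p₀ p)))
          (cong (λ a → proj₁ (δ⁺ (st a) (hd a))) (cone i p₀ q (<-trans (n<1+n _) i+j<)))

        sides : ∀ {j} (q : j < N) → suc i + j < N →
          lf (G p q) ≡ Vec.map (λ τ → leftOf τ j) (proj₂ (C (suc i))) × rt (G p q) ≡ Vec.map (λ τ → rightOf τ j) (proj₂ (C (suc i)))
        sides {j} q i+j< = vec-ext (λ t → trans (proj₁ (at t)) (sym (lookup-next (C i) (λ τ → leftOf τ j) t))) ,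
                           vec-ext (λ t → trans (proj₂ (at t)) (sym (lookup-next (C i) (λ τ → rightOf τ j) t)))
          where
          from : ∀ φ {j₀} (q₀ : j₀ < N) → i + j₀ < N → tapewise φ (G p₀ q₀) (G p q) ≡ true → ∀ t →
            φ (isZero j₀) (lookup acts t) (leftOf (lookup τs t) j₀) (rightOf (lookup τs t) j₀) (lookup (lf (G p q)) t)
                  (lookup (rt (G p q)) t) ≡ true
          from φ {j₀} q₀ lt eq t = subst₂ (λ l r → φ (isZero j₀) (lookup acts t) l r (lookup (lf (G p q)) t) (lookup (rt (G p q)) t) ≡ true)
            (Vecₚ.lookup-map t (λ τ → leftOf τ j₀) τs) (Vecₚ.lookup-map t (λ τ → rightOf τ j₀) τs)
            (tapewise-elim φ (cell (C i) j₀) (G p q) (subst (λ a → tapewise φ a (G p q) ≡ true) (cone i p₀ q₀ lt) eq) t)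

          at : ∀ t → lookup (lf (G p q)) t ≡ leftOf (writeMove (lookup τs t) (lookup acts t)) j ×
                     lookup (rt (G p q)) t ≡ rightOf (writeMove (lookup τs t) (lookup acts t)) j
          at t = tape-step (lookup τs t) (lookup acts t) j _ _
            (from same-tape q (<-trans (n<1+n _) i+j<) (fact same p₀ q p q (cong₂ _∧_ (succAt p₀ p) (equalAt q q refl))) t)
            (from down-tape q′ i+sj< (fact down p₀ q′ p q (cong₂ _∧_ (succAt p₀ p) (succAt q q′))) t)
            (λ { j₀ refl → from up-tape (<-trans (n<1+n j₀) q) (<-trans (n<1+n _) (subst (_< N) (+-suc i j₀) (<-trans (n<1+n _) i+j<)))
              (fact up p₀ (<-trans (n<1+n j₀) q) p q (cong₂ _∧_ (succAt p₀ p) (succAt (<-trans (n<1+n j₀) q) q))) t })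
            (λ { refl → from edge-tape q (<-trans (n<1+n _) i+j<) (fact edge p₀ q p q (cong₂ _∧_ (succAt p₀ p) (cong₂ _∧_
                  (equalAt q q refl) (zeroAt q)))) t })
            where
            i+sj< : i + suc j < N
            i+sj< = subst (_< N) (sym (+-suc i j)) i+j<
            q′ : suc j < N
            q′ = ≤-<-trans (m≤n+m (suc j) i) i+sj<

      accepted : length u ≤ f → accepts (pair x u) ≡ true
      accepted u≤ = last-row (N ∸ 1) (suc-pred N ⦃ >-nonZero 0<N ⦄)
        where
        0<N : 0 < N
        0<N = ≤-<-trans z≤n (enough-time u u≤)
        last-row : ∀ i → suc i ≡ N → accepts (pair x u) ≡ true
        last-row i eq =
          let p = ≤-reflexive eq
              (_ , head-true) = ∧-true (fact accept p 0<N p 0<N (dec-true (_ ℕₚ.≟ _) (trans (cong suc (Finₚ.toℕ-fromℕ< p)) eq)))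
              (c , ran , out) = computes (pair x u)
              (C≡c , _) = run-conf (evalPoly pM (length (pair x u))) i (initial Mc (pair x u)) ran (≤-pred (≤-trans
                    (enough-time u u≤) (≤-reflexive (sym eq))))
          in output-true c out (trans (cong (λ c → Vec.head (Vec.map Tape.head (proj₂ c))) (sym C≡c))
               (trans (cong (Vec.head ∘ hd) (sym (cone i p 0<N (subst (_< N) (sym (+-identityʳ i)) p)))) (==-true head-true)))
          where
          output-true : ∀ c → output Mc c ≡ [ accepts (pair x u) ] → Vec.head (Vec.map Tape.head
                (proj₂ c)) ≡ bit true → accepts (pair x u) ≡ true
          output-true (_ , tape _ s ss ∷ _) out refl with out
          ... | eq = sym (Listₚ.∷-injectiveˡ eq)

  sound : ∀ g → (∀ x y → R x y (g x) (g y) ≡ true) → ∃[ u ] length u ≤ f × accepts (pair x u) ≡ true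
  sound g solution =
    let (u , u≤ , eqs) = decode x f r first-row (λ j → R-elim (origin-row , j) (origin-row , j) (solution (origin-row , j)
          (origin-row , j)) (labelled (lbl j))
            (cong₂ _∧_ (zeroAt 0<N) (is-label-refl (lbl j))))
          (λ j j′ eq blank-j → propagate-blank (R-elim (origin-row , j) (origin-row , j′) (solution (origin-row , j)
                (origin-row , j′)) propagate
            (cong₂ _∧_ (zeroAt 0<N) (cong₂ _∧_ (dec-true (origin-row Finₚ.≟ origin-row) refl) (dec-true (toℕ j′ ℕₚ.≟ suc
                  (toℕ j)) eq)))) blank-j)
    in u , u≤ , Row.accepted u (λ _ q → trans (eqs (Fin.fromℕ< q)) (cong (nth (word x u)) (Finₚ.toℕ-fromℕ< q))) u≤
    where
    open Sound g solution
    0<N : 0 < N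
    0<N = ≤-<-trans z≤n (enough-time [] z≤n)

    origin-row : Fin N
    origin-row = Fin.fromℕ< 0<N

    first-row : Fin N → Sym
    first-row j = Vec.head (rt (g (origin-row , j)))

    propagate-blank : ∀ {s s′} → (not (s == blank) ∨ (s′ == blank)) ≡ true → s ≡ blank → s′ ≡ blank
    propagate-blank {_} {s′} eq refl = ==-true eq

  complete : ∀ u → length u ≤ f → accepts (pair x u) ≡ true → ∃[ g ] ∀ x y → R x y (g x) (g y) ≡ true
  complete u u≤ accepted = g , λ x y → R-intro x y (λ ru → satisfied ru x y)
    where
    C : ℕ → Config Mc
    C = conf (initial Mc (pair x u))

    g : Fin N × Fin N → D
    g (i , j) = cell (C (toℕ i)) (toℕ j)

    tapewise-intro : ∀ φ c j j′ → (∀ τ act → φ (isZero j) act (leftOf τ j) (rightOf τ j) (leftOf (writeMove τ act) j′)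
          (rightOf (writeMove τ act) j′) ≡ true) →
      tapewise φ (cell c j) (cell (next c) j′) ≡ true
    tapewise-intro φ c j j′ ok = dec-true (Finₚ.all? (λ t → _ Boolₚ.≟ true)) λ t → trans
      (φ-cong (Vecₚ.lookup-map t (λ τ → leftOf τ j) (proj₂ c)) (Vecₚ.lookup-map t (λ τ → rightOf τ j) (proj₂ c))
            (lookup-next c (λ τ → leftOf τ j′) t) (lookup-next c (λ τ → rightOf τ j′) t))
      (ok (lookup (proj₂ c) t) (lookup (proj₂ (δ⁺ (proj₁ c) (Vec.map Tape.head (proj₂ c)))) t))
      where
      φ-cong : ∀ {act l l′ r r′ l₁ l₁′ r₁ r₁′} → l ≡ l′ → r ≡ r′ → l₁ ≡ l₁′ → r₁ ≡ r₁′ → φ (isZero j) act l r l₁ r₁ ≡ φ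
            (isZero j) act l′ r′ l₁′ r₁′
      φ-cong refl refl refl refl = refl

    same-ok : ∀ j τ act → same-tape (isZero j) act (leftOf τ j) (rightOf τ j) (leftOf (writeMove τ act) j) (rightOf
          (writeMove τ act) j) ≡ true
    same-ok j τ (w , left)  = refl
    same-ok j τ (w , right) = refl
    same-ok j τ (w , stay)  = cong₂ _∧_ (==-refl (leftOf τ j)) (dec-true (_ ≟ˢ _) (stay-right τ w j))

    up-ok : ∀ j τ act → up-tape (isZero j) act (leftOf τ j) (rightOf τ j) (leftOf (writeMove τ act) (suc j)) (rightOf
          (writeMove τ act) (suc j)) ≡ true
    up-ok j τ (w , left)  = dec-true (_ ≟ˢ _) (left-right-suc τ w j)
    up-ok j τ (w , right) = ==-refl (leftOf τ j)
    up-ok j τ (w , stay)  = refl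

    down-ok : ∀ j τ act → down-tape false act (leftOf τ (suc j)) (rightOf τ (suc j)) (leftOf (writeMove τ act) j) (rightOf
          (writeMove τ act) j) ≡ true
    down-ok j τ (w , left)  = dec-true (_ ≟ˢ _) (left-left τ w j)
    down-ok j τ (w , right) = dec-true (_ ≟ˢ _) (right-right τ w j)
    down-ok j τ (w , stay)  = refl

    edge-ok : ∀ τ act → edge-tape true act (leftOf τ 0) (rightOf τ 0) (leftOf (writeMove τ act) 0) (rightOf (writeMove τ act) 0) ≡ true
    edge-ok τ (w , left)  = dec-true (_ ≟ˢ _) (left-right-zero τ w)
    edge-ok τ (w , right) = ==-refl w
    edge-ok τ (w , stay)  = refl

    imply-blank : ∀ s s′ → (s ≡ blank → s′ ≡ blank) → (not (s == blank) ∨ (s′ == blank)) ≡ true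
    imply-blank s s′ imp with s ≟ˢ blank
    ... | no  _  = refl
    ... | yes eq = dec-true (s′ ≟ˢ blank) (imp eq)

    final : Vec.head (Vec.map Tape.head (proj₂ (C (N ∸ 1)))) ≡ bit true × step Mc (C (N ∸ 1)) ≡ nothing
    final with computes (pair x u)
    ... | c , ran , out with run-conf _ (N ∸ 1) (initial Mc (pair x u)) ran (≤-pred (≤-trans (enough-time u u≤) (≤-reflexive
          (sym (suc-pred N ⦃ >-nonZero (≤-<-trans z≤n (enough-time u u≤)) ⦄)))))
    ... | C≡c , halt = subst (λ c → Vec.head (Vec.map Tape.head (proj₂ c)) ≡ bit true) (sym C≡c) (head-true c (trans out
          (cong [_] accepted))) ,
                       subst (λ c → step Mc c ≡ nothing) (sym C≡c) halt
      where
      head-true : ∀ c → output Mc c ≡ [ true ] → Vec.head (Vec.map Tape.head (proj₂ c)) ≡ bit true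
      head-true (_ , tape _ (bit true) _ ∷ _) _ = refl

    halted-cell : ∀ c n → step Mc c ≡ nothing → halted (cell c n) ≡ true
    halted-cell (s , τs) n eq with δ s (Vec.map Tape.head τs)
    ... | nothing = refl

    satisfied : ∀ ru x y → Holds ru x y → body ru (g x) (g y) ≡ true
    satisfied identity (i , j) (i′ , j′) holds =
      dec-true (_ ≟ᴰ _) (cong₂ (λ i j → g (i , j)) (does-true {P? = i Finₚ.≟ i′} (proj₁ (∧-true holds)))
            (does-true {P? = j Finₚ.≟ j′} (proj₂ (∧-true holds))))
    satisfied shared (i , j) (i′ , j′) holds with does-true {P? = i Finₚ.≟ i′} holds
    ... | refl = cong₂ _∧_ (dec-true (st (g (i , j)) Finₚ.≟ st (g (i , j))) refl) (dec-true (hd (g (i , j)) ≟ⱽ hd (g (i , j))) refl)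
    satisfied origin (i , j) _ holds = subst (λ n → body origin (cell (C (toℕ i)) n) d₀ ≡ true) (sym
          (does-true {P? = toℕ j ℕₚ.≟ 0} holds)) (dec-true (hd (g (i , j)) ≟ⱽ hd (g (i , j))) refl)
    satisfied inside (i , j) _ holds with toℕ j
    ... | suc _ = refl
    satisfied start-row (i , j) _ holds = subst (λ n → body start-row (cell (C n) (toℕ j)) d₀ ≡ true) (sym
          (does-true {P? = toℕ i ℕₚ.≟ 0} holds))
      (subst (λ a → body start-row a d₀ ≡ true) (sym (initial-cell u (toℕ j)))
        (cong₂ _∧_ (dec-true (start Finₚ.≟ start) refl) (cong₂ _∧_ (dec-true
              (Vec.replicate _ blank ≟ⱽ Vec.replicate _ blank) refl) (dec-true (Vecₚ.≡-dec _≟ˢ_ (Vec.replicate extra blank)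
                    (Vec.replicate extra blank)) refl))))
    satisfied (labelled ℓ) (i , j) _ holds =
      subst₂ (λ n ℓ → fits ℓ (Vec.head (rt (cell (C n) (toℕ j)))) ≡ true) (sym (does-true {P? = toℕ i ℕₚ.≟ 0} (proj₁
            (∧-true holds)))) (sym (is-label-≡ ℓ (lbl j) (proj₂ (∧-true holds))))
        (subst (λ a → fits (lbl j) (Vec.head (rt a)) ≡ true) (sym (initial-cell u (toℕ j))) (encode x u f r u≤ j))
    satisfied propagate (i , j) (i′ , j′) holds with ∧-true {does (toℕ i ℕₚ.≟ 0)} holds
    ... | i≡0 , rest with ∧-true {does (i Finₚ.≟ i′)} rest
    ... | i≡i′ , j′≡ with does-true {P? = i Finₚ.≟ i′} i≡i′
    ... | refl = subst (λ n → body propagate (cell (C n) (toℕ j)) (cell (C n) (toℕ j′)) ≡ true) (sym (does-true {P? = toℕ i ℕₚ.≟ 0} i≡0))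
      (subst₂ (λ a b → body propagate a b ≡ true) (sym (initial-cell u (toℕ j))) (sym (initial-cell u (toℕ j′)))
        (imply-blank _ _ (λ eq → trans (cong (nth (word x u)) (does-true {P? = toℕ j′ ℕₚ.≟ suc (toℕ j)} j′≡)) (bits-propagate
              (pair x u) (toℕ j) eq))))
    satisfied control (i , j) (i′ , j′) holds = subst (λ n → body control (cell (C (toℕ i)) (toℕ j)) (cell (C n) (toℕ j′)) ≡ true)
      (sym (does-true {P? = toℕ i′ ℕₚ.≟ suc (toℕ i)} holds)) (dec-true (proj₁ (C (suc (toℕ i))) Finₚ.≟ proj₁ (C (suc (toℕ i)))) refl)
    satisfied same (i , j) (i′ , j′) holds = subst₂ (λ n m → body same (cell (C (toℕ i)) (toℕ j)) (cell (C n) m) ≡ true)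
      (sym (does-true {P? = toℕ i′ ℕₚ.≟ suc (toℕ i)} (proj₁ (∧-true holds)))) (cong toℕ (does-true {P? = j Finₚ.≟ j′} (proj₂
            (∧-true holds))))
      (tapewise-intro same-tape (C (toℕ i)) (toℕ j) (toℕ j) (same-ok (toℕ j)))
    satisfied up (i , j) (i′ , j′) holds = subst₂ (λ n m → body up (cell (C (toℕ i)) (toℕ j)) (cell (C n) m) ≡ true)
      (sym (does-true {P? = toℕ i′ ℕₚ.≟ suc (toℕ i)} (proj₁ (∧-true holds)))) (sym (does-true {P? = toℕ j′ ℕₚ.≟ suc (toℕ j)}
            (proj₂ (∧-true holds))))
      (tapewise-intro up-tape (C (toℕ i)) (toℕ j) (suc (toℕ j)) (up-ok (toℕ j)))
    satisfied down (i , j) (i′ , j′) holds = subst₂ (λ n m → body down (cell (C (toℕ i)) m) (cell (C n) (toℕ j′)) ≡ true)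
      (sym (does-true {P? = toℕ i′ ℕₚ.≟ suc (toℕ i)} (proj₁ (∧-true holds)))) (sym (does-true {P? = toℕ j ℕₚ.≟ suc (toℕ j′)}
            (proj₂ (∧-true holds))))
      (tapewise-intro down-tape (C (toℕ i)) (suc (toℕ j′)) (toℕ j′) (down-ok (toℕ j′)))
    satisfied edge (i , j) (i′ , j′) holds with ∧-true {does (toℕ i′ ℕₚ.≟ suc (toℕ i))} holds
    ... | i′≡ , rest with ∧-true {does (j Finₚ.≟ j′)} rest
    ... | j≡j′ , j≡0 with does-true {P? = j Finₚ.≟ j′} j≡j′
    ... | refl = subst₂ (λ n m → body edge (cell (C (toℕ i)) m) (cell (C n) m) ≡ true)
      (sym (does-true {P? = toℕ i′ ℕₚ.≟ suc (toℕ i)} i′≡)) (sym (does-true {P? = toℕ j ℕₚ.≟ 0} j≡0))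
      (tapewise-intro edge-tape (C (toℕ i)) 0 0 edge-ok)
    satisfied accept (i , j) _ holds = subst (λ n → body accept (cell (C n) (toℕ j)) d₀ ≡ true) (sym (cong (_∸ 1)
          (does-true {P? = suc (toℕ i) ℕₚ.≟ N} holds)))
      (cong₂ _∧_ (halted-cell (C (N ∸ 1)) (toℕ j) (proj₂ final)) (dec-true (_ ≟ˢ _) (proj₁ final)))

-- Programming Turing machines

module Programs (g E : ℕ) where

  Sym : Set
  Sym = Symbol g

  Heads Acts Tapes : Set
  Heads = Vec Sym (suc E)
  Acts  = Vec (Sym × Move) (suc E)
  Tapes = Vec (Tape g) (suc E)

  heads : Tapes → Heads
  heads = Vec.map Tape.head

  apply : Tapes → Acts → Tapes
  apply = Vec.zipWith writeMove

  idle : Heads → Acts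
  idle = Vec.map (_, stay)

  data Prog : Set where
    act   : (Heads → Acts) → Prog
    _▹_   : Prog → Prog → Prog
    ite   : (Heads → Bool) → Prog → Prog → Prog
    while : (Heads → Bool) → Prog → Prog

  infixr 4 _▹_

  -- Every test takes a step of its own, in which the machine changes its state and leaves the tapes
  -- as they are.
  data Exec : Prog → Tapes → Tapes → ℕ → Set where
    act        : ∀ {a τs} → Exec (act a) τs (apply τs (a (heads τs))) 1
    seq        : ∀ {p q τs τs′ τs″ m n} → Exec p τs τs′ m → Exec q τs′ τs″ n → Exec (p ▹ q) τs τs″ (m + n)
    ite-true   : ∀ {b p q τs τs′ n} → b (heads τs) ≡ true → Exec p τs τs′ n → Exec (ite b p q) τs τs′ (suc n)
    ite-false  : ∀ {b p q τs τs′ n} → b (heads τs) ≡ false → Exec q τs τs′ n → Exec (ite b p q) τs τs′ (suc n)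
    while-done : ∀ {b p τs} → b (heads τs) ≡ false → Exec (while b p) τs τs 1
    while-step : ∀ {b p τs τs′ τs″ m n} → b (heads τs) ≡ true → Exec p τs τs′ m → Exec (while b p) τs′ τs″ n →
                 Exec (while b p) τs τs″ (suc (m + n))

  St : Prog → Set
  St (act a)     = ⊤
  St (p ▹ q)     = St p ⊎ St q
  St (ite b p q) = ⊤ ⊎ (St p ⊎ St q)
  St (while b p) = ⊤ ⊎ St p

  entry : ∀ p → St p
  entry (act a)     = tt
  entry (p ▹ q)     = inj₁ (entry p)
  entry (ite b p q) = inj₁ tt
  entry (while b p) = inj₁ tt

  leaveTo : ∀ {A B : Set} → (A → B) → Maybe B → Maybe A → Maybe B
  leaveTo φ e (just s) = just (φ s)
  leaveTo φ e nothing  = e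

  redirect : ∀ {A B : Set} → (A → B) → Maybe B → Maybe A × Acts → Maybe B × Acts
  redirect φ e (s , a) = leaveTo φ e s , a

  -- The successor `nothing` means that `p` is left; an enclosing program redirects this exit to the
  -- entry of what comes next.
  trans-fn : ∀ p → St p → Heads → Maybe (St p) × Acts
  trans-fn (act a)     _               h = nothing , a h
  trans-fn (p ▹ q)     (inj₁ s)        h = redirect inj₁ (just (inj₂ (entry q))) (trans-fn p s h)
  trans-fn (p ▹ q)     (inj₂ s)        h = redirect inj₂ nothing (trans-fn q s h)
  trans-fn (ite b p q) (inj₁ _)        h = just (inj₂ (if b h then inj₁ (entry p) else inj₂ (entry q))) , idle h
  trans-fn (ite b p q) (inj₂ (inj₁ s)) h = redirect (inj₂ ∘ inj₁) nothing (trans-fn p s h)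
  trans-fn (ite b p q) (inj₂ (inj₂ s)) h = redirect (inj₂ ∘ inj₂) nothing (trans-fn q s h)
  trans-fn (while b p) (inj₁ _)        h = (if b h then just (inj₂ (entry p)) else nothing) , idle h
  trans-fn (while b p) (inj₂ s)        h = redirect inj₂ (just (inj₁ tt)) (trans-fn p s h)

  data Steps (p : Prog) : Maybe (St p) → Tapes → Maybe (St p) → Tapes → ℕ → Set where
    done : ∀ {s τs} → Steps p s τs s τs 0
    more : ∀ {s τs s₁ a s′ τs′ n} → trans-fn p s (heads τs) ≡ (s₁ , a) → Steps p s₁ (apply τs a) s′ τs′ n → Steps p
          (just s) τs s′ τs′ (suc n)

  _⊕_ : ∀ {p s τs s′ τs′ s″ τs″ m n} → Steps p s τs s′ τs′ m → Steps p s′ τs′ s″ τs″ n → Steps p s τs s″ τs″ (m + n)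
  done      ⊕ ys = ys
  more eq xs ⊕ ys = more eq (xs ⊕ ys)

  lift : ∀ {p P} (φ : St p → St P) e → (∀ s h → trans-fn P (φ s) h ≡ redirect φ e (trans-fn p s h)) →
    ∀ {s τs s′ τs′ n} → Steps p s τs s′ τs′ n → Steps P (leaveTo φ e s) τs (leaveTo φ e s′) τs′ n
  lift φ e compat done = done
  lift φ e compat (more {s} {τs} eq xs) = more (trans (compat s (heads τs)) (cong (redirect φ e) eq)) (lift φ e compat xs)

  idle-step : ∀ {p s τs s₁ s′ τs′ n} → trans-fn p s (heads τs) ≡ (s₁ , idle (heads τs)) → Steps p s₁ τs s′ τs′ n → Steps p
        (just s) τs s′ τs′ (suc n)
  idle-step {τs = τs} eq xs = more eq (subst (λ τs → Steps _ _ τs _ _ _) (sym (apply-stay τs)) xs)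

  simulate : ∀ {p τs τs′ n} → Exec p τs τs′ n → Steps p (just (entry p)) τs nothing τs′ n
  simulate act = more refl done
  simulate (seq x y) = lift inj₁ _ (λ _ _ → refl) (simulate x) ⊕ lift inj₂ nothing (λ _ _ → refl) (simulate y)
  simulate {ite b p q} {τs} (ite-true eq x) =
    idle-step (cong (λ b → just (inj₂ (if b then inj₁ (entry p) else inj₂ (entry q))) , idle (heads τs)) eq) (lift
          (inj₂ ∘ inj₁) nothing (λ _ _ → refl) (simulate x))
  simulate {ite b p q} {τs} (ite-false eq x) =
    idle-step (cong (λ b → just (inj₂ (if b then inj₁ (entry p) else inj₂ (entry q))) , idle (heads τs)) eq) (lift
          (inj₂ ∘ inj₂) nothing (λ _ _ → refl) (simulate x))
  simulate {while b p} {τs} (while-done eq) =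
    idle-step (cong (λ b → (if b then just (inj₂ (entry p)) else nothing) , idle (heads τs)) eq) done
  simulate {while b p} {τs} (while-step eq x y) =
    idle-step (cong (λ b → (if b then just (inj₂ (entry p)) else nothing) , idle (heads τs)) eq) (lift inj₂ (just (inj₁ tt))
          (λ _ _ → refl) (simulate x) ⊕ simulate y)

  size : Prog → ℕ
  size (act a)     = 1
  size (p ▹ q)     = size p + size q
  size (ite b p q) = 1 + (size p + size q)
  size (while b p) = 1 + size p

  encodeSt : ∀ p → St p → Fin (size p)
  encodeSt (act a)     _               = zero
  encodeSt (p ▹ q)     (inj₁ s)        = encodeSt p s Fin.↑ˡ size q
  encodeSt (p ▹ q)     (inj₂ s)        = size p Fin.↑ʳ encodeSt q s
  encodeSt (ite b p q) (inj₁ _)        = zero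
  encodeSt (ite b p q) (inj₂ (inj₁ s)) = suc (encodeSt p s Fin.↑ˡ size q)
  encodeSt (ite b p q) (inj₂ (inj₂ s)) = suc (size p Fin.↑ʳ encodeSt q s)
  encodeSt (while b p) (inj₁ _)        = zero
  encodeSt (while b p) (inj₂ s)        = suc (encodeSt p s)

  decodeSt  : ∀ p → Fin (size p) → St p
  decodeSum : ∀ p q → Fin (size p) ⊎ Fin (size q) → St p ⊎ St q
  decodeSt (act a)     _       = tt
  decodeSt (p ▹ q)     i       = decodeSum p q (Fin.splitAt (size p) i)
  decodeSt (ite b p q) zero    = inj₁ tt
  decodeSt (ite b p q) (suc i) = inj₂ (decodeSum p q (Fin.splitAt (size p) i))
  decodeSt (while b p) zero    = inj₁ tt
  decodeSt (while b p) (suc i) = inj₂ (decodeSt p i)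
  decodeSum p q (inj₁ i) = inj₁ (decodeSt p i)
  decodeSum p q (inj₂ i) = inj₂ (decodeSt q i)

  decode-encode : ∀ p s → decodeSt p (encodeSt p s) ≡ s
  decode-encode (act a)     _        = refl
  decode-encode (p ▹ q)     (inj₁ s) = trans (cong (decodeSum p q) (Finₚ.splitAt-↑ˡ (size p) (encodeSt p s) (size q)))
        (cong inj₁ (decode-encode p s))
  decode-encode (p ▹ q)     (inj₂ s) = trans (cong (decodeSum p q) (Finₚ.splitAt-↑ʳ (size p) (size q) (encodeSt q s)))
        (cong inj₂ (decode-encode q s))
  decode-encode (ite b p q) (inj₁ _) = refl
  decode-encode (ite b p q) (inj₂ (inj₁ s)) = cong inj₂ (decode-encode (p ▹ q) (inj₁ s))
  decode-encode (ite b p q) (inj₂ (inj₂ s)) = cong inj₂ (decode-encode (p ▹ q) (inj₂ s))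
  decode-encode (while b p) (inj₁ _) = refl
  decode-encode (while b p) (inj₂ s) = cong inj₂ (decode-encode p s)

  module _ (p : Prog) where

    code : Maybe (St p) → Fin (suc (size p))
    code nothing  = zero
    code (just s) = suc (encodeSt p s)

    machine : TM
    machine = record
      { extra = E ; symbols = g ; states = suc (size p) ; start = code (just (entry p))
      ; δ = λ { zero h → nothing ; (suc i) h → let (s , a) = trans-fn p (decodeSt p i) h in just (code s , a) } }

    step-machine : ∀ {s τs s₁ a} → trans-fn p s (heads τs) ≡ (s₁ , a) → step machine (code (just s) , τs) ≡ just (code s₁ , apply τs a)
    step-machine {s} {τs} eq = cong (λ r → just (code (proj₁ r) , apply τs (proj₂ r))) (trans (cong (λ s → trans-fn p s
          (heads τs)) (decode-encode p s)) eq)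

    run-step : ∀ {c c′} n → step machine c ≡ just c′ → run machine (suc n) c ≡ run machine n c′
    run-step {c} n eq with step machine c
    run-step n refl | just _ = refl

    run-halted : ∀ n τs → run machine n (zero , τs) ≡ just (zero , τs)
    run-halted zero    τs = refl
    run-halted (suc n) τs = refl

    run-steps : ∀ {s τs τs′ n} → Steps p s τs nothing τs′ n → ∀ m → run machine (n + m) (code s , τs) ≡ just (zero , τs′)
    run-steps done m = run-halted m _
    run-steps (more {n = n} eq xs) m = trans (run-step (n + m) (step-machine eq)) (run-steps xs m)

    run-exec : ∀ {τs τs′ n b} → Exec p τs τs′ n → n ≤ b → run machine b (TM.start machine , τs) ≡ just (zero , τs′)
    run-exec {τs} {τs′} {n} {b} x n≤b = subst (λ b → run machine b (TM.start machine , τs) ≡ just (zero , τs′))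
          (m+[n∸m]≡n n≤b) (run-steps (simulate x) (b ∸ n))

-- Loops and counters on tapes

data Role : Set where
  io        : Role
  depth ctr : ℕ → Role

_≟ᴿ_ : DecidableEquality Role
io      ≟ᴿ io      = yes refl
io      ≟ᴿ depth _ = no λ ()
io      ≟ᴿ ctr _   = no λ ()
depth _ ≟ᴿ io      = no λ ()
depth i ≟ᴿ depth j with i ℕₚ.≟ j
... | yes refl = yes refl
... | no  ne   = no λ { refl → ne refl }
depth _ ≟ᴿ ctr _   = no λ ()
ctr _   ≟ᴿ io      = no λ ()
ctr _   ≟ᴿ depth _ = no λ ()
ctr i   ≟ᴿ ctr j   with i ℕₚ.≟ j
... | yes refl = yes refl
... | no  ne   = no λ { refl → ne refl }

-- One tape for input and output, G tapes for the loops that generate the labels,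
-- and C counters.
module Layout (G C : ℕ) where

  open Programs 8 (G + C) public

  pattern startˢ = work zero
  pattern endˢ   = work (suc zero)

  labˢ : Label → Sym
  labˢ marker        = work (suc (suc zero))
  labˢ (input true)  = work (suc (suc (suc zero)))
  labˢ (input false) = work (suc (suc (suc (suc zero))))
  labˢ separator     = work (suc (suc (suc (suc (suc zero)))))
  labˢ free          = work (suc (suc (suc (suc (suc (suc zero))))))
  labˢ padding       = work (suc (suc (suc (suc (suc (suc (suc zero)))))))

  labelOf : Sym → Label
  labelOf (work (suc (suc zero)))                         = marker
  labelOf (work (suc (suc (suc zero))))                   = input true
  labelOf (work (suc (suc (suc (suc zero)))))             = input false
  labelOf (work (suc (suc (suc (suc (suc zero))))))       = separator
  labelOf (work (suc (suc (suc (suc (suc (suc zero))))))) = free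
  labelOf _                                               = padding

  labelOf-labˢ : ∀ ℓ → labelOf (labˢ ℓ) ≡ ℓ
  labelOf-labˢ marker        = refl
  labelOf-labˢ (input true)  = refl
  labelOf-labˢ (input false) = refl
  labelOf-labˢ separator     = refl
  labelOf-labˢ free          = refl
  labelOf-labˢ padding       = refl

  isStart isEnd isBit : Sym → Bool
  isStart startˢ = true
  isStart _      = false
  isEnd endˢ     = true
  isEnd _        = false
  isBit (bit _)  = true
  isBit _        = false

  Plain : Sym → Set
  Plain s = isStart s ≡ false × isEnd s ≡ false

  plain-lab : ∀ ℓ → Plain (labˢ ℓ)
  plain-lab marker        = refl , refl
  plain-lab (input true)  = refl , refl
  plain-lab (input false) = refl , refl
  plain-lab separator     = refl , refl
  plain-lab free          = refl , refl
  plain-lab padding       = refl , refl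

  idx : Role → ℕ
  idx io        = 0
  idx (depth i) = suc i
  idx (ctr c)   = suc (G + c)

  role : ℕ → Role
  role zero    = io
  role (suc n) with n <? G
  ... | yes _ = depth n
  ... | no  _ = ctr (n ∸ G)

  Allocated : Role → Set
  Allocated io        = ⊤
  Allocated (depth i) = i < G
  Allocated (ctr c)   = c < C

  role-idx : ∀ r → Allocated r → role (idx r) ≡ r
  role-idx io        _  = refl
  role-idx (depth i) lt with i <? G
  ... | yes _ = refl
  ... | no ≮  = ⊥-elim (≮ lt)
  role-idx (ctr c)   lt with G + c <? G
  ... | yes lt′ = ⊥-elim (<-irrefl refl (≤-<-trans (m≤m+n G c) lt′))
  ... | no  _   = cong ctr (m+n∸m≡n G c)

  idx< : ∀ r → Allocated r → idx r < suc (G + C)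
  idx< io        _  = s≤s z≤n
  idx< (depth i) lt = s≤s (≤-trans lt (m≤m+n G C))
  idx< (ctr c)   lt = s≤s (+-monoʳ-< G lt)

  State : Set
  State = Role → Tape 8

  vec : State → Tapes
  vec S = Vec.tabulate (λ i → S (role (toℕ i)))

  lookup-vec : ∀ S i → lookup (vec S) i ≡ S (role (toℕ i))
  lookup-vec S i = Vecₚ.lookup∘tabulate (λ i → S (role (toℕ i))) i

  look : ∀ {n} → Vec Sym n → ℕ → Sym
  look []      _       = blank
  look (s ∷ h) zero    = s
  look (s ∷ h) (suc n) = look h n

  look-toℕ : ∀ {n} (h : Vec Sym n) i → look h (toℕ i) ≡ lookup h i
  look-toℕ (s ∷ h) zero    = refl
  look-toℕ (s ∷ h) (suc i) = look-toℕ h i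

  look-vec : ∀ S r → Allocated r → look (heads (vec S)) (idx r) ≡ Tape.head (S r)
  look-vec S r ok = trans (cong (look (heads (vec S))) (sym (Finₚ.toℕ-fromℕ< (idx< r ok)))) (trans (look-toℕ (heads (vec S)) i)
    (trans (Vecₚ.lookup-map i Tape.head (vec S)) (cong Tape.head (trans (lookup-vec S i)
      (cong S (trans (cong role (Finₚ.toℕ-fromℕ< (idx< r ok))) (role-idx r ok)))))))
    where i = Fin.fromℕ< (idx< r ok)

  data Instr : Set where
    keep : Move → Instr
    put  : Sym → Move → Instr

  instruct : Instr → Sym → Sym × Move
  instruct (keep m)  s = s , m
  instruct (put s m) _ = s , m

  perform : Instr → Tape 8 → Tape 8
  perform i τ = writeMove τ (instruct i (Tape.head τ))

  instructs : (Role → Instr) → Heads → Acts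
  instructs a h = Vec.tabulate (λ i → instruct (a (role (toℕ i))) (look h (toℕ i)))

  actⁱ : (Role → Instr) → Prog
  actⁱ a = act (instructs a)

  infix 3 _∶_⇝_within_
  record _∶_⇝_within_ (P : Prog) (S S′ : State) (b : ℕ) : Set where
    constructor runs
    field
      {steps} : ℕ
      exec    : Exec P (vec S) (vec S′) steps
      bounded : steps ≤ b

  run-resp : ∀ {P S S₁ S′ S₁′ b} → (∀ r → S r ≡ S₁ r) → (∀ r → S′ r ≡ S₁′ r) → P ∶ S ⇝ S′ within b → P ∶ S₁ ⇝ S₁′ within b
  run-resp {P} eq eq′ (runs {n} x n≤) = runs (subst₂ (λ τs τs′ → Exec P τs τs′ n) (Vecₚ.tabulate-cong (λ i → eq (role
        (toℕ i)))) (Vecₚ.tabulate-cong (λ i → eq′ (role (toℕ i)))) x) n≤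

  weaken : ∀ {P S S′ b b′} → b ≤ b′ → P ∶ S ⇝ S′ within b → P ∶ S ⇝ S′ within b′
  weaken b≤ (runs x n≤) = runs x (≤-trans n≤ b≤)

  run-act : ∀ {a S S′} → (∀ r → perform (a r) (S r) ≡ S′ r) → actⁱ a ∶ S ⇝ S′ within 1
  run-act {a} {S} {S′} eq = runs (subst (λ τs → Exec (actⁱ a) (vec S) τs 1) (vec-ext performed) act) ≤-refl
    where
    instructed : ∀ i → lookup (instructs a (heads (vec S))) i ≡ instruct (a (role (toℕ i))) (Tape.head (S (role (toℕ i))))
    instructed i = trans (Vecₚ.lookup∘tabulate (λ i → instruct (a (role (toℕ i))) (look (heads (vec S)) (toℕ i))) i)
      (cong (instruct (a (role (toℕ i)))) (trans (look-toℕ (heads (vec S)) i)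
        (trans (Vecₚ.lookup-map i Tape.head (vec S)) (cong Tape.head (lookup-vec S i)))))

    performed : ∀ i → lookup (apply (vec S) (instructs a (heads (vec S)))) i ≡ lookup (vec S′) i
    performed i = trans (Vecₚ.lookup-zipWith writeMove i (vec S) (instructs a (heads (vec S))))
      (trans (cong₂ writeMove (lookup-vec S i) (instructed i)) (trans (eq (role (toℕ i))) (sym (lookup-vec S′ i))))

  run-seq : ∀ {p q S S′ S″ a b} → p ∶ S ⇝ S′ within a → q ∶ S′ ⇝ S″ within b → p ▹ q ∶ S ⇝ S″ within (a + b)
  run-seq (runs x x≤) (runs y y≤) = runs (seq x y) (+-mono-≤ x≤ y≤)

  Test : Set
  Test = Heads → Bool

  on : Role → (Sym → Bool) → Test
  on r φ h = φ (look h (idx r))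

  both : Test → Test → Test
  both t u h = t h ∧ u h

  on-vec : ∀ S r φ → Allocated r → on r φ (heads (vec S)) ≡ φ (Tape.head (S r))
  on-vec S r φ ok = cong φ (look-vec S r ok)

  run-ite : ∀ {t p q S S′ b n} → t (heads (vec S)) ≡ b → (if b then p else q) ∶ S ⇝ S′ within n → ite t p q ∶ S ⇝ S′ within (suc n)
  run-ite {b = true}  eq (runs x x≤) = runs (ite-true eq x) (s≤s x≤)
  run-ite {b = false} eq (runs x x≤) = runs (ite-false eq x) (s≤s x≤)

  run-while : ∀ {t p} (σ : ℕ → State) len b → (∀ k → k < len → t (heads (vec (σ k))) ≡ true) → t (heads (vec (σ len))) ≡ false →
    (∀ k → k < len → p ∶ σ k ⇝ σ (suc k) within b) → while t p ∶ σ 0 ⇝ σ len within (len * suc b + 1)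
  run-while σ zero      b go stop body = runs (while-done stop) ≤-refl
  run-while σ (suc len) b go stop body with body 0 (s≤s z≤n) | run-while (σ ∘ suc) len b (λ k lt → go (suc k) (s≤s lt)) stop
        (λ k lt → body (suc k) (s≤s lt))
  ... | runs x x≤ | runs y y≤ = runs (while-step (go 0 (s≤s z≤n)) x y)
    (s≤s (≤-trans (+-mono-≤ x≤ y≤) (≤-reflexive (sym (+-assoc b (len * suc b) 1)))))

  zipper : List Sym → List Sym → Tape 8
  zipper bs []       = tape bs blank []
  zipper bs (s ∷ ss) = tape bs s ss

  at : List Sym → List Sym → ℕ → Tape 8
  at bs ss       zero    = zipper bs ss
  at bs []       (suc i) = zipper bs []
  at bs (s ∷ ss) (suc i) = at (s ∷ bs) ss i

  at-right : ∀ bs ss i → i < length ss → moveHead right (at bs ss i) ≡ at bs ss (suc i)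
  at-right bs (s ∷ [])      zero    _        = refl
  at-right bs (s ∷ s′ ∷ ss) zero    _        = refl
  at-right bs (s ∷ ss)      (suc i) (s≤s lt) = at-right (s ∷ bs) ss i lt

  at-left : ∀ bs ss i → suc i < length ss → moveHead left (at bs ss (suc i)) ≡ at bs ss i
  at-left bs (s ∷ s′ ∷ ss) zero    _        = refl
  at-left bs (s ∷ ss)      (suc i) (s≤s lt) = at-left (s ∷ bs) ss i lt

  -- A counter is the head position on such a tape: the value i of a variable is
  -- position 1 + i, and an idle counter rests on the start mark.
  content : List Sym → List Sym
  content ms = startˢ ∷ ms ++ [ endˢ ]

  counter : List Sym → ℕ → Tape 8
  counter ms = at [] (content ms)

  length-content : ∀ ms → length (content ms) ≡ suc (suc (length ms))
  length-content ms = cong suc (trans (Listₚ.length-++ ms) (+-comm (length ms) 1))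

  counter-right : ∀ ms {i} → i ≤ length ms → moveHead right (counter ms i) ≡ counter ms (suc i)
  counter-right ms {i} i≤ = at-right [] (content ms) i (≤-trans (s≤s (m≤n⇒m≤1+n i≤)) (≤-reflexive (sym (length-content ms))))

  counter-left : ∀ ms {i} → i ≤ length ms → moveHead left (counter ms (suc i)) ≡ counter ms i
  counter-left ms {i} i≤ = at-left [] (content ms) i (≤-trans (s≤s (s≤s i≤)) (≤-reflexive (sym (length-content ms))))

  head-inner : ∀ bs ms (i : Fin (length ms)) → Tape.head (at bs (ms ++ [ endˢ ]) (toℕ i)) ≡ List.lookup ms i
  head-inner bs (s ∷ ms) zero    = refl
  head-inner bs (s ∷ ms) (suc i) = head-inner (s ∷ bs) ms i

  head-last : ∀ bs ms → Tape.head (at bs (ms ++ [ endˢ ]) (length ms)) ≡ endˢ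
  head-last bs []       = refl
  head-last bs (s ∷ ms) = head-last (s ∷ bs) ms

  plain-inner : ∀ {ms} → All Plain ms → ∀ k → k < length ms → Plain (Tape.head (counter ms (suc k)))
  plain-inner {ms} ps k lt = subst Plain (trans (sym (head-inner [ startˢ ] ms (Fin.fromℕ< lt))) (cong (λ k → Tape.head
        (counter ms (suc k))) (Finₚ.toℕ-fromℕ< lt)))
    (All.lookup ps (∈ₚ.∈-lookup (Fin.fromℕ< lt)))

  at-end : ∀ ms → Tape.head (counter ms (suc (length ms))) ≡ endˢ
  at-end ms = head-last [ startˢ ] ms

  not-start : ∀ {ms} → All Plain ms → ∀ k → k ≤ length ms → isStart (Tape.head (counter ms (suc k))) ≡ false
  not-start {ms} ps k k≤ with k ℕₚ.≟ length ms
  ... | yes refl = cong isStart (at-end ms)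
  ... | no  ne   = proj₁ (plain-inner ps k (≤∧≢⇒< k≤ ne))

  rewind-cost : ℕ → ℕ
  rewind-cost len = suc len * 2 + 1

  -- The family `S` is arbitrary because the same scan serves a single tape inside `update` and all
  -- counters or all depth tapes moving in parallel.
  run-rewind : ∀ {ms} → All Plain ms → ∀ r → Allocated r → (S : Tape 8 → State) → (∀ τ → S τ r ≡ τ) → ∀ back →
    (∀ τ → back ∶ S τ ⇝ S (moveHead left τ) within 1) →
    while (on r (not ∘ isStart)) back ∶ S (counter ms (suc (length ms))) ⇝ S (counter ms 0) within rewind-cost (length ms)
  run-rewind {ms} plain r ok S S-r back run-back = subst (λ p → while (on r (not ∘ isStart)) back ∶ S (counter ms
        (suc len)) ⇝ S (counter ms p) within rewind-cost len) (n∸n≡0 len)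
    (run-while (λ k → S (counter ms (suc len ∸ k))) (suc len) 1
      (λ { k (s≤s k≤) → trans (scan k) (trans (cong (not ∘ isStart ∘ Tape.head ∘ counter ms) (+-∸-assoc 1 k≤)) (cong not
            (not-start plain (len ∸ k) (m∸n≤m len k)))) })
      (trans (scan (suc len)) (cong (not ∘ isStart ∘ Tape.head ∘ counter ms) (n∸n≡0 len)))
      (λ { k (s≤s k≤) → subst (λ p → back ∶ S (counter ms p) ⇝ S (counter ms (len ∸ k)) within 1) (sym (+-∸-assoc 1 k≤))
        (subst (λ τ → back ∶ S (counter ms (suc (len ∸ k))) ⇝ S τ within 1) (counter-left ms (m∸n≤m len k)) (run-back
              (counter ms (suc (len ∸ k))))) }))
    where
    len = length ms
    scan : ∀ k → on r (not ∘ isStart) (heads (vec (S (counter ms (suc len ∸ k))))) ≡ not (isStart (Tape.head (counter ms (suc len ∸ k))))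
    scan k = trans (on-vec (S (counter ms (suc len ∸ k))) r (not ∘ isStart) ok) (cong (not ∘ isStart ∘ Tape.head) (S-r _))

  update : State → Role → Tape 8 → State
  update S r τ r′ with r′ ≟ᴿ r
  ... | yes _ = τ
  ... | no  _ = S r′

  update-≡ : ∀ S r τ → update S r τ r ≡ τ
  update-≡ S r τ with r ≟ᴿ r
  ... | yes _ = refl
  ... | no ne = ⊥-elim (ne refl)

  only : Role → Instr → Role → Instr
  only r i r′ with r′ ≟ᴿ r
  ... | yes _ = i
  ... | no  _ = keep stay

  move : Role → Move → Prog
  move r m = actⁱ (only r (keep m))

  run-move : ∀ {S r τ τ′} m → moveHead m τ ≡ τ′ → move r m ∶ update S r τ ⇝ update S r τ′ within 1
  run-move {S} {r} {τ} m refl = run-act {only r (keep m)} {update S r τ} λ r′ → go r′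
    where
    go : ∀ r′ → perform (only r (keep m) r′) (update S r τ r′) ≡ update S r (moveHead m τ) r′
    go r′ with r′ ≟ᴿ r
    ... | yes _ = refl
    ... | no  _ = refl

  loop : Role → Prog → Prog
  loop r body = move r right ▹ while (on r (not ∘ isEnd)) (body ▹ move r right) ▹ while (on r (not ∘ isStart)) (move r left)

  loop-cost : ℕ → ℕ → ℕ
  loop-cost len b = 1 + ((len * suc (b + 1) + 1) + rewind-cost len)

  run-loop : ∀ {r body ms} → Allocated r → All Plain ms → (σ : ℕ → State) → ∀ b →
    (∀ k → k < length ms → body ∶ update (σ k) r (counter ms (suc k)) ⇝ update (σ (suc k)) r (counter ms (suc k)) within b) →
    loop r body ∶ update (σ 0) r (counter ms 0) ⇝ update (σ (length ms)) r (counter ms 0) within loop-cost (length ms) b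
  run-loop {r} {body} {ms} ok ps σ b step-body = run-seq (run-move right (counter-right ms z≤n)) (run-seq forward backward)
    where
    len = length ms

    forward = run-while (λ k → update (σ k) r (counter ms (suc k))) (length ms) (b + 1)
      (λ k lt → trans (on-vec (update (σ k) r (counter ms (suc k))) r (not ∘ isEnd) ok) (trans (cong
            (not ∘ isEnd ∘ Tape.head) (update-≡ (σ k) r _)) (cong not (proj₂ (plain-inner ps k lt)))))
      (trans (on-vec (update (σ len) r (counter ms (suc len))) r (not ∘ isEnd) ok) (trans (cong (not ∘ isEnd ∘ Tape.head)
            (update-≡ (σ (length ms)) r _)) (cong (not ∘ isEnd) (at-end ms))))
      (λ k lt → run-seq (step-body k lt) (run-move right (counter-right ms lt)))

    backward : while (on r (not ∘ isStart)) (move r left) ∶ update (σ len) r (counter ms (suc len)) ⇝ update (σ len) r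
          (counter ms 0) within rewind-cost len
    backward = run-rewind ps r ok (update (σ len) r) (λ _ → update-≡ (σ len) r _) (move r left) (λ _ → run-move left refl)

levels : ∀ {n} → Emitter n → ℕ
levels skip         = 0
levels (emit b)     = 0
levels (e ⨾ e′)     = levels e ⊔ levels e′
levels (for e)      = suc (levels e)
levels (ifᵉ b e e′) = levels e ⊔ levels e′

min-zero : ∀ a b → isZero (a ∸ (a ⊓ b)) ∧ isZero (b ∸ (a ⊓ b)) ≡ does (a ℕₚ.≟ b)
min-zero zero    zero    = refl
min-zero zero    (suc b) = refl
min-zero (suc a) zero    = refl
min-zero (suc a) (suc b) = min-zero a b

min-stop : ∀ a b → not (isZero (a ∸ (a ⊓ b))) ∧ not (isZero (b ∸ (a ⊓ b))) ≡ false
min-stop zero    zero    = refl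
min-stop zero    (suc b) = refl
min-stop (suc a) zero    = refl
min-stop (suc a) (suc b) = min-stop a b

min-go : ∀ k a b → k < a ⊓ b → not (isZero (a ∸ k)) ∧ not (isZero (b ∸ k)) ≡ true
min-go zero    (suc a) (suc b) _        = refl
min-go (suc k) (suc a) (suc b) (s≤s lt) = min-go k a b lt

∸-step : ∀ {k a} → k < a → a ∸ k ≡ suc (a ∸ suc k)
∸-step {zero}  {suc a} _        = refl
∸-step {suc k} {suc a} (s≤s lt) = ∸-step lt

prefix : ∀ {A : Set} → (ℕ → List A) → ℕ → List A
prefix f zero    = []
prefix f (suc k) = prefix f k ++ f k

prefix-shift : ∀ {A : Set} (f : ℕ → List A) k → prefix f (suc k) ≡ f 0 ++ prefix (f ∘ suc) k
prefix-shift f zero    = sym (Listₚ.++-identityʳ (f 0))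
prefix-shift f (suc k) = trans (cong (_++ f (suc k)) (prefix-shift f k)) (Listₚ.++-assoc (f 0) (prefix (f ∘ suc) k) (f (suc k)))

prefix-allFin : ∀ {A : Set} {N} (f : ℕ → List A) (g : Fin N → List A) → (∀ i → f (toℕ i) ≡ g i) → prefix f N ≡ concatMap g (allFin N)
prefix-allFin {N = N} f g eq = trans (go N f g eq) (cong concat (sym (Listₚ.map-tabulate id g)))
  where
  go : ∀ N (f : ℕ → List _) (g : Fin N → List _) → (∀ i → f (toℕ i) ≡ g i) → prefix f N ≡ concat (List.tabulate g)
  go zero    f g eq = refl
  go (suc N) f g eq = trans (prefix-shift f N) (cong₂ _++_ (eq zero) (go N (f ∘ suc) (g ∘ suc) (eq ∘ suc)))

module Compile (G C : ℕ) where

  open Layout G C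

  setp : List (ℕ × ℕ) → (ℕ → ℕ) → ℕ → ℕ
  setp []            pos x = pos x
  setp ((y , p) ∷ l) pos x = if does (x ℕₚ.≟ y) then p else setp l pos x

  dirs : List (ℕ × Move) → ℕ → Move
  dirs []            x = stay
  dirs ((y , m) ∷ l) x = if does (x ℕₚ.≟ y) then m else dirs l x

  ctr-instr : List (ℕ × Move) → Role → Instr
  ctr-instr l (ctr c) = keep (dirs l c)
  ctr-instr l _       = keep stay

  ctrs : List (ℕ × Move) → Prog
  ctrs l = actⁱ (ctr-instr l)

  -- Equality of two counters: decrease both until one is empty, counting on counter 0.
  restore : ℕ → ℕ → Prog
  restore c c′ = while (on (ctr 0) (not ∘ isStart)) (ctrs ((0 , left) ∷ (c , right) ∷ (c′ , right) ∷ []))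

  if-equal : ℕ → ℕ → Prog → Prog → Prog
  if-equal c c′ p q =
    while (both (on (ctr c) (not ∘ isStart)) (on (ctr c′) (not ∘ isStart))) (ctrs ((0 , right) ∷ (c , left) ∷ (c′ , left) ∷ [])) ▹
    ite (both (on (ctr c) isStart) (on (ctr c′) isStart)) (restore c c′ ▹ p) (restore c c′ ▹ q)

  -- From de Bruijn indices to levels, so that a variable keeps its counter when further loops are
  -- entered. Counter 0 is left free for `if-equal`.
  ctrOf : ∀ {n} → Fin n → ℕ
  ctrOf {n} x = suc (n ∸ suc (toℕ x))

  -- In continuation form no truth value has to be stored. Equal variables share one counter and are
  -- treated apart, since the comparison in `Equal` is for two different counters.
  ifᵇ : ∀ {n} → BExp n → Prog → Prog → Prog
  ifᵇ (constᵉ true)  p q = p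
  ifᵇ (constᵉ false) p q = q
  ifᵇ (eqᵉ x y)    p q with x Finₚ.≟ y
  ... | yes _ = p
  ... | no  _ = if-equal (ctrOf x) (ctrOf y) p q
  ifᵇ (succᵉ x y)  p q with x Finₚ.≟ y
  ... | yes _ = q
  -- The counter of `y` is lowered for the comparison and raised again in both branches. Value zero
  -- goes to the start mark, a position that no value of `x` has.
  ... | no  _ = ctrs [ (ctrOf y , left) ] ▹ if-equal (ctrOf x) (ctrOf y) (ctrs [ (ctrOf y , right) ] ▹ p) (ctrs [ (ctrOf y , right) ] ▹ q)
  ifᵇ (zeroᵉ x)    p q = ctrs [ (ctrOf x , left) ] ▹ ite (on (ctr (ctrOf x)) isStart) (ctrs [ (ctrOf x , right) ] ▹ p)
        (ctrs [ (ctrOf x , right) ] ▹ q)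
  ifᵇ (lastᵉ x)    p q = ctrs [ (ctrOf x , right) ] ▹ ite (on (ctr (ctrOf x)) isEnd) (ctrs [ (ctrOf x , left) ] ▹ p) (ctrs [
        (ctrOf x , left) ] ▹ q)
  ifᵇ (labelᵉ f x) p q = ite (on (ctr (ctrOf x)) (f ∘ labelOf)) p q
  ifᵇ (e ∧ᵉ e′)    p q = ifᵇ e (ifᵇ e′ p q) q
  ifᵇ (¬ᵉ e)       p q = ifᵇ e q p

  compile : ∀ {n} → Emitter n → Prog
  compile skip             = actⁱ (λ _ → keep stay)
  compile (emit b)         = actⁱ (only io (put (bit b) right))
  compile (e ⨾ e′)         = compile e ▹ compile e′
  compile {n} (for e)      = loop (ctr (suc n)) (compile e)
  compile (ifᵉ b e e′)     = ifᵇ b (compile e) (compile e′)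

  equal-cost : ℕ → ℕ
  equal-cost N = (suc N * 2 + 1) + (1 + (suc N * 2 + 1))

  test-cost : ∀ {n} → ℕ → BExp n → ℕ
  test-cost N (constᵉ b)   = 0
  test-cost N (eqᵉ x y)    = equal-cost N
  test-cost N (succᵉ x y)  = 1 + (equal-cost N + 1)
  test-cost N (zeroᵉ x)    = 3
  test-cost N (lastᵉ x)    = 3
  test-cost N (labelᵉ f x) = 1
  test-cost N (e ∧ᵉ e′)    = test-cost N e + test-cost N e′
  test-cost N (¬ᵉ e)       = test-cost N e

  time : ∀ {n} → ℕ → Emitter n → ℕ
  time N skip         = 1
  time N (emit b)     = 1
  time N (e ⨾ e′)     = time N e + time N e′
  time N (for e)      = loop-cost N (time N e)
  time N (ifᵉ b e e′) = test-cost N b + (time N e + time N e′)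

  -- The emitted bits lie to the left of the head, nearest first, hence in reverse order.
  push : List Bool → List Sym → List Sym
  push []       B = B
  push (b ∷ bs) B = push bs (bit b ∷ B)

  push-++ : ∀ bs bs′ B → push (bs ++ bs′) B ≡ push bs′ (push bs B)
  push-++ []       bs′ B = refl
  push-++ (b ∷ bs) bs′ B = push-++ bs bs′ (bit b ∷ B)

  module Correct (labs : List Label) (dt : Tape 8) where

    N : ℕ
    N = length labs

    lbl : Fin N → Label
    lbl = List.lookup labs

    open Semantics lbl

    ms : List Sym
    ms = map labˢ labs

    length-ms : length ms ≡ N
    length-ms = Listₚ.length-map labˢ labs

    plain : All Plain ms
    plain = Allₚ.map⁺ (All.universal plain-lab labs)

    cnt : ℕ → Tape 8
    cnt = counter ms

    st : List Sym → (ℕ → ℕ) → State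
    st B pos io        = tape B blank []
    st B pos (depth _) = dt
    st B pos (ctr c)   = cnt (pos c)

    st-cong : ∀ {B pos pos′} → (∀ c → pos c ≡ pos′ c) → ∀ r → st B pos r ≡ st B pos′ r
    st-cong eq io        = refl
    st-cong eq (depth _) = refl
    st-cong eq (ctr c)   = cong cnt (eq c)

    data Moved : Move → ℕ → ℕ → Set where
      stays  : ∀ {p} → Moved stay p p
      rights : ∀ {p} → p ≤ N → Moved right p (suc p)
      lefts  : ∀ {p} → p ≤ N → Moved left (suc p) p

    moved-cnt : ∀ {m p p′} → Moved m p p′ → moveHead m (cnt p) ≡ cnt p′
    moved-cnt stays       = refl
    moved-cnt (rights p≤) = counter-right ms (≤-trans p≤ (≤-reflexive (sym length-ms)))
    moved-cnt (lefts p≤)  = counter-left ms (≤-trans p≤ (≤-reflexive (sym length-ms)))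

    Transit : Set
    Transit = ℕ × Move × ℕ × ℕ

    moves : Transit → ℕ × Move
    moves (y , m , _ , _) = y , m
    befores afters : Transit → ℕ × ℕ
    befores (y , _ , p , _) = y , p
    afters (y , _ , _ , p′) = y , p′

    run-ctrs : ∀ (l : List Transit) B pos → All (λ (_ , m , p , p′) → Moved m p p′) l →
      ctrs (map moves l) ∶ st B (setp (map befores l) pos) ⇝ st B (setp (map afters l) pos) within 1
    run-ctrs l B pos moved = run-act {ctr-instr (map moves l)} λ { io → refl ; (depth _) → refl ; (ctr c) → moved-cnt (go l moved c) }
      where
      go : ∀ l → All (λ (_ , m , p , p′) → Moved m p p′) l → ∀ x → Moved (dirs (map moves l) x) (setp (map befores l) pos x)
            (setp (map afters l) pos x)
      go []                 []        x = stays
      go ((y , m , p , p′) ∷ l) (mv ∷ mvs) x with does (x ℕₚ.≟ y)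
      ... | true  = mv
      ... | false = go l mvs x

    head-zero : ∀ p → p ≤ suc N → isStart (Tape.head (cnt p)) ≡ isZero p
    head-zero zero    _        = refl
    head-zero (suc p) (s≤s p≤) = not-start plain p (≤-trans p≤ (≤-reflexive (sym length-ms)))

    head-end : ∀ p → p ≤ N → isEnd (Tape.head (cnt (suc p))) ≡ does (p ℕₚ.≟ N)
    head-end p p≤ with p ℕₚ.≟ N
    ... | yes refl = trans (trans (cong (λ n → isEnd (Tape.head (cnt (suc n)))) (sym length-ms)) (cong isEnd (at-end ms)))
          (sym (dec-true (N ℕₚ.≟ N) refl))
    ... | no  ne   = trans (proj₂ (plain-inner plain p (≤-trans (≤∧≢⇒< p≤ ne) (≤-reflexive (sym length-ms))))) (sym
          (dec-false (p ℕₚ.≟ N) ne))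

    head-label : ∀ i → labelOf (Tape.head (cnt (suc (toℕ i)))) ≡ lbl i
    head-label i = trans (cong labelOf (trans (cong (λ p → Tape.head (cnt (suc p))) (sym (Finₚ.toℕ-cast (sym length-ms) i)))
          (trans (head-inner [ startˢ ] ms (Fin.cast (sym length-ms) i)) (lookup-map labs i))))
      (labelOf-labˢ (lbl i))
      where
      lookup-map : ∀ ls (i : Fin (length ls)) .{eq} → List.lookup (map labˢ ls) (Fin.cast eq i) ≡ labˢ (List.lookup ls i)
      lookup-map (ℓ ∷ ls) zero    = refl
      lookup-map (ℓ ∷ ls) (suc i) = lookup-map ls i

    if-cong : ∀ {A : Set} {b b′} {p q : A} → b ≡ b′ → (if b then p else q) ≡ (if b′ then p else q)
    if-cong refl = refl

    module Equal (ℓ ℓ′ : ℕ) (ℓ≢ℓ′ : ℓ ≢ ℓ′) (ok : suc ℓ < C) (ok′ : suc ℓ′ < C) (B : List Sym) (pos : ℕ → ℕ)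
                 (pos-0 : pos 0 ≡ 0) (a a′ : ℕ) (pos-a : pos (suc ℓ) ≡ a) (pos-a′ : pos (suc ℓ′) ≡ a′) (a≤ : a ≤ suc N) (a′≤ : a′ ≤ suc N) where

      c c′ K : ℕ
      c  = suc ℓ
      c′ = suc ℓ′
      K  = a ⊓ a′

      phase : ℕ → ℕ → ℕ
      phase k = setp ((0 , k) ∷ (c , a ∸ k) ∷ (c′ , a′ ∸ k) ∷ []) pos

      K≤ : K ≤ suc N
      K≤ = ≤-trans (m⊓n≤m a a′) a≤

      phase-c : ∀ k → phase k c ≡ a ∸ k
      phase-c k = if-cong (dec-true (ℓ ℕₚ.≟ ℓ) refl)

      phase-c′ : ∀ k → phase k c′ ≡ a′ ∸ k
      phase-c′ k = trans (if-cong (dec-false (ℓ′ ℕₚ.≟ ℓ) (ℓ≢ℓ′ ∘ sym))) (if-cong (dec-true (ℓ′ ℕₚ.≟ ℓ′) refl))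

      phase-0 : ∀ x → phase 0 x ≡ pos x
      phase-0 zero = sym pos-0
      phase-0 (suc x) with x ℕₚ.≟ ℓ
      ... | yes refl = trans (if-cong (dec-true (x ℕₚ.≟ x) refl)) (sym pos-a)
      ... | no  ne with x ℕₚ.≟ ℓ′
      ... | yes refl = trans (if-cong (dec-false (x ℕₚ.≟ ℓ) ne)) (trans (if-cong (dec-true (x ℕₚ.≟ x) refl)) (sym pos-a′))
      ... | no  ne′  = trans (if-cong (dec-false (x ℕₚ.≟ ℓ) ne)) (if-cong (dec-false (x ℕₚ.≟ ℓ′) ne′))

      test : ∀ φ k → both (on (ctr c) (φ ∘ isStart)) (on (ctr c′) (φ ∘ isStart)) (heads (vec (st B (phase k)))) ≡ (φ (isZero
            (a ∸ k)) ∧ φ (isZero (a′ ∸ k)))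
      test φ k = cong₂ _∧_
        (trans (on-vec (st B (phase k)) (ctr c) (φ ∘ isStart) ok) (trans (cong (λ p → φ (isStart (Tape.head (cnt p))))
              (phase-c k)) (cong φ (head-zero (a ∸ k) (≤-trans (m∸n≤m a k) a≤)))))
        (trans (on-vec (st B (phase k)) (ctr c′) (φ ∘ isStart) ok′) (trans (cong (λ p → φ (isStart (Tape.head (cnt p))))
              (phase-c′ k)) (cong φ (head-zero (a′ ∸ k) (≤-trans (m∸n≤m a′ k) a′≤)))))

      ∸-bound : ∀ {x} k → x ≤ suc N → k < x → x ∸ suc k ≤ N
      ∸-bound {x} k x≤ k<x = ≤-pred (≤-trans (≤-reflexive (sym (∸-step k<x))) (≤-trans (m∸n≤m x k) x≤))

      down-step : ∀ k → k < K → ctrs ((0 , right) ∷ (c , left) ∷ (c′ , left) ∷ []) ∶ st B (phase k) ⇝ st B (phase (suc k)) within 1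
      down-step k k<K = run-ctrs ((0 , right , k , suc k) ∷ (c , left , a ∸ k , a ∸ suc k) ∷ (c′ , left , a′ ∸ k , a′ ∸ suc k) ∷ []) B pos
        (rights (≤-pred (≤-trans k<K K≤)) ∷
         subst (λ p → Moved left p (a ∸ suc k)) (sym (∸-step k<a)) (lefts (∸-bound k a≤ k<a)) ∷
         subst (λ p → Moved left p (a′ ∸ suc k)) (sym (∸-step k<a′)) (lefts (∸-bound k a′≤ k<a′)) ∷ [])
        where
        k<a : k < a
        k<a = ≤-trans k<K (m⊓n≤m a a′)
        k<a′ : k < a′
        k<a′ = ≤-trans k<K (m⊓n≤n a a′)

      up-step : ∀ k → k < K → ctrs ((0 , left) ∷ (c , right) ∷ (c′ , right) ∷ []) ∶ st B (phase (suc k)) ⇝ st B (phase k) within 1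
      up-step k k<K = run-ctrs ((0 , left , suc k , k) ∷ (c , right , a ∸ suc k , a ∸ k) ∷ (c′ , right , a′ ∸ suc k , a′ ∸ k) ∷ []) B pos
        (lefts (≤-pred (≤-trans k<K K≤)) ∷
         subst (Moved right (a ∸ suc k)) (sym (∸-step k<a)) (rights (∸-bound k a≤ k<a)) ∷
         subst (Moved right (a′ ∸ suc k)) (sym (∸-step k<a′)) (rights (∸-bound k a′≤ k<a′)) ∷ [])
        where
        k<a : k < a
        k<a = ≤-trans k<K (m⊓n≤m a a′)
        k<a′ : k < a′
        k<a′ = ≤-trans k<K (m⊓n≤n a a′)

      restored : restore c c′ ∶ st B (phase K) ⇝ st B pos within (suc N * 2 + 1)
      restored = run-resp (λ _ → refl) (st-cong (λ x → trans (cong (λ k → phase k x) (n∸n≡0 K)) (phase-0 x)))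
        (weaken (+-monoˡ-≤ 1 (*-monoˡ-≤ 2 K≤)) (run-while (λ k → st B (phase (K ∸ k))) K 1
          (λ k k<K → trans (scratch k) (cong not (cong isZero (∸-step k<K))))
          (trans (scratch K) (cong (not ∘ isZero) (n∸n≡0 K)))
          (λ k k<K → run-resp (st-cong (λ x → cong (λ k → phase k x) (sym (∸-step k<K)))) (λ _ → refl)
            (up-step (K ∸ suc k) (≤-trans (≤-reflexive (sym (∸-step k<K))) (m∸n≤m K k))))))
        where
        scratch : ∀ k → on (ctr 0) (not ∘ isStart) (heads (vec (st B (phase (K ∸ k))))) ≡ not (isZero (K ∸ k))
        scratch k = trans (on-vec (st B (phase (K ∸ k))) (ctr 0) (not ∘ isStart) (≤-trans (s≤s z≤n) ok)) (cong not (head-zero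
              (K ∸ k) (≤-trans (m∸n≤m K k) K≤)))

      run-if-equal : ∀ {p q S n} → (if does (a ℕₚ.≟ a′) then p else q) ∶ st B pos ⇝ S within n →
        if-equal c c′ p q ∶ st B pos ⇝ S within (equal-cost N + n)
      run-if-equal {p} {q} {S} {n} branch = weaken (≤-reflexive (sym (+-assoc (suc N * 2 + 1) (1 + (suc N * 2 + 1)) n))) (run-seq
        (run-resp (st-cong phase-0) (λ _ → refl) (weaken (+-monoˡ-≤ 1 (*-monoˡ-≤ 2 K≤)) (run-while (λ k → st B (phase k)) K 1
          (λ k k<K → trans (test not k) (min-go k a a′ k<K)) (trans (test not K) (min-stop a a′)) down-step)))
        (run-ite (trans (test id K) (min-zero a a′)) (chosen (does (a ℕₚ.≟ a′)) branch)))
        where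
        chosen : ∀ b → (if b then p else q) ∶ st B pos ⇝ S within n →
          (if b then (restore c c′ ▹ p) else (restore c c′ ▹ q)) ∶ st B (phase K) ⇝ S within ((suc N * 2 + 1) + n)
        chosen true  br = run-seq restored br
        chosen false br = run-seq restored br

    lev : ∀ {n} → Vec (Fin N) n → ℕ → ℕ
    lev []              ℓ = 0
    lev {suc n} (i ∷ ρ) ℓ = if does (ℓ ℕₚ.≟ n) then suc (toℕ i) else lev ρ ℓ

    posOf : ∀ {n} → Vec (Fin N) n → ℕ → ℕ
    posOf ρ zero    = 0
    posOf ρ (suc ℓ) = lev ρ ℓ

    lev-out : ∀ {n} (ρ : Vec (Fin N) n) ℓ → n ≤ ℓ → lev ρ ℓ ≡ 0
    lev-out []              ℓ _   = refl
    lev-out {suc n} (i ∷ ρ) ℓ n<ℓ = trans (if-cong (dec-false (ℓ ℕₚ.≟ n) (λ eq → <-irrefl (sym eq) n<ℓ))) (lev-out ρ ℓ (<⇒≤ n<ℓ))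

    lev-lookup : ∀ {n} (ρ : Vec (Fin N) n) x → lev ρ (n ∸ suc (toℕ x)) ≡ suc (toℕ (lookup ρ x))
    lev-lookup {suc n} (i ∷ ρ) zero    = if-cong (dec-true (n ℕₚ.≟ n) refl)
    lev-lookup {suc n} (i ∷ ρ) (suc x) = trans (if-cong (dec-false ((n ∸ suc (toℕ x)) ℕₚ.≟ n)
      (λ eq → <-irrefl eq (≤-trans (≤-reflexive (sym (∸-step (Finₚ.toℕ<n x)))) (m∸n≤m n (toℕ x)))))) (lev-lookup ρ x)

    pos-bound : ∀ {n} (ρ : Vec (Fin N) n) x → suc (toℕ (lookup ρ x)) ≤ N
    pos-bound ρ x = Finₚ.toℕ<n (lookup ρ x)

    level-injective : ∀ {n} (x y : Fin n) → n ∸ suc (toℕ x) ≡ n ∸ suc (toℕ y) → x ≡ y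
    level-injective x y eq = Finₚ.toℕ-injective (suc-injective (∸-cancelˡ-≡ (Finₚ.toℕ<n x) (Finₚ.toℕ<n y) eq))

    ctr-allocated : ∀ {n} (x : Fin n) → n < C → ctrOf x < C
    ctr-allocated {n} x n<C = ≤-trans (s≤s (≤-trans (≤-reflexive (sym (∸-step (Finₚ.toℕ<n x)))) (m∸n≤m n (toℕ x)))) n<C

    shift-ctr : ∀ {n} (ρ : Vec (Fin N) n) x m p B → Moved m (suc (toℕ (lookup ρ x))) p →
      ctrs [ (ctrOf x , m) ] ∶ st B (posOf ρ) ⇝ st B (setp [ (ctrOf x , p) ] (posOf ρ)) within 1
    shift-ctr ρ x m p B moved = run-resp (st-cong unchanged) (λ _ → refl) (run-ctrs [ (ctrOf x , m , suc (toℕ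
          (lookup ρ x)) , p) ] B (posOf ρ) (moved ∷ []))
      where
      unchanged : ∀ y → setp [ (ctrOf x , suc (toℕ (lookup ρ x))) ] (posOf ρ) y ≡ posOf ρ y
      unchanged y with y ℕₚ.≟ ctrOf x
      ... | yes refl = trans (if-cong (dec-true (ctrOf x ℕₚ.≟ ctrOf x) refl)) (sym (lev-lookup ρ x))
      ... | no  ne   = if-cong (dec-false (y ℕₚ.≟ ctrOf x) ne)

    unshift-ctr : ∀ {n} (ρ : Vec (Fin N) n) x m p B → Moved m p (suc (toℕ (lookup ρ x))) →
      ctrs [ (ctrOf x , m) ] ∶ st B (setp [ (ctrOf x , p) ] (posOf ρ)) ⇝ st B (posOf ρ) within 1
    unshift-ctr ρ x m p B moved = run-resp (λ _ → refl) (st-cong unchanged) (run-ctrs [ (ctrOf x , m , p , suc (toℕ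
          (lookup ρ x))) ] B (posOf ρ) (moved ∷ []))
      where
      unchanged : ∀ y → setp [ (ctrOf x , suc (toℕ (lookup ρ x))) ] (posOf ρ) y ≡ posOf ρ y
      unchanged y with y ℕₚ.≟ ctrOf x
      ... | yes refl = trans (if-cong (dec-true (ctrOf x ℕₚ.≟ ctrOf x) refl)) (sym (lev-lookup ρ x))
      ... | no  ne   = if-cong (dec-false (y ℕₚ.≟ ctrOf x) ne)

    both-branches : ∀ {r p q S₁ S S′ m n} b → r ∶ S₁ ⇝ S within m → (if b then p else q) ∶ S ⇝ S′ within n →
      (if b then (r ▹ p) else (r ▹ q)) ∶ S₁ ⇝ S′ within (m + n)
    both-branches true  x y = run-seq x y
    both-branches false x y = run-seq x y

    run-ifᵇ : ∀ {n} (e : BExp n) → n < C → ∀ (ρ : Vec (Fin N) n) {b B p q S m} → eval e ρ ≡ b →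
      (if b then p else q) ∶ st B (posOf ρ) ⇝ S within m → ifᵇ e p q ∶ st B (posOf ρ) ⇝ S within (test-cost N e + m)
    run-ifᵇ (constᵉ true)  n<C ρ refl br = br
    run-ifᵇ (constᵉ false) n<C ρ refl br = br
    run-ifᵇ {n} (eqᵉ x y) n<C ρ {B = B} {p} {q} {S} {m} refl br with x Finₚ.≟ y
    ... | yes refl = weaken (m≤n+m _ (equal-cost N)) (subst (λ b → (if b then p else q) ∶ st B (posOf ρ) ⇝ S within m)
          (dec-true (lookup ρ x Finₚ.≟ lookup ρ x) refl) br)
    ... | no  ne   = Equal.run-if-equal (n ∸ suc (toℕ x)) (n ∸ suc (toℕ y)) (ne ∘ level-injective x y) (ctr-allocated x n<C)
          (ctr-allocated y n<C) B (posOf ρ) refl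
      (suc (toℕ (lookup ρ x))) (suc (toℕ (lookup ρ y))) (lev-lookup ρ x) (lev-lookup ρ y) (m≤n⇒m≤1+n (pos-bound ρ x))
            (m≤n⇒m≤1+n (pos-bound ρ y))
      (subst (λ b → (if b then p else q) ∶ st B (posOf ρ) ⇝ S within m)
        (does-⇔ (mk⇔ (cong (suc ∘ toℕ)) (Finₚ.toℕ-injective ∘ suc-injective)) (lookup ρ x Finₚ.≟ lookup ρ y) (suc (toℕ
              (lookup ρ x)) ℕₚ.≟ suc (toℕ (lookup ρ y)))) br)
    run-ifᵇ {n} (succᵉ x y) n<C ρ {B = B} {p} {q} {S} {m} refl br with x Finₚ.≟ y
    ... | yes refl = weaken (m≤n+m _ (1 + (equal-cost N + 1))) (subst (λ b → (if b then p else q) ∶ st B (posOf ρ) ⇝ S within m)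
      (dec-false (toℕ (lookup ρ x) ℕₚ.≟ suc (toℕ (lookup ρ x))) (λ eq → <-irrefl eq ≤-refl)) br)
    ... | no  ne   = weaken (s≤s (≤-reflexive (sym (+-assoc (equal-cost N) 1 m)))) (run-seq (shift-ctr ρ y left (toℕ
          (lookup ρ y)) B (lefts (<⇒≤ (pos-bound ρ y))))
      (Equal.run-if-equal (n ∸ suc (toℕ x)) (n ∸ suc (toℕ y)) (ne ∘ level-injective x y) (ctr-allocated x n<C) (ctr-allocated y n<C) B
        (setp [ (ctrOf y , toℕ (lookup ρ y)) ] (posOf ρ)) refl (suc (toℕ (lookup ρ x))) (toℕ (lookup ρ y))
        (trans (if-cong (dec-false ((n ∸ suc (toℕ x)) ℕₚ.≟ (n ∸ suc (toℕ y))) (ne ∘ level-injective x y))) (lev-lookup ρ x))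
        (if-cong (dec-true (ctrOf y ℕₚ.≟ ctrOf y) refl)) (m≤n⇒m≤1+n (pos-bound ρ x)) (m≤n⇒m≤1+n (<⇒≤ (pos-bound ρ y)))
        (both-branches (does (suc (toℕ (lookup ρ x)) ℕₚ.≟ toℕ (lookup ρ y))) (unshift-ctr ρ y right (toℕ (lookup ρ y)) B
              (rights (<⇒≤ (pos-bound ρ y))))
          (subst (λ b → (if b then p else q) ∶ st B (posOf ρ) ⇝ S within m)
            (does-⇔ (mk⇔ sym sym) (toℕ (lookup ρ y) ℕₚ.≟ suc (toℕ (lookup ρ x))) (suc (toℕ (lookup ρ x)) ℕₚ.≟ toℕ (lookup ρ y))) br))))
    run-ifᵇ (zeroᵉ x) n<C ρ {B = B} refl br = run-seq (shift-ctr ρ x left (toℕ (lookup ρ x)) B (lefts (<⇒≤ (pos-bound ρ x))))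
      (run-ite {b = does (toℕ (lookup ρ x) ℕₚ.≟ 0)} (trans (on-vec (st B (setp [ (ctrOf x , toℕ (lookup ρ x)) ] (posOf ρ)))
            (ctr (ctrOf x)) isStart (ctr-allocated x n<C))
        (trans (cong (isStart ∘ Tape.head ∘ cnt) (if-cong (dec-true (ctrOf x ℕₚ.≟ ctrOf x) refl))) (trans (head-zero (toℕ
              (lookup ρ x)) (m≤n⇒m≤1+n (<⇒≤ (pos-bound ρ x)))) (isZero-does (toℕ (lookup ρ x))))))
        (both-branches (does (toℕ (lookup ρ x) ℕₚ.≟ 0)) (unshift-ctr ρ x right (toℕ (lookup ρ x)) B (rights (<⇒≤ (pos-bound ρ x)))) br))
      where
      isZero-does : ∀ n → isZero n ≡ does (n ℕₚ.≟ 0)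
      isZero-does zero    = refl
      isZero-does (suc n) = refl
    run-ifᵇ (lastᵉ x) n<C ρ {B = B} refl br = run-seq (shift-ctr ρ x right (suc (suc (toℕ (lookup ρ x)))) B (rights (pos-bound ρ x)))
      (run-ite {b = does (suc (toℕ (lookup ρ x)) ℕₚ.≟ N)} (trans (on-vec (st B (setp [ (ctrOf x , suc (suc (toℕ
            (lookup ρ x)))) ] (posOf ρ))) (ctr (ctrOf x)) isEnd (ctr-allocated x n<C))
        (trans (cong (isEnd ∘ Tape.head ∘ cnt) (if-cong (dec-true (ctrOf x ℕₚ.≟ ctrOf x) refl))) (head-end (suc (toℕ
              (lookup ρ x))) (pos-bound ρ x))))
        (both-branches (does (suc (toℕ (lookup ρ x)) ℕₚ.≟ N)) (unshift-ctr ρ x left (suc (suc (toℕ (lookup ρ x)))) B (lefts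
              (pos-bound ρ x))) br))
    run-ifᵇ (labelᵉ f x) n<C ρ {B = B} refl br = run-ite {b = f (lbl (lookup ρ x))} (trans (on-vec (st B (posOf ρ)) (ctr
          (ctrOf x)) (f ∘ labelOf) (ctr-allocated x n<C))
      (cong f (trans (cong (labelOf ∘ Tape.head ∘ cnt) (lev-lookup ρ x)) (head-label (lookup ρ x))))) br
    run-ifᵇ (e ∧ᵉ e′) n<C ρ {B = B} {p} {q} {S} {m} refl br = weaken (≤-reflexive (sym (+-assoc (test-cost N e) (test-cost N e′) m)))
      (run-ifᵇ e n<C ρ {eval e ρ} refl (inner (eval e ρ) br))
      where
      inner : ∀ b → (if b ∧ eval e′ ρ then p else q) ∶ st B (posOf ρ) ⇝ S within m → (if b then ifᵇ e′ p q else q) ∶ st B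
            (posOf ρ) ⇝ S within (test-cost N e′ + m)
      inner true  br = run-ifᵇ e′ n<C ρ refl br
      inner false br = weaken (m≤n+m _ (test-cost N e′)) br
    run-ifᵇ (¬ᵉ e) n<C ρ {B = B} {p} {q} {S} {m} refl br = run-ifᵇ e n<C ρ refl (subst (λ P → P ∶ st B
          (posOf ρ) ⇝ S within m) (if-not (eval e ρ)) br)
      where
      if-not : ∀ b → (if not b then p else q) ≡ (if b then q else p)
      if-not true  = refl
      if-not false = refl

    run-compile : ∀ {n} (e : Emitter n) → n + levels e < C → ∀ (ρ : Vec (Fin N) n) B →
      compile e ∶ st B (posOf ρ) ⇝ st (push (⟦ e ⟧ ρ) B) (posOf ρ) within time N e
    run-compile skip     _   ρ B = run-act {λ _ → keep stay} λ _ → refl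
    run-compile (emit b) _   ρ B = run-act {only io (put (bit b) right)} λ { io → refl ; (depth _) → refl ; (ctr _) → refl }
    run-compile {n} (e ⨾ e′) lt ρ B = subst (λ B′ → compile (e ⨾ e′) ∶ st B (posOf ρ) ⇝ st B′ (posOf ρ) within _) (sym
          (push-++ (⟦ e ⟧ ρ) (⟦ e′ ⟧ ρ) B))
      (run-seq (run-compile e (≤-<-trans (+-monoʳ-≤ n (m≤m⊔n (levels e) _)) lt) ρ B) (run-compile e′ (≤-<-trans (+-monoʳ-≤ n
            (m≤n⊔m (levels e) _)) lt) ρ (push (⟦ e ⟧ ρ) B)))
    run-compile {n} (ifᵉ b e e′) lt ρ B = run-ifᵇ b (≤-<-trans (m≤m+n n _) lt) ρ refl (branch (eval b ρ))
      where
      branch : ∀ b → (if b then compile e else compile e′) ∶ st B (posOf ρ) ⇝ st (push (if b then ⟦ e ⟧ ρ else ⟦ e′ ⟧ ρ) B)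
            (posOf ρ) within (time N e + time N e′)
      branch true  = weaken (m≤m+n _ _) (run-compile e (≤-<-trans (+-monoʳ-≤ n (m≤m⊔n (levels e) _)) lt) ρ B)
      branch false = weaken (m≤n+m _ _) (run-compile e′ (≤-<-trans (+-monoʳ-≤ n (m≤n⊔m (levels e) _)) lt) ρ B)
    run-compile {n} (for e) lt ρ B = subst₂ (λ B′ t → loop (ctr (suc n)) (compile e) ∶ st B (posOf ρ) ⇝ st (push B′ B)
          (posOf ρ) within loop-cost t (time N e)) whole length-ms
      (run-resp (idle-counter 0) (idle-counter (length ms))
        (run-loop {r = ctr (suc n)} (≤-trans (s≤s (≤-trans (s≤s (m≤m+n n _)) (≤-reflexive (sym (+-suc n
              (levels e)))))) lt) plain σ (time N e) iteration))
      where
      out : ℕ → List Bool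
      out k with k <? N
      ... | yes k<N = ⟦ e ⟧ (Fin.fromℕ< k<N ∷ ρ)
      ... | no  _   = []

      out-toℕ : ∀ i → out (toℕ i) ≡ ⟦ e ⟧ (i ∷ ρ)
      out-toℕ i with toℕ i <? N
      ... | yes i<N = cong (λ j → ⟦ e ⟧ (j ∷ ρ)) (Finₚ.fromℕ<-toℕ i i<N)
      ... | no  i≮N = ⊥-elim (i≮N (Finₚ.toℕ<n i))

      whole : prefix out (length ms) ≡ ⟦ for e ⟧ ρ
      whole = trans (cong (prefix out) length-ms) (prefix-allFin out (λ i → ⟦ e ⟧ (i ∷ ρ)) out-toℕ)

      σ : ℕ → State
      σ k = st (push (prefix out k) B) (posOf ρ)

      idle-counter : ∀ k r → update (σ k) (ctr (suc n)) (counter ms 0) r ≡ σ k r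
      idle-counter k r with r ≟ᴿ ctr (suc n)
      ... | yes refl = cong cnt (sym (lev-out ρ n ≤-refl))
      ... | no  _    = refl

      busy-counter : ∀ {k k′ B′} (k<N : k < N) → B′ ≡ push (prefix out k′) B → ∀ r → st B′ (posOf
            (Fin.fromℕ< k<N ∷ ρ)) r ≡ update (σ k′) (ctr (suc n)) (counter ms (suc k)) r
      busy-counter k<N refl r with r ≟ᴿ ctr (suc n)
      busy-counter k<N refl r         | yes refl = cong cnt (trans (if-cong (dec-true (n ℕₚ.≟ n) refl)) (cong suc (Finₚ.toℕ-fromℕ< k<N)))
      busy-counter k<N refl io        | no _  = refl
      busy-counter k<N refl (depth _) | no _  = refl
      busy-counter k<N refl (ctr zero)    | no _  = refl
      busy-counter k<N refl (ctr (suc ℓ)) | no ne = cong cnt (if-cong (dec-false (ℓ ℕₚ.≟ n) (λ eq → ne (cong (ctr ∘ suc) eq))))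

      iteration : ∀ k → k < length ms → compile e ∶ update (σ k) (ctr (suc n)) (counter ms (suc k)) ⇝ update (σ (suc k)) (ctr
            (suc n)) (counter ms (suc k)) within time N e
      iteration k k<len = run-resp (busy-counter {k} {k} k<N refl) (busy-counter {k} {suc k} k<N (sym (trans (push-++
            (prefix out k) (out k) B) (cong (λ o → push o (push (prefix out k) B)) out-k))))
        (run-compile e (subst (_< C) (+-suc n (levels e)) lt) (Fin.fromℕ< k<N ∷ ρ) (push (prefix out k) B))
        where
        k<N : k < N
        k<N = ≤-trans k<len (≤-reflexive length-ms)
        out-k : out k ≡ ⟦ e ⟧ (Fin.fromℕ< k<N ∷ ρ)
        out-k = trans (cong out (sym (Finₚ.toℕ-fromℕ< k<N))) (out-toℕ (Fin.fromℕ< k<N))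

-- Polynomial bounds

infixl 6 _+ᵖ_
infixl 7 _*ᵖ_

_+ᵖ_ _*ᵖ_ _∘ᵖ_ : List ℕ → List ℕ → List ℕ
[]       +ᵖ bs       = bs
(a ∷ as) +ᵖ []       = a ∷ as
(a ∷ as) +ᵖ (b ∷ bs) = a + b ∷ (as +ᵖ bs)
[]       *ᵖ bs = []
(a ∷ as) *ᵖ bs = map (a *_) bs +ᵖ (0 ∷ as *ᵖ bs)
[]       ∘ᵖ q = []
(a ∷ as) ∘ᵖ q = (a ∷ []) +ᵖ q *ᵖ (as ∘ᵖ q)

eval-+ᵖ : ∀ as bs n → evalPoly (as +ᵖ bs) n ≡ evalPoly as n + evalPoly bs n
eval-+ᵖ []       bs       n = refl
eval-+ᵖ (a ∷ as) []       n = sym (+-identityʳ _)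
eval-+ᵖ (a ∷ as) (b ∷ bs) n rewrite eval-+ᵖ as bs n = lemma a b n (evalPoly as n) (evalPoly bs n)
  where
  lemma : ∀ a b n x y → a + b + n * (x + y) ≡ a + n * x + (b + n * y)
  lemma = solve-∀

eval-scale : ∀ a bs n → evalPoly (map (a *_) bs) n ≡ a * evalPoly bs n
eval-scale a []       n = sym (*-zeroʳ a)
eval-scale a (b ∷ bs) n rewrite eval-scale a bs n = lemma a b n (evalPoly bs n)
  where
  lemma : ∀ a b n x → a * b + n * (a * x) ≡ a * (b + n * x)
  lemma = solve-∀

eval-*ᵖ : ∀ as bs n → evalPoly (as *ᵖ bs) n ≡ evalPoly as n * evalPoly bs n
eval-*ᵖ []       bs n = refl
eval-*ᵖ (a ∷ as) bs n rewrite eval-+ᵖ (map (a *_) bs) (0 ∷ as *ᵖ bs) n | eval-scale a bs n | eval-*ᵖ as bs n = lemma a n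
      (evalPoly as n) (evalPoly bs n)
  where
  lemma : ∀ a n x y → a * y + n * (x * y) ≡ (a + n * x) * y
  lemma = solve-∀

eval-∘ᵖ : ∀ as q n → evalPoly (as ∘ᵖ q) n ≡ evalPoly as (evalPoly q n)
eval-∘ᵖ []       q n = refl
eval-∘ᵖ (a ∷ as) q n rewrite eval-+ᵖ (a ∷ []) (q *ᵖ (as ∘ᵖ q)) n | eval-*ᵖ q (as ∘ᵖ q) n | eval-∘ᵖ as q n | *-zeroʳ n | +-identityʳ a = refl

evalPoly-mono : ∀ as {m n} → m ≤ n → evalPoly as m ≤ evalPoly as n
evalPoly-mono []       m≤n = z≤n
evalPoly-mono (a ∷ as) m≤n = +-monoʳ-≤ a (*-mono-≤ m≤n (evalPoly-mono as m≤n))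

Polynomial : (ℕ → ℕ) → Set
Polynomial F = ∃[ as ] ∀ n → F n ≤ evalPoly as n

poly-const : ∀ c → Polynomial (λ _ → c)
poly-const c = [ c ] , λ n → m≤m+n c _

poly-id : Polynomial id
poly-id = 0 ∷ 1 ∷ [] , λ n → ≤-reflexive (lemma n)
  where
  lemma : ∀ n → n ≡ 0 + n * (1 + n * 0)
  lemma = solve-∀

poly-+ : ∀ {F H} → Polynomial F → Polynomial H → Polynomial (λ n → F n + H n)
poly-+ (as , f≤) (bs , h≤) = as +ᵖ bs , λ n → ≤-trans (+-mono-≤ (f≤ n) (h≤ n)) (≤-reflexive (sym (eval-+ᵖ as bs n)))

poly-* : ∀ {F H} → Polynomial F → Polynomial H → Polynomial (λ n → F n * H n)
poly-* (as , f≤) (bs , h≤) = as *ᵖ bs , λ n → ≤-trans (*-mono-≤ (f≤ n) (h≤ n)) (≤-reflexive (sym (eval-*ᵖ as bs n)))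

poly-suc : ∀ {F} → Polynomial F → Polynomial (λ n → suc (F n))
poly-suc = poly-+ (poly-const 1)

-- The machine writes the labels on its counter tapes, by loops nested according
-- to Horner's scheme, and then runs the emitter.
module Generator (as bs : List ℕ) (emitter : Emitter 0) where

  -- Both polynomials are generated on the same depth tapes, one per nested loop, so their joint
  -- length is ample. Each nesting level of the emitter takes a counter, and one more serves the
  -- comparisons.
  G C : ℕ
  G = suc (length as + length bs)
  C = suc (levels emitter)

  open Layout G C
  open Compile G C

  uni : Instr → Instr → Instr → Role → Instr
  uni i j k io        = i
  uni i j k (depth _) = j
  uni i j k (ctr _)   = k

  stay-put : Instr
  stay-put = keep stay

  mark : Sym
  mark = labˢ free

  isTrue : Sym → Bool
  isTrue (bit b) = b
  isTrue _       = false

  copy-bit : Bool → Prog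
  copy-bit b = actⁱ (uni stay-put stay-put (put (labˢ marker) right)) ▹ actⁱ (uni (put blank right) (put mark right) (put
        (labˢ (input b)) right))

  -- The input is erased while it is read: its tape becomes the output tape, and the blanks left
  -- behind delimit the output. The marks put on the depth tapes record the input length in unary.
  copy : Prog
  copy = while (on io isBit) (ite (on io isTrue) (copy-bit true) (copy-bit false))

  append : Sym → ℕ → Prog
  append s zero    = actⁱ (uni stay-put stay-put stay-put)
  append s (suc a) = actⁱ (uni stay-put stay-put (put s right)) ▹ append s a

  generate : List ℕ → ℕ → Sym → Prog
  generate []       i s = actⁱ (uni stay-put stay-put stay-put)
  generate (a ∷ as) i s = append s a ▹ loop (depth i) (generate as (suc i) s)

  rewind-depth rewind-ctr finish main : Prog
  rewind-depth = while (on (depth 0) (not ∘ isStart)) (actⁱ (uni stay-put (keep left) stay-put))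
  rewind-ctr   = while (on (ctr 0) (not ∘ isStart)) (actⁱ (uni stay-put stay-put (keep left)))
  -- The head returns to the first output bit, which is recognised by the blank before it.
  finish = actⁱ (uni (keep left) stay-put stay-put) ▹ while (on io isBit) (actⁱ (uni (keep left) stay-put stay-put)) ▹ actⁱ
        (uni (keep right) stay-put stay-put)
  main =
    actⁱ (uni stay-put (put startˢ right) (put startˢ right)) ▹
    copy ▹
    actⁱ (uni stay-put (put endˢ stay) (put (labˢ separator) right)) ▹
    rewind-depth ▹
    generate as 0 (labˢ free) ▹
    generate bs 0 (labˢ padding) ▹
    actⁱ (uni stay-put stay-put (put endˢ stay)) ▹
    rewind-ctr ▹
    compile emitter ▹
    finish

  uniform : Tape 8 → Tape 8 → Tape 8 → State
  uniform a b c io        = a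
  uniform a b c (depth _) = b
  uniform a b c (ctr _)   = c

  run-uni : ∀ i j k {a b c a′ b′ c′} → perform i a ≡ a′ → perform j b ≡ b′ → perform k c ≡ c′ →
    actⁱ (uni i j k) ∶ uniform a b c ⇝ uniform a′ b′ c′ within 1
  run-uni i j k refl refl refl = run-act {uni i j k} λ { io → refl ; (depth _) → refl ; (ctr _) → refl }

  blank-tape : List Sym → Tape 8
  blank-tape B = tape B blank []

  doubled : List Bool → List Label
  doubled = concatMap (λ b → marker ∷ input b ∷ [])

  put-blank : ∀ bl b (x : List Bool) → perform (put blank right) (zipper bl (bit b ∷ map bit x)) ≡ zipper (blank ∷ bl) (map bit x)
  put-blank bl b []      = refl
  put-blank bl b (_ ∷ _) = refl

  if-not-if : ∀ b → (if b then copy-bit true else copy-bit false) ≡ copy-bit b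
  if-not-if true  = refl
  if-not-if false = refl

  run-while-step : ∀ {t p S S₁ S₂ a b} → t (heads
        (vec S)) ≡ true → p ∶ S ⇝ S₁ within a → while t p ∶ S₁ ⇝ S₂ within b → while t p ∶ S ⇝ S₂ within (suc a + b)
  run-while-step go (runs x x≤) (runs y y≤) = runs (while-step go x y) (s≤s (+-mono-≤ x≤ y≤))

  run-copy : ∀ x bl Bd Bc → All (_≡ blank) bl → ∃[ bl′ ] All (_≡ blank) bl′ ×
    (copy ∶ uniform (zipper bl (map bit x)) (blank-tape Bd) (blank-tape Bc)
      ⇝ uniform (blank-tape bl′) (blank-tape (List.replicate (length x) mark List.ʳ++ Bd)) (blank-tape (map labˢ
            (doubled x) List.ʳ++ Bc)) within (length x * 4 + 1))
  run-copy []      bl Bd Bc blanks = bl , blanks , runs (while-done refl) ≤-refl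
  run-copy (b ∷ x) bl Bd Bc blanks with run-copy x (blank ∷ bl) (mark ∷ Bd) (labˢ (input b) ∷ labˢ marker ∷ Bc) (refl ∷ blanks)
  ... | bl′ , blanks′ , rest = bl′ , blanks′ , run-while-step refl body rest
    where
    S₀ S₁ : State
    S₀ = uniform (zipper bl (map bit (b ∷ x))) (blank-tape Bd) (blank-tape Bc)
    S₁ = uniform (zipper (blank ∷ bl) (map bit x)) (blank-tape (mark ∷ Bd)) (blank-tape (labˢ (input b) ∷ labˢ marker ∷ Bc))

    copied : copy-bit b ∶ S₀ ⇝ S₁ within 2
    copied = run-seq (run-uni stay-put stay-put (put (labˢ marker) right) {a = zipper bl (map bit
          (b ∷ x))} {b = blank-tape Bd} {c = blank-tape Bc} refl refl refl)
      (run-uni (put blank right) (put mark right) (put (labˢ (input b)) right) (put-blank bl b x) refl refl)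

    body : ite (on io isTrue) (copy-bit true) (copy-bit false) ∶ S₀ ⇝ S₁ within 3
    body = run-ite {b = b} refl (subst (λ P → P ∶ S₀ ⇝ S₁ within 2) (sym (if-not-if b)) copied)

  over : State → List Sym → State
  over S B io        = S io
  over S B (depth i) = S (depth i)
  over S B (ctr _)   = blank-tape B

  replicate-+ : ∀ {A : Set} m n {s : A} {B} → List.replicate m s List.ʳ++ (List.replicate n s List.ʳ++ B) ≡ List.replicate
        (n + m) s List.ʳ++ B
  replicate-+ m zero    = refl
  replicate-+ m (suc n) = replicate-+ m n

  append-cost : ℕ → ℕ
  append-cost a = a + 1

  generate-cost : List ℕ → ℕ → ℕ
  generate-cost []       n = 1
  generate-cost (a ∷ as) n = append-cost a + loop-cost n (generate-cost as n)

  run-append : ∀ s a S B → append s a ∶ over S B ⇝ over S (List.replicate a s List.ʳ++ B) within append-cost a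
  run-append s zero    S B = run-act {uni stay-put stay-put stay-put} λ { io → refl ; (depth _) → refl ; (ctr _) → refl }
  run-append s (suc a) S B = run-seq (run-act {uni stay-put stay-put (put s right)} λ { io → refl ; (depth _) → refl ;
        (ctr _) → refl }) (run-append s a S (s ∷ B))

  module _ (dms : List Sym) (plain : All Plain dms) where

    run-generate : ∀ s as i S B → i + length as < G → (∀ j → i ≤ j → S (depth j) ≡ counter dms 0) →
      generate as i s ∶ over S B ⇝ over S (List.replicate (evalPoly as (length dms)) s List.ʳ++ B) within generate-cost as (length dms)
    run-generate s []       i S B lt idle₀ = run-act {uni stay-put stay-put stay-put} λ { io → refl ; (depth _) → refl ; (ctr _) → refl }
    run-generate s (a ∷ as) i S B lt idle₀ = run-seq (run-append s a S B)
      (run-resp (idle-loop 0 (λ _ → refl)) (idle-loop (length dms) (λ { _ → cong blank-tape (trans (replicate-+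
            (length dms * e) a) refl) }))
        (run-loop {r = depth i} (≤-<-trans (m≤m+n i _) lt) plain σ (generate-cost as (length dms)) iteration))
      where
      e : ℕ
      e = evalPoly as (length dms)

      B₁ : List Sym
      B₁ = List.replicate a s List.ʳ++ B

      σ : ℕ → State
      σ k = over S (List.replicate (k * e) s List.ʳ++ B₁)

      idle-loop : ∀ k {B′} → (∀ (_ : ⊤) → blank-tape (List.replicate (k * e) s List.ʳ++ B₁) ≡ blank-tape B′) → ∀ r → update
            (σ k) (depth i) (counter dms 0) r ≡ over S B′ r
      idle-loop k eq r with r ≟ᴿ depth i
      idle-loop k eq r         | yes refl = sym (idle₀ i ≤-refl)
      idle-loop k eq io        | no _ = refl
      idle-loop k eq (depth _) | no _ = refl
      idle-loop k eq (ctr _)   | no _ = eq tt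

      busy : ℕ → State
      busy k = update S (depth i) (counter dms (suc k))

      busy-≡ : ∀ k k′ {B′} → List.replicate (k′ * e) s List.ʳ++ B₁ ≡ B′ → ∀ r → over (busy k) B′ r ≡ update (σ k′) (depth i)
            (counter dms (suc k)) r
      busy-≡ k k′ eq io        = refl
      busy-≡ k k′ eq (depth j) with depth j ≟ᴿ depth i
      ... | yes _ = refl
      ... | no  _ = refl
      busy-≡ k k′ eq (ctr _)   = cong blank-tape (sym eq)

      iteration : ∀ k → k < length dms → generate as (suc i) s ∶ update (σ k) (depth i) (counter dms (suc k)) ⇝ update (σ
            (suc k)) (depth i) (counter dms (suc k)) within generate-cost as (length dms)
      iteration k _ = run-resp (busy-≡ k k refl) (busy-≡ k (suc k) (trans (cong (λ m → List.replicate m s List.ʳ++ B₁)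
            (+-comm e (k * e))) (sym (replicate-+ e (k * e)))))
        (run-generate s as (suc i) (busy k) (List.replicate (k * e) s List.ʳ++ B₁) (subst (_< G) (+-suc i
              (length as)) lt) λ j i<j → idle-j j i<j)
        where
        idle-j : ∀ j → suc i ≤ j → busy k (depth j) ≡ counter dms 0
        idle-j j i<j with depth j ≟ᴿ depth i
        ... | yes refl = ⊥-elim (<-irrefl refl i<j)
        ... | no  _    = idle₀ j (<⇒≤ i<j)

  at-length : ∀ bs ms → at bs (ms ++ [ endˢ ]) (length ms) ≡ tape (ms List.ʳ++ bs) endˢ []
  at-length bs []       = refl
  at-length bs (m ∷ ms) = at-length (m ∷ bs) ms

  filled : ∀ ms → tape (ms List.ʳ++ [ startˢ ]) endˢ [] ≡ counter ms (suc (length ms))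
  filled ms = sym (at-length [ startˢ ] ms)

  head-over-after : List Sym → List Sym → Tape 8
  head-over-after L aft = tape (proj₂ (uncons L)) (proj₁ (uncons L)) aft

  push-reverse : ∀ bs rs B → push bs (map bit rs ++ B) ≡ map bit (bs List.ʳ++ rs) ++ B
  push-reverse []       rs B = refl
  push-reverse (b ∷ bs) rs B = push-reverse bs (b ∷ rs) B

  unreverse : ∀ (xs rs : List Bool) (ys : List Sym) → map bit (xs List.ʳ++ rs) List.ʳ++ ys ≡ map bit rs List.ʳ++ (map bit xs ++ ys)
  unreverse []       rs ys = refl
  unreverse (x ∷ xs) rs ys = unreverse xs (x ∷ rs) ys

  run-back : ∀ rb bl aft {b c} → All (_≡ blank) bl →
    while (on io isBit) (actⁱ (uni (keep left) stay-put stay-put)) ∶ uniform (head-over-after (map bit rb ++ bl) aft) b c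
      ⇝ uniform (head-over-after bl (map bit rb List.ʳ++ aft)) b c within (length rb * 2 + 1)
  run-back []       []       aft blanks       = runs (while-done refl) ≤-refl
  run-back []       (_ ∷ bl) aft (refl ∷ _)   = runs (while-done refl) ≤-refl
  run-back (b ∷ rb) bl       aft blanks       = run-while-step refl (run-uni (keep left) stay-put stay-put refl refl refl)
        (run-back rb bl (bit b ∷ aft) blanks)

  result : List Sym → List Bool → Tape 8
  result bl out = moveHead right (head-over-after bl (map bit out ++ [ blank ]))

  run-finish : ∀ out bl {b c} → All (_≡ blank) bl →
    finish ∶ uniform (blank-tape (push out bl)) b c ⇝ uniform (result bl out) b c within (1 + ((length out * 2 + 1) + 1))
  run-finish out bl {b} {c} blanks = run-seq
    (run-uni (keep left) stay-put stay-put {a = blank-tape (push out bl)} {b} {c} (cong (λ B → moveHead left (blank-tape B))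
          (push-reverse out [] bl)) refl refl)
    (run-seq (subst₂ (λ aft len → while (on io isBit) (actⁱ (uni (keep left) stay-put stay-put)) ∶ uniform (head-over-after
          (map bit (out List.ʳ++ []) ++ bl) [ blank ]) b c
        ⇝ uniform (head-over-after bl aft) b c within (len * 2 + 1)) (unreverse out [] [ blank ]) (trans
              (Listₚ.length-ʳ++ out) (+-identityʳ (length out)))
        (run-back (out List.ʳ++ []) bl [ blank ] blanks))
      (run-uni (keep right) stay-put stay-put refl refl refl))

  length-doubled : ∀ x → length (doubled x) ≡ length x * 2
  length-doubled []      = refl
  length-doubled (b ∷ x) = cong (λ n → suc (suc n)) (length-doubled x)

  length-labels : ∀ x f r → length (labels x f r) ≡ length x * 2 + suc (f + r)
  length-labels x f r = trans (Listₚ.length-++ (doubled x)) (cong₂ _+_ (length-doubled x)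
    (cong suc (trans (Listₚ.length-++ (List.replicate f free)) (cong₂ _+_ (Listₚ.length-replicate f) (Listₚ.length-replicate r)))))

  total : ℕ → ℕ → ℕ
  total n N = 1 + ((n * 4 + 1) + (1 + (rewind-cost n + (generate-cost as n + (generate-cost bs n + (1 + (rewind-cost N +
    (time N emitter + (1 + ((time N emitter * 2 + 1) + 1))))))))))

  -- Each emitted bit costs a step. This bounds the way back over the output in `finish`.
  length-output : ∀ labs dt {n} (e : Emitter n) ρ → length (Semantics.⟦_⟧ (Correct.lbl labs dt) e ρ) ≤ time (length labs) e
  length-output labs dt skip     ρ = z≤n
  length-output labs dt (emit b) ρ = ≤-refl
  length-output labs dt (e ⨾ e′) ρ = ≤-trans (≤-reflexive (Listₚ.length-++ (Semantics.⟦_⟧ (Correct.lbl labs dt) e ρ)))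
        (+-mono-≤ (length-output labs dt e ρ) (length-output labs dt e′ ρ))
  length-output labs dt (ifᵉ b e e′) ρ = ≤-trans (branch (Semantics.eval (Correct.lbl labs dt) b ρ)) (m≤n+m _ (test-cost (length labs) b))
    where
    branch : ∀ c → length (if c then Semantics.⟦_⟧ (Correct.lbl labs dt) e ρ else Semantics.⟦_⟧
          (Correct.lbl labs dt) e′ ρ) ≤ time (length labs) e + time (length labs) e′
    branch true  = ≤-trans (length-output labs dt e ρ) (m≤m+n _ _)
    branch false = ≤-trans (length-output labs dt e′ ρ) (m≤n+m _ _)
  length-output labs dt (for e) ρ = ≤-trans (iterations (allFin (length labs)))
    (≤-trans (≤-reflexive (cong (_* time (length labs) e) (Listₚ.length-tabulate {n = length labs} id)))
      (≤-trans (*-monoʳ-≤ (length labs) (≤-trans (m≤m+n _ 1) (n≤1+n _))) (≤-trans (m≤m+n _ 1) (≤-trans (m≤m+n _ _) (n≤1+n _)))))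
    where
    iterations : ∀ is → length (concatMap (λ i → Semantics.⟦_⟧ (Correct.lbl labs dt) e (i ∷ ρ)) is) ≤ length is * time (length labs) e
    iterations []       = z≤n
    iterations (i ∷ is) = ≤-trans (≤-reflexive (Listₚ.length-++ (Semantics.⟦_⟧ (Correct.lbl labs dt) e (i ∷ ρ)))) (+-mono-≤
          (length-output labs dt e (i ∷ ρ)) (iterations is))

  module Run (x : List Bool) where

    n f r : ℕ
    n = length x
    f = evalPoly as n
    r = evalPoly bs n

    labs : List Label
    labs = labels x f r

    ms dms : List Sym
    ms  = map labˢ labs
    dms = List.replicate n mark

    plain-ms : All Plain ms
    plain-ms = Allₚ.map⁺ (All.universal plain-lab labs)

    plain-dms : All Plain dms
    plain-dms = Allₚ.replicate⁺ n (plain-lab free)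

    length-dms : length dms ≡ n
    length-dms = Listₚ.length-replicate n

    dt : Tape 8
    dt = counter dms 0

    open Correct labs dt using (lbl; st; posOf; run-compile)
    open Semantics lbl using (⟦_⟧)

    out : List Bool
    out = ⟦ emitter ⟧ []

    B₀ B₁ B₂ : List Sym
    B₀ = labˢ separator ∷ (map labˢ (doubled x) List.ʳ++ [ startˢ ])
    B₁ = List.replicate f (labˢ free) List.ʳ++ B₀
    B₂ = List.replicate r (labˢ padding) List.ʳ++ B₁

    B₂-≡ : B₂ ≡ ms List.ʳ++ [ startˢ ]
    B₂-≡ = sym (begin
      ms List.ʳ++ [ startˢ ]
        ≡⟨ cong (List._ʳ++ [ startˢ ]) (Listₚ.map-++ labˢ (doubled x) _) ⟩
      (map labˢ (doubled x) ++ map labˢ (separator ∷ List.replicate f free ++ List.replicate r padding)) List.ʳ++ [ startˢ ]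
        ≡⟨ Listₚ.++-ʳ++ (map labˢ (doubled x)) ⟩
      map labˢ (List.replicate f free ++ List.replicate r padding) List.ʳ++ B₀
        ≡⟨ cong (List._ʳ++ B₀) (Listₚ.map-++ labˢ (List.replicate f free) _) ⟩
      (map labˢ (List.replicate f free) ++ map labˢ (List.replicate r padding)) List.ʳ++ B₀
        ≡⟨ cong₂ (λ F R → (F ++ R) List.ʳ++ B₀) (Listₚ.map-replicate labˢ f free) (Listₚ.map-replicate labˢ r padding) ⟩
      (List.replicate f (labˢ free) ++ List.replicate r (labˢ padding)) List.ʳ++ B₀
        ≡⟨ Listₚ.++-ʳ++ (List.replicate f (labˢ free)) ⟩
      B₂ ∎)
      where open ≡-Reasoning

    generated : ∀ ps s bl B → 0 + length ps < G → generate ps 0 s ∶ uniform (blank-tape bl) dt (blank-tape B)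
      ⇝ uniform (blank-tape bl) dt (blank-tape (List.replicate (evalPoly ps n) s List.ʳ++ B)) within generate-cost ps n
    generated ps s bl B lt = subst (λ m → generate ps 0 s ∶ uniform (blank-tape bl) dt (blank-tape B)
        ⇝ uniform (blank-tape bl) dt (blank-tape (List.replicate (evalPoly ps m) s List.ʳ++ B)) within generate-cost ps m) length-dms
      (run-resp same-state same-state (run-generate dms plain-dms s ps 0 (uniform (blank-tape bl) dt (blank-tape [])) B lt (λ _ _ → refl)))
      where
      same-state : ∀ {B} ρ → over (uniform (blank-tape bl) dt (blank-tape [])) B ρ ≡ uniform (blank-tape bl) dt (blank-tape B) ρ
      same-state io        = refl
      same-state (depth _) = refl
      same-state (ctr _)   = refl

    final : ∃[ bl ] main ∶ uniform (zipper [] (map bit x)) (blank-tape []) (blank-tape []) ⇝ uniform (result bl out) dt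
          (counter ms 0) within total n (length labs)
    final with run-copy x [] [ startˢ ] [ startˢ ] []
    ... | bl , blanks , copied = bl ,
      run-seq (run-uni stay-put (put startˢ right) (put startˢ right) {zipper []
            (map bit x)} {blank-tape []} {blank-tape []} refl refl refl)
      (run-seq copied
      (run-seq (run-uni stay-put (put endˢ stay) (put (labˢ separator) right) {blank-tape bl} refl (filled dms) refl)
      (run-seq rewound-depth
      (run-seq (generated as (labˢ free) bl B₀ (s≤s (m≤m+n (length as) _)))
      (run-seq (generated bs (labˢ padding) bl B₁ (s≤s (m≤n+m (length bs) _)))
      (run-seq (run-uni stay-put stay-put (put endˢ stay) {blank-tape bl} {dt} refl refl (trans (cong
            (λ B → tape B endˢ []) B₂-≡) (filled ms)))
      (run-seq rewound-ctr
      (run-seq compiled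
      (weaken (s≤s (+-monoˡ-≤ 1 (+-monoˡ-≤ 1 (*-monoˡ-≤ 2 (length-output labs dt emitter []))))) (run-finish out bl blanks))))))))))
      where
      rewound-depth : rewind-depth ∶ uniform (blank-tape bl) (counter dms (suc (length dms))) (blank-tape B₀) ⇝ uniform
            (blank-tape bl) dt (blank-tape B₀) within rewind-cost n
      rewound-depth = subst (λ m → rewind-depth ∶ uniform (blank-tape bl) (counter dms (suc (length dms)))
            (blank-tape B₀) ⇝ uniform (blank-tape bl) dt (blank-tape B₀) within rewind-cost m) length-dms
        (run-rewind plain-dms (depth 0) (s≤s z≤n) (λ τ → uniform (blank-tape bl) τ (blank-tape B₀)) (λ _ → refl)
          (actⁱ (uni stay-put (keep left) stay-put)) (λ τ → run-uni stay-put (keep left) stay-put refl refl refl))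

      rewound-ctr : rewind-ctr ∶ uniform (blank-tape bl) dt (counter ms (suc (length ms))) ⇝ uniform (blank-tape bl) dt
            (counter ms 0) within rewind-cost (length labs)
      rewound-ctr = subst (λ m → rewind-ctr ∶ uniform (blank-tape bl) dt (counter ms (suc (length ms))) ⇝ uniform
            (blank-tape bl) dt (counter ms 0) within rewind-cost m) (Listₚ.length-map labˢ labs)
        (run-rewind plain-ms (ctr 0) (s≤s z≤n) (λ τ → uniform (blank-tape bl) dt τ) (λ _ → refl)
          (actⁱ (uni stay-put stay-put (keep left))) (λ τ → run-uni stay-put stay-put (keep left) refl refl refl))

      compiled : compile emitter ∶ uniform (blank-tape bl) dt (counter ms 0) ⇝ uniform (blank-tape (push out bl)) dt
            (counter ms 0) within time (length labs) emitter
      compiled = run-resp same-state same-state (run-compile emitter ≤-refl [] bl)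
        where
        same-state : ∀ {B} ρ → st B (posOf []) ρ ≡ uniform (blank-tape B) dt (counter ms 0) ρ
        same-state io            = refl
        same-state (depth _)     = refl
        same-state (ctr zero)    = refl
        same-state (ctr (suc _)) = refl

    initial-state : initial (machine main) x ≡ (TM.start (machine main) , vec (uniform (zipper [] (map bit x))
          (blank-tape []) (blank-tape [])))
    initial-state = cong (TM.start (machine main) ,_) (cong₂ _∷_ (first (map bit x)) (sym (trans (Vecₚ.tabulate-cong
          (λ i → rest {zipper [] (map bit x)} (toℕ i))) (constant (G + C)))))
      where
      first : ∀ l → tape [] (proj₁ (uncons l)) (proj₂ (uncons l)) ≡ zipper [] l
      first []      = refl
      first (_ ∷ _) = refl
      rest : ∀ {a} m → uniform a (blank-tape []) (blank-tape []) (role (suc m)) ≡ blank-tape []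
      rest m with role (suc m) in eq
      ... | depth _ = refl
      ... | ctr _   = refl
      ... | io with m <? G | eq
      ... | yes _ | ()
      ... | no  _ | ()
      constant : ∀ m → Vec.tabulate {n = m} (λ _ → blank-tape []) ≡ Vec.replicate m (blank-tape [])
      constant zero    = refl
      constant (suc m) = cong (_ ∷_) (constant m)

    output-result : ∀ bl q b c → output (machine main) (q , vec (uniform (result bl out) b c)) ≡ out
    output-result bl q b c = leading out bl q (Vec.tail (vec (uniform (result bl out) b c)))
      where
      leading : ∀ o bl q τs → output (machine main) (q , moveHead right (head-over-after bl (map bit o ++ [ blank ])) ∷ τs) ≡ o
      leading []      bl q τs = refl
      leading (b ∷ o) bl q τs = cong (b ∷_) (bits o)
        where
        bits : ∀ o → leadingBits (machine main) (map bit o ++ [ blank ]) ≡ o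
        bits []      = refl
        bits (b ∷ o) = cong (b ∷_) (bits o)

  loop-cost-poly : ∀ {F H} → Polynomial F → Polynomial H → Polynomial (λ n → loop-cost (F n) (H n))
  loop-cost-poly f h = poly-suc (poly-+ (poly-+ (poly-* f (poly-suc (poly-+ h (poly-const 1)))) (poly-const 1)) (poly-+
        (poly-* (poly-suc f) (poly-const 2)) (poly-const 1)))

  rewind-cost-poly : ∀ {F} → Polynomial F → Polynomial (λ n → rewind-cost (F n))
  rewind-cost-poly f = poly-+ (poly-* (poly-suc f) (poly-const 2)) (poly-const 1)

  generate-cost-poly : ∀ ps → Polynomial (generate-cost ps)
  generate-cost-poly []       = poly-const 1
  generate-cost-poly (a ∷ ps) = poly-+ (poly-const (append-cost a)) (loop-cost-poly poly-id (generate-cost-poly ps))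

  module _ {F : ℕ → ℕ} (F-poly : Polynomial F) where

    equal-cost-poly : Polynomial (λ n → equal-cost (F n))
    equal-cost-poly = poly-+ (rewind-cost-poly F-poly) (poly-suc (rewind-cost-poly F-poly))

    test-cost-poly : ∀ {m} (e : BExp m) → Polynomial (λ n → test-cost (F n) e)
    test-cost-poly (constᵉ b)   = poly-const 0
    test-cost-poly (eqᵉ x y)    = equal-cost-poly
    test-cost-poly (succᵉ x y)  = poly-suc (poly-+ equal-cost-poly (poly-const 1))
    test-cost-poly (zeroᵉ x)    = poly-const 3
    test-cost-poly (lastᵉ x)    = poly-const 3
    test-cost-poly (labelᵉ p x) = poly-const 1
    test-cost-poly (e ∧ᵉ e′)    = poly-+ (test-cost-poly e) (test-cost-poly e′)
    test-cost-poly (¬ᵉ e)       = test-cost-poly e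

    time-poly : ∀ {m} (e : Emitter m) → Polynomial (λ n → time (F n) e)
    time-poly skip         = poly-const 1
    time-poly (emit b)     = poly-const 1
    time-poly (e ⨾ e′)     = poly-+ (time-poly e) (time-poly e′)
    time-poly (for e)      = loop-cost-poly F-poly (time-poly e)
    time-poly (ifᵉ b e e′) = poly-+ (test-cost-poly b) (poly-+ (time-poly e) (time-poly e′))

  positions : ℕ → ℕ
  positions n = n * 2 + suc (evalPoly as n + evalPoly bs n)

  positions-poly : Polynomial positions
  positions-poly = poly-+ (poly-* poly-id (poly-const 2)) (poly-suc (poly-+ (as , λ _ → ≤-refl) (bs , λ _ → ≤-refl)))

  total-poly : Polynomial (λ n → total n (positions n))
  total-poly = poly-suc (poly-+ (poly-+ (poly-* poly-id (poly-const 4)) (poly-const 1)) (poly-suc (poly-+ (rewind-cost-poly poly-id)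
    (poly-+ (generate-cost-poly as) (poly-+ (generate-cost-poly bs) (poly-suc (poly-+ (rewind-cost-poly positions-poly)
    (poly-+ (time-poly positions-poly emitter) (poly-suc (poly-+ (poly-+ (poly-* (time-poly positions-poly emitter)
          (poly-const 2)) (poly-const 1)) (poly-const 1)))))))))))

  polyTime : ∀ fn → (∀ x → Run.out x ≡ fn x) → PolyTime fn
  polyTime fn spec = machine main , proj₁ total-poly , λ x → computed x (Run.final x)
    where
    computed : ∀ x → ∃[ bl ] main ∶ uniform (zipper [] (map bit x)) (blank-tape []) (blank-tape []) ⇝ uniform (result bl
          (Run.out x)) (Run.dt x) (counter (Run.ms x) 0) within total (length x) (length (Run.labs x)) →
      ∃[ c ] run (machine main) (evalPoly (proj₁ total-poly) (length x)) (initial (machine main) x) ≡ just c × output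
            (machine main) c ≡ fn x
    computed x (bl , runs exec bounded) = _ ,
      trans (cong (run (machine main) (evalPoly (proj₁ total-poly) (length x))) (Run.initial-state x))
        (run-exec main exec (≤-trans bounded (≤-trans (≤-reflexive (cong (total (length x)) (length-labels x (Run.f x)
              (Run.r x)))) (proj₂ total-poly (length x))))) ,
      trans (Run.output-result x bl zero (Run.dt x) (counter (Run.ms x) 0)) (spec x)

-- The reduction

module Reduction (t′ d″ : ℕ) (Mc : TM) (accepts : List Bool → Bool) (pM : List ℕ)
  (computes : ∀ y → ∃[ c ] run Mc (evalPoly pM (length y)) (initial Mc y) ≡ just c × output Mc c ≡ [ accepts y ])
  (p : List ℕ) where

  open Tableau Mc using (_≟ᴰ_; allD; allD-complete; d₀; rel)
  open Hardness t′ d″ _≟ᴰ_ allD allD-complete d₀ rel using (program; module On; unsolvable⇒¬proper)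

  -- The word `pair x u` has twice the length of `x`, plus one, plus the length of `u`, which `p`
  -- bounds. So `steps` bounds the running time of the verifier, and as many padding cells give the
  -- tableau enough rows.
  steps : List ℕ
  steps = pM ∘ᵖ ((1 ∷ 2 ∷ []) +ᵖ p)

  open Generator p steps program using (polyTime; length-labels)

  module _ (x : List Bool) where

    f r : ℕ
    f = evalPoly p (length x)
    r = evalPoly steps (length x)

    lbl : Fin (length (labels x f r)) → Label
    lbl = List.lookup (labels x f r)

    length-pair : ∀ x u → length (pair x u) ≡ length x * 2 + suc (length u)
    length-pair []      u = refl
    length-pair (b ∷ x) u = cong (λ n → suc (suc n)) (length-pair x u)

    enough-time : ∀ u → length u ≤ f → evalPoly pM (length (pair x u)) < length (labels x f r)
    enough-time u u≤ = begin-strict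
      evalPoly pM (length (pair x u))                            ≤⟨ evalPoly-mono pM length≤ ⟩
      evalPoly pM (evalPoly ((1 ∷ 2 ∷ []) +ᵖ p) (length x))      ≡⟨ eval-∘ᵖ pM _ (length x) ⟨
      r                                                          <⟨ s≤s (m≤n+m r f) ⟩
      suc (f + r)                                                ≤⟨ m≤n+m (suc (f + r)) (length x * 2) ⟩
      length x * 2 + suc (f + r)                                 ≡⟨ length-labels x f r ⟨
      length (labels x f r)                                      ∎
      where
      open ≤-Reasoning
      linear : ∀ n → n * 2 + 1 ≡ 1 + n * (2 + n * 0)
      linear = solve-∀
      length≤ : length (pair x u) ≤ evalPoly ((1 ∷ 2 ∷ []) +ᵖ p) (length x)
      length≤ = begin
        length (pair x u)                             ≡⟨ length-pair x u ⟩
        length x * 2 + (1 + length u)                 ≡⟨ +-assoc (length x * 2) 1 (length u) ⟨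
        length x * 2 + 1 + length u                   ≤⟨ +-monoʳ-≤ (length x * 2 + 1) u≤ ⟩
        length x * 2 + 1 + f                          ≡⟨ cong (_+ f) (linear (length x)) ⟩
        evalPoly (1 ∷ 2 ∷ []) (length x) + f          ≡⟨ eval-+ᵖ (1 ∷ 2 ∷ []) p (length x) ⟨
        evalPoly ((1 ∷ 2 ∷ []) +ᵖ p) (length x)       ∎

    module CL = CookLevin Mc accepts pM computes x f r enough-time

    instanceOf : Hypergraph (Numbers.k t′ d″)
    instanceOf = On.hypergraph lbl

    accepted⇒rainbow : ∀ u → length u ≤ f → accepts (pair x u) ≡ true → RainbowColorable instanceOf (Numbers.q t′ d″)
    accepted⇒rainbow u u≤ acc = let (g , solution) = CL.complete u u≤ acc in On.solution⇒rainbow lbl g solution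

    rejected⇒¬colorable : (∀ u → length u ≤ f → accepts (pair x u) ≢ true) → ¬ Colorable instanceOf 2
    rejected⇒¬colorable rejected (χ , proper) = unsolvable⇒¬proper lbl (origin , origin) CL.functional χ proper
      λ g solution → let (u , u≤ , acc) = CL.sound g solution in rejected u u≤ acc
      where
      origin : Fin (length (labels x f r))
      origin = Fin.fromℕ< (≤-<-trans z≤n (enough-time [] z≤n))

  polyTime-instance : PolyTime (encodeHypergraph ∘ instanceOf)
  polyTime-instance = polyTime (encodeHypergraph ∘ instanceOf) (λ x → On.⟦program⟧ (lbl x))

theorem1p2 : ∀ (t d : ℕ) → 1 ≤ t → 2 ≤ d →
    NP-hard (Rainbow (t * d + ⌊ d /2⌋) (t * (d ∸ 1) + 1) 2)
theorem1p2 (suc _) (suc zero) _ (s≤s ())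
theorem1p2 (suc t′) (suc (suc d″)) _ _ L (accepts , (Mc , pM , computes) , p , spec) =
  instanceOf , polyTime-instance ,
  (λ x x∈L → let (u , u≤ , acc) = Equivalence.to (spec x) x∈L in accepted⇒rainbow x u u≤ acc) ,
  (λ x x∉L → rejected⇒¬colorable x (λ u u≤ acc → x∉L (Equivalence.from (spec x) (u , u≤ , acc))))
  where open Reduction t′ d″ Mc accepts pM computes p
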